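{- Let $q\ge 43$ be the order of a projective $3$-space $\mathrm{PG}(3,q)$ and let $\Gamma$ be the graph whose vertices are the chambers of $\mathrm{PG}(3,q)$, two vertices being adjacent when the corresponding chambers are opposite (in general position). Then: (a) The largest independent sets of $\Gamma$ are exactly the sets $F(x)$ where $x$ is a point or a plane of $\mathrm{PG}(3,q)$. (b) Every maximal independent set of $\Gamma$ that is not of the form $F(x)$ for a point or plane $x$ has at most $9(q+1)(5q^2+1)$ elements. (c) If $q\ge 47$, then the chromatic number of $\Gamma$ is $q^2+q$.
   Context: A chamber of $\mathrm{PG}(3,q)$ is a triple $\{P,\ell,\pi\}$ consisting of a point $P$, a line $\ell$ and a plane $\pi$ that are mutually incident. Two chambers $\{P,\ell,\pi\}$ and $\{P',\ell',\pi'\}$ are opposite if $P\notin\pi'$, $\ell$ and $\ell'$ are skew (disjoint), and $P'\notin\pi$. For a point or a plane $x$, $F(x)$ denotes the set of all chambers whose line is incident with $x$ (i.e. contains the point $x$, resp. lies in the plane $x$); each such set is independent in $\Gamma$ and has $(q^2+q+1)(q+1)^2$ elements. -}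

module Defs where

open import Level using (Level; _⊔_)
open import Algebra.Bundles using (CommutativeRing)
open import Data.Nat using (ℕ; _≤_; _<_)
open import Data.Fin using (Fin; zero; suc)
open import Data.List using (List; []; _∷_; length)
open import Data.List.Relation.Unary.Any using (Any)
open import Data.List.Relation.Unary.AllPairs using (AllPairs)
open import Data.Product using (Σ; ∃; ∃₂; _×_; _,_)
open import Data.Sum using (_⊎_)
open import Relation.Nullary using (¬_)
open import Relation.Binary.Definitions using (Decidable)
open import Relation.Binary.PropositionalEquality using (_≡_; _≢_)
open import Function.Bundles using (_⇔_)

record IsFiniteFieldOfOrder {c ℓ} (R : CommutativeRing c ℓ) (q : ℕ) : Set (c ⊔ ℓ) where
  open CommutativeRing R using (Carrier; _≈_; _*_; 0#; 1#)
  field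
    1≉0      : ¬ (1# ≈ 0#)
    inverse  : ∀ x → ¬ (x ≈ 0#) → ∃ λ y → x * y ≈ 1#
    _≟_      : Decidable _≈_
    enum     : Fin q → Carrier
    enum-inj : ∀ i j → enum i ≈ enum j → i ≡ j
    enum-sur : ∀ x → ∃ λ i → enum i ≈ x

module PG3 {c ℓ} (R : CommutativeRing c ℓ) where
  open CommutativeRing R using (Carrier; _≈_; _+_; _*_; 0#; 1#)

  -- vectors of F^4 (also used for linear forms / dual vectors)
  V : Set c
  V = Fin 4 → Carrier

  ⟨_,_⟩ : V → V → Carrier
  ⟨ f , v ⟩ = f zero * v zero + f (suc zero) * v (suc zero)
            + f (suc (suc zero)) * v (suc (suc zero))
            + f (suc (suc (suc zero))) * v (suc (suc (suc zero)))

  NonZero : V → Set ℓ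
  NonZero v = ¬ (∀ i → v i ≈ 0#)

  InSpan : V → V → V → Set (c ⊔ ℓ)
  InSpan a b v = ∃₂ λ s t → ∀ i → v i ≈ s * a i + t * b i

  LinIndep2 : V → V → Set (c ⊔ ℓ)
  LinIndep2 a b = ∀ s t → (∀ i → s * a i + t * b i ≈ 0#) → (s ≈ 0#) × (t ≈ 0#)

  -- points: 1-dim subspaces, spanned by a nonzero vector
  record Point : Set (c ⊔ ℓ) where
    constructor mkPoint
    field
      vec : V
      nz  : NonZero vec

  -- lines: 2-dim subspaces, spanned by two independent vectors
  record Line : Set (c ⊔ ℓ) where
    constructor mkLine
    field
      u w : V
      ind : LinIndep2 u w

  -- planes: 3-dim subspaces, the kernel of a nonzero linear form
  record Plane : Set (c ⊔ ℓ) where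
    constructor mkPlane
    field
      form : V
      nz   : NonZero form

  open Point
  open Line
  open Plane

  _≈P_ : Point → Point → Set (c ⊔ ℓ)
  P ≈P P' = ∃ λ s → ∀ i → vec P' i ≈ s * vec P i

  _≈L_ : Line → Line → Set (c ⊔ ℓ)
  l ≈L l' = (InSpan (u l) (w l) (u l') × InSpan (u l) (w l) (w l'))
          × (InSpan (u l') (w l') (u l) × InSpan (u l') (w l') (w l))

  _≈π_ : Plane → Plane → Set (c ⊔ ℓ)
  π ≈π π' = ∃ λ s → ∀ i → form π' i ≈ s * form π i

  _I-PL_ : Point → Line → Set (c ⊔ ℓ)
  P I-PL l = InSpan (u l) (w l) (vec P)

  _I-Lπ_ : Line → Plane → Set ℓ
  l I-Lπ π = (⟨ form π , u l ⟩ ≈ 0#) × (⟨ form π , w l ⟩ ≈ 0#)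

  _I-Pπ_ : Point → Plane → Set ℓ
  P I-Pπ π = ⟨ form π , vec P ⟩ ≈ 0#

  record Chamber : Set (c ⊔ ℓ) where
    constructor mkChamber
    field
      pt  : Point
      ln  : Line
      pl  : Plane
      pt∈ln : pt I-PL ln
      ln⊆pl : ln I-Lπ pl

  open Chamber

  _≈C_ : Chamber → Chamber → Set (c ⊔ ℓ)
  C ≈C D = (pt C ≈P pt D) × (ln C ≈L ln D) × (pl C ≈π pl D)

  Skew : Line → Line → Set (c ⊔ ℓ)
  Skew l l' = ∀ (P : Point) → P I-PL l → P I-PL l' → Data.Empty.⊥
    where import Data.Empty

  Opposite : Chamber → Chamber → Set (c ⊔ ℓ)
  Opposite C D = ¬ (pt C I-Pπ pl D) × Skew (ln C) (ln D) × ¬ (pt D I-Pπ pl C)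

  -- finite sets of chambers: duplicate-free lists (up to chamber equality)
  _∈C_ : Chamber → List Chamber → Set (c ⊔ ℓ)
  C ∈C S = Any (C ≈C_) S

  UniqueC : List Chamber → Set (c ⊔ ℓ)
  UniqueC S = AllPairs (λ C D → ¬ (C ≈C D)) S

  Independent : List Chamber → Set (c ⊔ ℓ)
  Independent S = ∀ C D → C ∈C S → D ∈C S → ¬ Opposite C D

  IndepSet : List Chamber → Set (c ⊔ ℓ)
  IndepSet S = UniqueC S × Independent S

  Largest : List Chamber → Set (c ⊔ ℓ)
  Largest S = IndepSet S × (∀ T → IndepSet T → length T ≤ length S)

  MaximalIndep : List Chamber → Set (c ⊔ ℓ)
  MaximalIndep S = IndepSet S × (∀ C → Independent (C ∷ S) → C ∈C S)

  Represents : List Chamber → (Chamber → Set (c ⊔ ℓ)) → Set (c ⊔ ℓ)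
  Represents S X = ∀ C → (C ∈C S) ⇔ X C

  F-pt : Point → Chamber → Set (c ⊔ ℓ)
  F-pt P C = P I-PL ln C

  F-pl : Plane → Chamber → Set (c ⊔ ℓ)
  F-pl π C = Level.Lift (c ⊔ ℓ) (ln C I-Lπ π)

  IsF : List Chamber → Set (c ⊔ ℓ)
  IsF S = (∃ λ (P : Point) → Represents S (F-pt P)) ⊎ (∃ λ (π : Plane) → Represents S (F-pl π))

  ProperColouring : ℕ → Set (c ⊔ ℓ)
  ProperColouring k = Σ (Chamber → Fin k) λ col →
      (∀ C D → C ≈C D → col C ≡ col D) × (∀ C D → Opposite C D → col C ≢ col D)

  ChromaticNumber : ℕ → Set (c ⊔ ℓ)
  ChromaticNumber n = ProperColouring n × (∀ k → k < n → ¬ ProperColouring k)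

{-# OPTIONS --safe #-}
module Submission where

-- Write a chamber as an incident triple (x , l , e) of a point, a line and a plane.  Let S be independent.
-- If S contains (x₁ , l , e) and (x₂ , l , e) with x₁ ≢ x₂, then every chamber of S whose line is skew to l has
-- its point in e.  Call a line heavy if this happens for two planes e on l; a heavy line meets all lines of S,
-- and a line that is not heavy carries at most 2q + 1 chambers of S.  Unless S lies in some F(x) there are at
-- most q + 1 heavy lines, since three heavy lines forming a triangle or a tripod force all lines of S into a
-- plane or through a point.  If the same configuration occurs for two lines l of one plane e, every chamber of S
-- has its point in e or its line through a fixed point; two such planes (and two such points, dually) make S
-- small.  Otherwise fix three chambers of S in general position.  Each chamber of S stands to each of them in one
-- of three relations: the lines meet, or the point of one lies in the plane of the other, or vice versa.  Any
-- combination of these leaves O(q³) chambers, and altogether S has at most 25(q+1)³ chambers or lies in an F(x).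
--
-- Suppose now that the chambers are covered by a classes F(x) of points, b classes F(x) of planes and r other
-- classes, a + b + r < q² + q.  At most 25r(q+1) lines avoid the a points and b planes.  If some plane e contains
-- more than q of the points and some point x lies on more than q of the planes, then each of the a + b elements
-- covers at most q² new lines off x and not in e, which is too few.  Otherwise, up to duality, every plane
-- contains at most q of the points; a plane that is not one of the b has at least q² + q − b − qn uncovered
-- lines, where n is the number of points in it, and the second moment of n gives a contradiction.  Conversely,
-- every line passes through one of the q² points of a plane e₀ off a line l₀ ⊂ e₀ or lies in one of the q planes
-- on l₀ other than e₀, which yields a colouring with q² + q colours.

open import Defs
open import Level using (Level; lift; lower) renaming (_⊔_ to _⊔ˡ_)
open import Algebra.Bundles using (CommutativeRing)
import Algebra.Properties.Group as GroupProperties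
import Algebra.Properties.Ring as RingProperties
open import Data.Nat
open import Data.Nat.Properties
open import Data.Nat.Tactic.RingSolver using (solve-∀)
import Algebra.Properties.Semiring.Sum +-*-semiring as Σ
open import Data.Bool using (Bool; true; false; _∧_; _∨_; not; if_then_else_)
import Data.Bool.Properties as Bool
open import Data.Maybe using (Maybe; just; nothing)
open import Data.Fin using (Fin; zero; suc)
import Data.Fin as Fin
import Data.Fin.Properties as Fin
open import Data.List using (List; []; _∷_; length; concat; tabulate)
open import Data.List.Relation.Unary.Any using (Any; here; there; any?)
import Data.List.Relation.Unary.Any as Any
import Data.List.Relation.Unary.Any.Properties as Any
import Data.List.Relation.Unary.All.Properties as All
open import Data.List.Relation.Unary.AllPairs using ([]; _∷_)
open import Data.Product using (∃; ∃₂; _×_; _,_; proj₁; proj₂)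
open import Data.Sum using (_⊎_; inj₁; inj₂)
open import Data.Empty using (⊥; ⊥-elim)
open import Function using (_∘_; case_of_)
open import Function.Bundles using (_⇔_; mk⇔; Equivalence)
open import Relation.Nullary using (¬_; Dec; yes; no; ⌊_⌋)
open import Relation.Nullary.Decidable using (_×-dec_; map′; ¬?; decidable-stable)
open import Relation.Binary.PropositionalEquality
import Relation.Binary.Reasoning.Setoid as SetoidReasoning

-- Counting with sums over Fin

-- With (q + 1)³ as the unit, 25 = 1 + 2 + 22. The heavy lines cost 1. If the second configuration
-- occurs in at most one plane and at most one point, deleting these costs 1 each. Three chambers in
-- general position then leave 8 + 7 + 7, one summand for each relation to the first of them. The
-- deletions precede the splitting because a pair of a line and a plane may carry q + 1 chambers,
-- and many such pairs would spoil the order q³; with at most one per line, plane or point, a line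
-- has at most 2q + 1 chambers and a plane or point at most (q + 1)². In the moment argument every
-- plane is weighted with q - n. The assumption that a plane contains at most q of the points makes
-- this weight nonnegative, and the weighted sum of n contains -n², so that a lower bound for the
-- second moment works against the cover. The condition q ≥ 47 ensures that the uncovered lines
-- consume at most five ninths of the main term.

opaque
  sum : ∀ {n} → (Fin n → ℕ) → ℕ
  sum = Σ.sum

  sum-cong-≗ : ∀ {n} {f g : Fin n → ℕ} → (∀ i → f i ≡ g i) → sum f ≡ sum g
  sum-cong-≗ = Σ.sum-cong-≗

  ∑-comm : ∀ {m n} (f : Fin m → Fin n → ℕ) → sum (λ i → sum (f i)) ≡ sum (λ j → sum (λ i → f i j))
  ∑-comm = Σ.∑-comm

  ∑-distrib-+ : ∀ {n} (f g : Fin n → ℕ) → sum (λ i → f i + g i) ≡ sum f + sum g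
  ∑-distrib-+ = Σ.∑-distrib-+

  *-distribʳ-sum : ∀ {n} c (f : Fin n → ℕ) → sum f * c ≡ sum (λ i → f i * c)
  *-distribʳ-sum = Σ.*-distribʳ-sum

  sum-mono : ∀ {n} {f g : Fin n → ℕ} → (∀ i → f i ≤ g i) → sum f ≤ sum g
  sum-mono {zero}  h = z≤n
  sum-mono {suc n} h = +-mono-≤ (h zero) (sum-mono (h ∘ suc))

  sum-const : ∀ n c → sum {n} (λ _ → c) ≡ n * c
  sum-const zero    c = refl
  sum-const (suc n) c = cong (c +_) (sum-const n c)

  term≤sum : ∀ {n} (f : Fin n → ℕ) i → f i ≤ sum f
  term≤sum f zero    = m≤m+n (f zero) _
  term≤sum f (suc i) = ≤-trans (term≤sum (f ∘ suc) i) (m≤n+m _ (f zero))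

sum-zero : ∀ n → sum {n} (λ _ → 0) ≡ 0
sum-zero n = trans (sum-const n 0) (*-zeroʳ n)

ι : Bool → ℕ
ι true  = 1
ι false = 0

# : ∀ {n} → (Fin n → Bool) → ℕ
# p = sum (ι ∘ p)

∧-intro : ∀ {a b} → a ≡ true → b ≡ true → a ∧ b ≡ true
∧-intro refl refl = refl

∧-elim : ∀ {a b} → a ∧ b ≡ true → a ≡ true × b ≡ true
∧-elim {true} {true} _ = refl , refl

true≢false : ∀ {b} → b ≡ true → b ≡ false → ⊥
true≢false refl ()

not-true : ∀ {b} → b ≡ false → not b ≡ true
not-true refl = refl

not-false : ∀ {b} → not b ≡ true → b ≡ false
not-false {false} _ = refl

does-true : ∀ {a} {A : Set a} (d : Dec A) → A → ⌊ d ⌋ ≡ true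
does-true (yes _) _ = refl
does-true (no ¬a) a = ⊥-elim (¬a a)

does-elim : ∀ {a} {A : Set a} (d : Dec A) → ⌊ d ⌋ ≡ true → A
does-elim (yes a) _ = a

decide : ∀ b → (b ≡ true) ⊎ (b ≡ false)
decide true  = inj₁ refl
decide false = inj₂ refl

decide-not : ∀ b → (b ≡ true) ⊎ (not b ≡ true)
decide-not true  = inj₁ refl
decide-not false = inj₂ refl

true? : ∀ b → Dec (b ≡ true)
true? b = b Bool.≟ true

opaque
  some : ∀ {n} → (Fin n → Bool) → Bool
  some p = ⌊ Fin.any? (λ i → true? (p i)) ⌋

  some-intro : ∀ {n} (p : Fin n → Bool) i → p i ≡ true → some p ≡ true
  some-intro p i pi = does-true (Fin.any? (λ i → true? (p i))) (i , pi)

  some-elim : ∀ {n} (p : Fin n → Bool) → some p ≡ true → ∃ λ i → p i ≡ true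
  some-elim p = does-elim (Fin.any? (λ i → true? (p i)))

infix 4 _==_
opaque
  _==_ : ∀ {n} → Fin n → Fin n → Bool
  i == j = ⌊ i Fin.≟ j ⌋

  ==-refl : ∀ {n} {i j : Fin n} → i ≡ j → (i == j) ≡ true
  ==-refl {i = i} {j} = does-true (i Fin.≟ j)

  ==-elim : ∀ {n} (i j : Fin n) → (i == j) ≡ true → i ≡ j
  ==-elim i j = does-elim (i Fin.≟ j)

≢⇒≠ : ∀ {n} {i j : Fin n} → i ≢ j → (i == j) ≡ false
≢⇒≠ {i = i} {j} i≢j with decide (i == j)
... | inj₁ eq = ⊥-elim (i≢j (==-elim i j eq))
... | inj₂ ne = ne

≠⇒≢ : ∀ {n} {i j : Fin n} → (i == j) ≡ false → i ≢ j
≠⇒≢ ne eq = true≢false (==-refl eq) ne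

ι-mono : ∀ {a b} → (a ≡ true → b ≡ true) → ι a ≤ ι b
ι-mono {false} _ = z≤n
ι-mono {true} h rewrite h refl = ≤-refl

#-mono : ∀ {n} {p r : Fin n → Bool} → (∀ i → p i ≡ true → r i ≡ true) → # p ≤ # r
#-mono h = sum-mono (λ i → ι-mono (h i))

#-cong : ∀ {n} {p r : Fin n → Bool} → (∀ i → p i ≡ true → r i ≡ true) →
         (∀ i → r i ≡ true → p i ≡ true) → # p ≡ # r
#-cong h k = ≤-antisym (#-mono h) (#-mono k)

#-≥1 : ∀ {n} (p : Fin n → Bool) i → p i ≡ true → 1 ≤ # p
#-≥1 p i pi = ≤-trans (≤-reflexive (sym (cong ι pi))) (term≤sum (ι ∘ p) i)

opaque
  unfolding sum
  #-≤1 : ∀ {n} (p : Fin n → Bool) → (∀ i j → p i ≡ true → p j ≡ true → i ≡ j) → # p ≤ 1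
  #-≤1 {zero}  p h = z≤n
  #-≤1 {suc n} p h with p zero in eq
  ... | true  = s≤s (≤-reflexive (trans (sum-cong-≗ none) (sum-zero n)))
    where
    none : ∀ i → ι (p (suc i)) ≡ 0
    none i with p (suc i) in eqi
    ... | false = refl
    ... | true with h zero (suc i) eq eqi
    ... | ()
  ... | false = #-≤1 (p ∘ suc) (λ i j pi pj → Fin.suc-injective (h (suc i) (suc j) pi pj))

#-none : ∀ {n} (p : Fin n → Bool) → (∀ i → p i ≡ true → ⊥) → # p ≡ 0
#-none {n} p h = trans (sum-cong-≗ none) (sum-zero n)
  where
  none : ∀ i → ι (p i) ≡ 0
  none i with p i in eq
  ... | false = refl
  ... | true = ⊥-elim (h i eq)

#-all : ∀ n → # {n} (λ _ → true) ≡ n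
#-all n = trans (sum-const n 1) (*-identityʳ n)

weighted-sum-≤ : ∀ {n} (p : Fin n → Bool) (f : Fin n → ℕ) c →
                  (∀ i → p i ≡ true → f i ≤ c) → sum (λ i → ι (p i) * f i) ≤ # p * c
weighted-sum-≤ p f c h = ≤-trans (sum-mono pointwise) (≤-reflexive (sym (*-distribʳ-sum c (ι ∘ p))))
  where
  pointwise : ∀ i → ι (p i) * f i ≤ ι (p i) * c
  pointwise i with p i in eq
  ... | true  = +-monoˡ-≤ 0 (h i eq)
  ... | false = z≤n

-- Both sides bound the number of pairs of `D` and `E` that stand in `R`. Equalities of counts are
-- obtained by using it once in each direction.
double : ∀ {m n} (D : Fin m → Bool) (E : Fin n → Bool) (R : Fin m → Fin n → Bool) c d →
         (∀ x → D x ≡ true → c ≤ # (λ y → E y ∧ R x y)) →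
         (∀ y → E y ≡ true → # (λ x → D x ∧ R x y) ≤ d) →
         # D * c ≤ # E * d
double D E R c d lo hi = begin
  # D * c      ≡⟨ *-distribʳ-sum c (ι ∘ D) ⟩
  sum (λ x → ι (D x) * c)      ≤⟨ sum-mono lo′ ⟩
  sum (λ x → sum (λ y → t x y))      ≡⟨ ∑-comm t ⟩
  sum (λ y → sum (λ x → t x y))      ≤⟨ sum-mono hi′ ⟩
  sum (λ y → ι (E y) * d)      ≡⟨ *-distribʳ-sum d (ι ∘ E) ⟨
  # E * d      ∎
  where
  open ≤-Reasoning
  t : ∀ x y → ℕ
  t x y = ι (D x ∧ (E y ∧ R x y))
  lo′ : ∀ x → ι (D x) * c ≤ sum (t x)
  lo′ x with D x in eq
  ... | true  = ≤-trans (≤-reflexive (+-identityʳ c)) (lo x eq)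
  ... | false = z≤n
  hi′ : ∀ y → sum (λ x → t x y) ≤ ι (E y) * d
  hi′ y with E y in eq
  ... | true  = ≤-trans (hi y eq) (≤-reflexive (sym (+-identityʳ d)))
  ... | false = ≤-reflexive (#-none _ (λ x h → true≢false (proj₂ (∧-elim {D x} h)) refl))

-- Double counting with `c` = `d` = 1. An injection may thus be given as a relation that is total on
-- `D` and allows at most one `x` for each `y`.
matching : ∀ {m n} (D : Fin m → Bool) (E : Fin n → Bool) (R : Fin m → Fin n → Bool) →
           (∀ x → D x ≡ true → ∃ λ y → E y ≡ true × R x y ≡ true) →
           (∀ x x′ y → D x ≡ true → D x′ ≡ true → E y ≡ true → R x y ≡ true → R x′ y ≡ true → x ≡ x′) →
           # D ≤ # E
matching D E R ex un = begin
  # D      ≡⟨ *-identityʳ (# D) ⟨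
  # D * 1  ≤⟨ double D E R 1 1 (λ x d → let (y , e , r) = ex x d in #-≥1 _ y (∧-intro e r))
                (λ y e → #-≤1 _ (λ x x′ h h′ →
                   let (d , r) = ∧-elim h ; (d′ , r′) = ∧-elim h′ in un x x′ y d d′ e r r′)) ⟩
  # E * 1  ≡⟨ *-identityʳ (# E) ⟩
  # E      ∎
  where open ≤-Reasoning

#-split : ∀ {n} (p r : Fin n → Bool) → # p ≡ # (λ i → p i ∧ r i) + # (λ i → p i ∧ not (r i))
#-split p r = trans (sum-cong-≗ split) (∑-distrib-+ (λ i → ι (p i ∧ r i)) (λ i → ι (p i ∧ not (r i))))
  where
  split : ∀ i → ι (p i) ≡ ι (p i ∧ r i) + ι (p i ∧ not (r i))
  split i with p i | r i
  ... | true  | true  = refl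
  ... | true  | false = refl
  ... | false | _ = refl

#-single : ∀ {n} (i : Fin n) → # (λ j → j == i) ≡ 1
#-single i = ≤-antisym (#-≤1 _ (λ a b p r → trans (==-elim a i p) (sym (==-elim b i r)))) (#-≥1 _ i (==-refl refl))

#-remove : ∀ {n} (p : Fin n → Bool) i → p i ≡ true → # p ≡ suc (# (λ j → p j ∧ not (j == i)))
#-remove p i pi = trans (#-split p (_== i)) (cong (_+ # (λ j → p j ∧ not (j == i)))
  (≤-antisym (#-≤1 _ (λ a b h k → trans (==-elim a i (proj₂ (∧-elim {p a} h))) (sym (==-elim b i (proj₂ (∧-elim {p b} k))))))
             (#-≥1 _ i (∧-intro pi (==-refl refl)))))

-- Away from the single index where `f` may exceed 1, an index in `D` contributes at most 1; the
-- exceptional one contributes at most `q` more. With `D` the planes on a line this gives 2q + 1,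
-- with the lines of a plane (q + 1)².
one-large : ∀ {n} (D : Fin n → Bool) (f : Fin n → ℕ) q → (∀ i → f i ≤ ι (D i) * suc q) →
            (∀ i j → 2 ≤ f i → 2 ≤ f j → i ≡ j) → sum f ≤ # D + q
one-large D f q bound uniq = begin
  sum f      ≤⟨ sum-mono pointwise ⟩
  sum (λ i → ι (D i) + ι (big i) * q)      ≡⟨ ∑-distrib-+ (ι ∘ D) (λ i → ι (big i) * q) ⟩
  # D + sum (λ i → ι (big i) * q)      ≡⟨ cong (# D +_) (*-distribʳ-sum q (ι ∘ big)) ⟨
  # D + # big * q      ≤⟨ +-monoʳ-≤ (# D) (*-monoˡ-≤ q (#-≤1 big (λ i j bi bj →
                                                            uniq i j (does-elim (2 ≤? f i) bi) (does-elim (2 ≤? f j) bj)))) ⟩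
  # D + 1 * q      ≡⟨ cong (# D +_) (*-identityˡ q) ⟩
  # D + q      ∎
  where
  open ≤-Reasoning
  big : ∀ i → Bool
  big i = ⌊ 2 ≤? f i ⌋
  pointwise : ∀ i → f i ≤ ι (D i) + ι (big i) * q
  pointwise i with bound i
  ... | b with D i
  ... | false = ≤-trans b z≤n
  ... | true with 2 ≤? f i
  ... | yes _ = ≤-trans b (≤-reflexive (cong suc refl))
  ... | no ¬2 = ≤-trans (≤-pred (≰⇒> ¬2)) (m≤m+n 1 0)

#-≥2 : ∀ {n} (p : Fin n → Bool) → 2 ≤ # p → ∃₂ λ i j → i ≢ j × p i ≡ true × p j ≡ true
#-≥2 p h with Fin.any? (λ i → true? (p i))
... | no none = ⊥-elim (<⇒≱ h (≤-trans (≤-reflexive (#-none p (λ i pi → none (i , pi)))) z≤n))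
... | yes (i , pi) with Fin.any? (λ j → true? (p j ∧ not (j == i)))
... | yes (j , pj) = i , j , (λ eq → true≢false (==-refl {i = j} (sym eq)) (not-false (proj₂ (∧-elim {p j} pj)))) , pi , proj₁ (∧-elim pj)
... | no none = ⊥-elim (<⇒≱ h (≤-reflexive (trans (#-remove p i pi) (cong suc (#-none _ (λ j pj → none (j , pj)))))))

#-other : ∀ {n} (p : Fin n → Bool) → 2 ≤ # p → ∀ i → ∃ λ j → j ≢ i × p j ≡ true
#-other p h i with #-≥2 p h
... | a , b , a≢b , pa , pb with a Fin.≟ i
... | yes refl = b , (λ eq → a≢b (sym eq)) , pb
... | no a≢i = a , a≢i , pa

-- Projective 3-spaces

-- pl x l and le e l say that the line l is incident with the point x and with the plane e; in this argument order
-- duality just exchanges pl and le.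
record Geometry (q : ℕ) : Set where
  field
    nP nL nE : ℕ
    pl : Fin nP → Fin nL → Bool
    le : Fin nE → Fin nL → Bool
    pe : Fin nP → Fin nE → Bool
    join : ∀ x y → ∃ λ l → pl x l ≡ true × pl y l ≡ true
    meet : ∀ e f → ∃ λ l → le e l ≡ true × le f l ≡ true
    cut  : ∀ e l → ∃ λ x → pl x l ≡ true × pe x e ≡ true
    span : ∀ x l → ∃ λ e → le e l ≡ true × pe x e ≡ true
    join-unique : ∀ {x y l m} → x ≢ y → pl x l ≡ true → pl y l ≡ true → pl x m ≡ true → pl y m ≡ true → l ≡ m
    meet-unique : ∀ {e f l m} → e ≢ f → le e l ≡ true → le f l ≡ true → le e m ≡ true → le f m ≡ true → l ≡ m
    flag  : ∀ {x l e} → pl x l ≡ true → le e l ≡ true → pe x e ≡ true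
    line⊆ : ∀ {x y l e} → x ≢ y → pl x l ≡ true → pl y l ≡ true → pe x e ≡ true → pe y e ≡ true → le e l ≡ true
    line∋ : ∀ {e f l x} → e ≢ f → le e l ≡ true → le f l ≡ true → pe x e ≡ true → pe x f ≡ true → pl x l ≡ true
    #points-on : ∀ l → # (λ x → pl x l) ≡ suc q
    #planes-on : ∀ l → # (λ e → le e l) ≡ suc q
    off-plane : ∀ e → ∃ λ x → pe x e ≡ false
    off-point : ∀ x → ∃ λ e → pe x e ≡ false
    a-point : Fin nP
    a-plane : Fin nE
    1≤q : 1 ≤ q

-- Each axiom is accompanied by its dual, so dualising only permutes the fields. Every statement
-- about a geometry is thereby available with points and planes exchanged; module names with a star
-- are such instances.
dual : ∀ {q} → Geometry q → Geometry q
dual G = record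
  { nP = nE ; nL = nL ; nE = nP ; pl = le ; le = pl ; pe = λ e x → pe x e
  ; join = meet ; meet = join ; cut = span ; span = cut
  ; join-unique = meet-unique ; meet-unique = join-unique
  ; flag = λ p r → flag r p ; line⊆ = line∋ ; line∋ = line⊆
  ; #points-on = #planes-on ; #planes-on = #points-on
  ; off-plane = off-point ; off-point = off-plane
  ; a-point = a-plane ; a-plane = a-point ; 1≤q = 1≤q }
  where open Geometry G

module Incidence {q : ℕ} (G : Geometry q) where
  open Geometry G

  other-plane : ∀ l e → ∃ λ f → f ≢ e × le f l ≡ true
  other-plane l e = #-other (λ f → le f l) (≤-trans (s≤s 1≤q) (≤-reflexive (sym (#planes-on l)))) e

  Meet : Fin nL → Fin nL → Set
  Meet l m = ∃ λ x → pl x l ≡ true × pl x m ≡ true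

  -- A second plane `f` on `m` cuts `l` in a point of both `e` and `f`, hence of `m`. In the dual
  -- geometry this says that two lines that meet lie in a common plane.
  coplanar⇒Meet : ∀ {e l m} → le e l ≡ true → le e m ≡ true → Meet l m
  coplanar⇒Meet {e} {l} {m} el em with other-plane m e
  ... | f , f≢e , fm with cut f l
  ... | x , xl , xf = x , xl , line∋ f≢e fm em xf (flag xl el)

  meets : Fin nL → Fin nL → Bool
  meets l m = some (λ x → pl x l ∧ pl x m)

  meets-intro : ∀ {l m} → Meet l m → meets l m ≡ true
  meets-intro (x , xl , xm) = some-intro _ x (∧-intro xl xm)

  meets-elim : ∀ {l m} → meets l m ≡ true → Meet l m
  meets-elim {l} {m} h with some-elim (λ x → pl x l ∧ pl x m) h
  ... | x , k = x , ∧-elim k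

  meet-point-unique : ∀ {l m x y} → l ≢ m → pl x l ≡ true → pl x m ≡ true → pl y l ≡ true → pl y m ≡ true → x ≡ y
  meet-point-unique {x = x} {y} l≢m xl xm yl ym with x Fin.≟ y
  ... | yes eq = eq
  ... | no x≢y = ⊥-elim (l≢m (join-unique x≢y xl yl xm ym))

  cut-unique : ∀ {l e x y} → le e l ≡ false → pl x l ≡ true → pe x e ≡ true → pl y l ≡ true → pe y e ≡ true → x ≡ y
  cut-unique {x = x} {y} l⊄e xl xe yl ye with x Fin.≟ y
  ... | yes eq = eq
  ... | no x≢y = ⊥-elim (true≢false (line⊆ x≢y xl yl xe ye) l⊄e)

  line-off-point : ∀ {x e} → pe x e ≡ true → ∃ λ l → le e l ≡ true × pl x l ≡ false
  line-off-point {x} {e} xe with off-point x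
  ... | f , x∉f with meet e f
  ... | l , el , fl with decide (pl x l)
  ... | inj₁ xl = ⊥-elim (true≢false (flag xl fl) x∉f)
  ... | inj₂ x∉l = l , el , x∉l

  ∌⇒≢ : ∀ {x y l} → pl x l ≡ true → pl y l ≡ false → y ≢ x
  ∌⇒≢ xl y∉l refl = true≢false xl y∉l

  join-in-plane : ∀ {x y e} → pe x e ≡ true → pe y e ≡ true → x ≢ y →
                  ∃ λ l → pl x l ≡ true × pl y l ≡ true × le e l ≡ true
  join-in-plane {x} {y} xe ye x≢y with join x y
  ... | l , xl , yl = l , xl , yl , line⊆ x≢y xl yl xe ye

  -- The lines of the pencil correspond to the points of a line `m` of the plane that misses `x`.
  #pencil : ∀ {x e} → pe x e ≡ true → # (λ l → pl x l ∧ le e l) ≡ suc q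
  #pencil {x} {e} xe with line-off-point xe
  ... | m , em , x∉m = trans (≤-antisym
      (matching (λ l → pl x l ∧ le e l) (λ y → pl y m) (λ l y → pl y l)
        (λ l h → let (xl , el) = ∧-elim {pl x l} h ; (y , yl , ym) = coplanar⇒Meet el em in y , ym , yl)
        (λ l l′ y h h′ ym yl yl′ → join-unique (∌⇒≢ ym x∉m) (proj₁ (∧-elim h)) yl (proj₁ (∧-elim h′)) yl′))
      (matching (λ y → pl y m) (λ l → pl x l ∧ le e l) (λ y l → pl y l)
        (λ y ym → let (l , xl , yl , el) = join-in-plane xe (flag ym em) (∌⇒≢ ym x∉m) in l , ∧-intro xl el , yl)
        (λ y y′ l ym ym′ h yl yl′ → meet-point-unique
           (λ { refl → true≢false (proj₁ (∧-elim h)) x∉m }) yl ym yl′ ym′)))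
    (#points-on m)

  point-in-plane : ∀ e → ∃ λ x → pe x e ≡ true
  point-in-plane e with join a-point a-point
  ... | l , _ with cut e l
  ... | x , _ , xe = x , xe

  line-in-plane : ∀ e → ∃ λ l → le e l ≡ true
  line-in-plane e with meet e e
  ... | l , el , _ = l , el

  #on-minus : ∀ {x l} → pl x l ≡ true → # (λ y → pl y l ∧ not (y == x)) ≡ q
  #on-minus {x} {l} xl = suc-injective (trans (sym (#-remove (λ y → pl y l) x xl)) (#points-on l))

  ≠-elim : ∀ {n} {x y : Fin n} → not (y == x) ≡ true → y ≢ x
  ≠-elim h = ≠⇒≢ (not-false h)

  ≠-intro : ∀ {n} {x y : Fin n} → y ≢ x → not (y == x) ≡ true
  ≠-intro h = not-true (≢⇒≠ h)

  -- Every point other than `x` lies on exactly one line of the pencil at `x`, and each of these q +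
  -- 1 lines has q further points.
  #points-in : ∀ e → # (λ y → pe y e) ≡ q * q + q + 1
  #points-in e with point-in-plane e
  ... | x , xe = begin-equality
      # (λ y → pe y e)      ≡⟨ #-remove (λ y → pe y e) x xe ⟩
      suc (# D)      ≡⟨ cong suc (*-identityʳ (# D)) ⟨
      suc (# D * 1)      ≡⟨ cong suc (≤-antisym
          (double D E pl 1 q
            (λ y h → let (ye , ne) = ∧-elim {pe y e} h
                         (l , xl , yl , el) = join-in-plane xe ye (λ eq → ≠-elim ne (sym eq))
                     in #-≥1 _ l (∧-intro (∧-intro xl el) yl))
            (λ l h → let (xl , el) = ∧-elim {pl x l} h in ≤-trans
               (#-mono (λ y k → let (d , yl) = ∧-elim {D y} k in ∧-intro yl (proj₂ (∧-elim d))))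
               (≤-reflexive (#on-minus xl))))
          (double E D (λ l y → pl y l) q 1
            (λ l h → let (xl , el) = ∧-elim {pl x l} h in ≤-trans (≤-reflexive (sym (#on-minus xl)))
               (#-mono (λ y k → let (yl , ne) = ∧-elim {pl y l} k in ∧-intro (∧-intro (flag yl el) ne) yl)))
            (λ y h → let (ye , ne) = ∧-elim {pe y e} h in #-≤1 _ (λ l l′ k k′ →
               let (e₁ , yl) = ∧-elim {E l} k ; (e₂ , yl′) = ∧-elim {E l′} k′
               in join-unique (≠-elim ne) yl (proj₁ (∧-elim e₁)) yl′ (proj₁ (∧-elim e₂)))))) ⟩
      suc (# E * q)      ≡⟨ cong (λ z → suc (z * q)) (#pencil xe) ⟩
      suc (suc q * q)      ≡⟨ arith q ⟩
      q * q + q + 1      ∎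
    where
    open ≤-Reasoning
    D = λ y → pe y e ∧ not (y == x)
    E = λ l → pl x l ∧ le e l
    arith : ∀ q → suc (suc q * q) ≡ q * q + q + 1
    arith = solve-∀

  -- Projection from `x`: a line through `x` is determined by its trace in a plane off `x`.
  #lines-on : ∀ x → # (λ l → pl x l) ≡ q * q + q + 1
  #lines-on x with off-point x
  ... | e , x∉e = trans (≤-antisym
      (matching (λ l → pl x l) (λ y → pe y e) (λ l y → pl y l)
        (λ l xl → let (y , yl , ye) = cut e l in y , ye , yl)
        (λ l l′ y xl xl′ ye yl yl′ → join-unique (λ { refl → true≢false ye x∉e }) xl yl xl′ yl′))
      (matching (λ y → pe y e) (λ l → pl x l) (λ y l → pl y l)
        (λ y ye → let (l , xl , yl) = join x y in l , xl , yl)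
        (λ y y′ l ye ye′ xl yl yl′ → cut-unique (off l xl) yl ye yl′ ye′)))
    (#points-in e)
    where
    off : ∀ l → pl x l ≡ true → le e l ≡ false
    off l xl with decide (le e l)
    ... | inj₁ el = ⊥-elim (true≢false (flag xl el) x∉e)
    ... | inj₂ ne = ne

  #points : nP ≡ q * q * q + q * q + q + 1
  #points = begin-equality
      nP      ≡⟨ #-all nP ⟨
      # {nP} (λ _ → true)      ≡⟨ #-remove (λ _ → true) x refl ⟩
      suc (# D)      ≡⟨ cong suc (*-identityʳ (# D)) ⟨
      suc (# D * 1)      ≡⟨ cong suc (≤-antisym
          (double D E pl 1 q
            (λ y ne → let (l , xl , yl) = join x y in #-≥1 _ l (∧-intro xl yl))
            (λ l xl → ≤-trans (#-mono (λ y k → let (ne , yl) = ∧-elim {D y} k in ∧-intro yl ne))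
                              (≤-reflexive (#on-minus xl))))
          (double E D (λ l y → pl y l) q 1
            (λ l xl → ≤-trans (≤-reflexive (sym (#on-minus xl)))
               (#-mono (λ y k → let (yl , ne) = ∧-elim {pl y l} k in ∧-intro ne yl)))
            (λ y ne → #-≤1 _ (λ l l′ k k′ →
               let (xl , yl) = ∧-elim {E l} k ; (xl′ , yl′) = ∧-elim {E l′} k′
               in join-unique (≠-elim ne) yl xl yl′ xl′)))) ⟩
      suc (# E * q)      ≡⟨ cong (λ z → suc (z * q)) (#lines-on x) ⟩
      suc ((q * q + q + 1) * q)     ≡⟨ arith q ⟩
      q * q * q + q * q + q + 1     ∎
    where
    open ≤-Reasoning
    x = a-point
    D = λ y → not (y == x)
    E = λ l → pl x l
    arith : ∀ q → suc ((q * q + q + 1) * q) ≡ q * q * q + q * q + q + 1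
    arith = solve-∀

  -- Incident pairs of a point and a line are counted in two ways, and the factor q + 1 is cancelled
  -- in place of a division.
  #lines : nL ≡ (q * q + 1) * (q * q + q + 1)
  #lines = *-cancelʳ-≡ nL _ (suc q) (begin-equality
      nL * suc q      ≡⟨ cong (_* suc q) (#-all nL) ⟨
      # {nL} D * suc q      ≡⟨ ≤-antisym
          (double D E (λ l x → pl x l) (suc q) m
            (λ l _ → ≤-reflexive (sym (#points-on l)))
            (λ x _ → ≤-reflexive (#lines-on x)))
          (double E D pl m (suc q)
            (λ x _ → ≤-reflexive (sym (#lines-on x)))
            (λ l _ → ≤-reflexive (#points-on l))) ⟩
      # {nP} E * m      ≡⟨ cong (_* m) (trans (#-all nP) #points) ⟩
      (q * q * q + q * q + q + 1) * m ≡⟨ arith q ⟩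
      (q * q + 1) * m * suc q      ∎)
    where
    open ≤-Reasoning
    D : Fin nL → Bool
    D _ = true
    E : Fin nP → Bool
    E _ = true
    m = q * q + q + 1
    arith : ∀ q → (q * q * q + q * q + q + 1) * (q * q + q + 1) ≡ (q * q + 1) * (q * q + q + 1) * suc q
    arith = solve-∀

-- Sets of chambers

-- The unit of all bounds on sets of chambers, kept opaque so that it acts as an atom in the
-- estimates.
opaque
  cube : ℕ → ℕ
  cube q = suc q * (suc q * suc q)

  cube-def : ∀ q → suc q * (suc q * suc q) ≡ cube q
  cube-def q = refl

module ChamberSets {q : ℕ} (G : Geometry q) where
  open Geometry G
  open Incidence G

  ChSet : Set
  ChSet = Fin nP → Fin nL → Fin nE → Bool

  infix 4 _⊆_
  _⊆_ : ChSet → ChSet → Set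
  X ⊆ Y = ∀ {x l e} → X x l e ≡ true → Y x l e ≡ true

  card : ChSet → ℕ
  card X = sum (λ l → sum (λ x → sum (λ e → ι (X x l e))))

  on-line : ChSet → Fin nL → ℕ
  on-line X l = sum (λ x → sum (λ e → ι (X x l e)))

  in-plane : ChSet → Fin nE → ℕ
  in-plane X e = sum (λ l → # (λ x → X x l e))

  at-point : ChSet → Fin nP → ℕ
  at-point X x = sum (λ l → # (λ e → X x l e))

  card-by-plane : ∀ X → card X ≡ sum (in-plane X)
  card-by-plane X = trans (sum-cong-≗ (λ l → ∑-comm (λ x e → ι (X x l e)))) (∑-comm (λ l e → # (λ x → X x l e)))

  card-by-point : ∀ X → card X ≡ sum (at-point X)
  card-by-point X = ∑-comm (λ l x → # (λ e → X x l e))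

  on-line-by-plane : ∀ X l → on-line X l ≡ sum (λ e → # (λ x → X x l e))
  on-line-by-plane X l = ∑-comm (λ x e → ι (X x l e))

  card-mono : ∀ {X Y} → X ⊆ Y → card X ≤ card Y
  card-mono h = sum-mono (λ l → sum-mono (λ x → sum-mono (λ e → ι-mono h)))

  card-∪ : ∀ X Y Z → (∀ {x l e} → X x l e ≡ true → Y x l e ≡ true ⊎ Z x l e ≡ true) → card X ≤ card Y + card Z
  card-∪ X Y Z h = ≤-trans (sum-mono (λ l → ≤-trans (sum-mono (λ x → ≤-trans (sum-mono (λ e → pointwise x l e))
      (≤-reflexive (∑-distrib-+ (λ e → ι (Y x l e)) (λ e → ι (Z x l e))))))
      (≤-reflexive (∑-distrib-+ (λ x → # (Y x l)) (λ x → # (Z x l))))))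
      (≤-reflexive (∑-distrib-+ (on-line Y) (on-line Z)))
    where
    pointwise : ∀ x l e → ι (X x l e) ≤ ι (Y x l e) + ι (Z x l e)
    pointwise x l e with X x l e in eq
    ... | false = z≤n
    ... | true with h eq
    ... | inj₁ y rewrite y = m≤m+n 1 _
    ... | inj₂ z rewrite z = m≤n+m 1 _

  sum-support : ∀ {n} (f : Fin n → ℕ) (D : Fin n → Bool) c → (∀ i → D i ≡ true → f i ≤ c) →
                (∀ i → D i ≡ false → f i ≡ 0) → sum f ≤ # D * c
  sum-support f D c hi lo = ≤-trans (sum-mono pointwise) (weighted-sum-≤ D f c hi)
    where
    pointwise : ∀ i → f i ≤ ι (D i) * f i
    pointwise i with D i in eq
    ... | true  = ≤-reflexive (sym (+-identityʳ (f i)))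
    ... | false = ≤-reflexive (lo i eq)

  sum-none : ∀ {m n} (p : Fin m → Fin n → Bool) → (∀ i j → p i j ≡ true → ⊥) → sum (λ i → # (p i)) ≡ 0
  sum-none {m} p h = trans (sum-cong-≗ (λ i → #-none (p i) (h i))) (sum-zero m)

  by-lines : ∀ X (D : Fin nL → Bool) c → (∀ {x l e} → X x l e ≡ true → D l ≡ true) →
             (∀ l → D l ≡ true → on-line X l ≤ c) → card X ≤ # D * c
  by-lines X D c sup h = sum-support (on-line X) D c h
    (λ l Dl → sum-none (λ x e → X x l e) (λ x e Xc → true≢false (sup Xc) Dl))

  by-planes : ∀ X (D : Fin nE → Bool) c → (∀ {x l e} → X x l e ≡ true → D e ≡ true) →
              (∀ e → D e ≡ true → in-plane X e ≤ c) → card X ≤ # D * c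
  by-planes X D c sup h = ≤-trans (≤-reflexive (card-by-plane X)) (sum-support (in-plane X) D c h
    (λ e De → sum-none (λ l x → X x l e) (λ l x Xc → true≢false (sup Xc) De)))

  Chambers : ChSet → Set
  Chambers X = ∀ {x l e} → X x l e ≡ true → pl x l ≡ true × le e l ≡ true

  Independent : ChSet → Set
  Independent X = ∀ {x l e x′ l′ e′} → X x l e ≡ true → X x′ l′ e′ ≡ true →
                  pe x e′ ≡ true ⊎ (pe x′ e ≡ true ⊎ Meet l l′)

  column-bound : ∀ {X} → Chambers X → ∀ l e → # (λ x → X x l e) ≤ ι (le e l) * suc q
  column-bound {X} ch l e with decide (le e l)
  ... | inj₁ el rewrite el = ≤-trans (#-mono (λ x h → proj₁ (ch h))) (≤-reflexive (trans (#points-on l) (sym (+-identityʳ (suc q)))))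
  ... | inj₂ ¬el = ≤-trans (≤-reflexive (#-none _ (λ x h → true≢false (proj₂ (ch h)) ¬el))) z≤n

  on-line-crude : ∀ {X} → Chambers X → ∀ l → on-line X l ≤ suc q * suc q
  on-line-crude {X} ch l = begin
    on-line X l      ≡⟨ on-line-by-plane X l ⟩
    sum (λ e → # (λ x → X x l e))      ≤⟨ sum-mono (column-bound ch l) ⟩
    sum (λ e → ι (le e l) * suc q)     ≡⟨ *-distribʳ-sum (suc q) (λ e → ι (le e l)) ⟨
    # (λ e → le e l) * suc q      ≡⟨ cong (_* suc q) (#planes-on l) ⟩
    suc q * suc q      ∎
    where open ≤-Reasoning

  -- Call a line full in a plane if at least two chambers of `X` have this line and this plane. A
  -- plane is rich if two lines are full in it, and a line is heavy if it is full in two planes; the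
  -- two definitions here are the negations.
  NonRich : ChSet → Fin nE → Set
  NonRich X e = ∀ l m → 2 ≤ # (λ x → X x l e) → 2 ≤ # (λ x → X x m e) → l ≡ m

  NonHeavy : ChSet → Fin nL → Set
  NonHeavy X l = ∀ e f → 2 ≤ # (λ x → X x l e) → 2 ≤ # (λ x → X x l f) → e ≡ f

  Light : ChSet → Set
  Light X = ∀ l → on-line X l ≤ suc (q + q)

  nonheavy⇒light : ∀ {X} → Chambers X → ∀ l → NonHeavy X l → on-line X l ≤ suc (q + q)
  nonheavy⇒light {X} ch l nh = ≤-trans (≤-reflexive (on-line-by-plane X l))
    (≤-trans (one-large (λ e → le e l) _ q (column-bound ch l) nh) (≤-reflexive (cong (_+ q) (#planes-on l))))

  -- One line of the plane may carry q + 1 chambers and every other line at most one; `D` limits the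
  -- lines that occur at all.
  in-nonrich : ∀ {X} → Chambers X → ∀ e → NonRich X e → ∀ (D : Fin nL → Bool) → (∀ {x l} → X x l e ≡ true → D l ≡ true) →
               in-plane X e ≤ # (λ l → D l ∧ le e l) + q
  in-nonrich {X} ch e nr D sup = one-large (λ l → D l ∧ le e l) _ q bound nr
    where
    bound : ∀ l → # (λ x → X x l e) ≤ ι (D l ∧ le e l) * suc q
    bound l with decide (D l)
    ... | inj₁ Dl rewrite Dl = column-bound ch l e
    ... | inj₂ ¬Dl = ≤-trans (≤-reflexive (#-none _ (λ x h → true≢false (sup h) ¬Dl))) z≤n

  in-plane-all : ∀ {X} → Chambers X → ∀ e → NonRich X e → # (λ l → le e l) ≡ q * q + q + 1 → in-plane X e ≤ suc q * suc q
  in-plane-all ch e nr #e = ≤-trans (in-nonrich ch e nr (λ _ → true) (λ _ → refl))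
    (≤-reflexive (trans (cong (_+ q) #e) (arith q)))
    where
    arith : ∀ q → q * q + q + 1 + q ≡ suc q * suc q
    arith = solve-∀

-- Duality for sets of chambers

module _ {q : ℕ} (G : Geometry q) where
  open Geometry G
  open Incidence G
  open ChamberSets G
  private
    module I* = Incidence (dual G)
    module C* = ChamberSets (dual G)

  flip : ChSet → C*.ChSet
  flip X e l x = X x l e

  card-flip : ∀ X → C*.card (flip X) ≡ card X
  card-flip X = sum-cong-≗ (λ l → ∑-comm (λ e x → ι (X x l e)))

  -- What survives when the chambers on heavy lines, in rich planes and at rich points are deleted.
  -- The notion is self-dual: `flip` preserves lightness and exchanges the last two fields.
  record Tame (X : ChSet) : Set where
    constructor tame
    field
      chambers : Chambers X
      light    : Light X
      nonrich  : ∀ e → NonRich X e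
      nonrich* : ∀ x → C*.NonRich (flip X) x

  tame-sub : ∀ {X Y} → Y ⊆ X → Tame X → Tame Y
  tame-sub Y⊆X t = tame (λ h → chambers (Y⊆X h))
      (λ l → ≤-trans (sum-mono (λ x → sum-mono (λ e → ι-mono Y⊆X))) (light l))
      (λ e l m hl hm → nonrich e l m (≤-trans hl (#-mono (λ _ → Y⊆X))) (≤-trans hm (#-mono (λ _ → Y⊆X))))
      (λ x l m hl hm → nonrich* x l m (≤-trans hl (#-mono (λ _ → Y⊆X))) (≤-trans hm (#-mono (λ _ → Y⊆X))))
    where open Tame t

  light-sub : ∀ {X Y} → Y ⊆ X → Light X → Light Y
  light-sub Y⊆X h l = ≤-trans (sum-mono (λ x → sum-mono (λ e → ι-mono Y⊆X))) (h l)

  light-flip : ∀ {X} → Light X → C*.Light (flip X)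
  light-flip {X} h l = ≤-trans (≤-reflexive (∑-comm (λ e x → ι (X x l e)))) (h l)

  independent-flip : ∀ {X} → Independent X → C*.Independent (flip X)
  independent-flip ind c c′ with ind c c′
  ... | inj₁ p = inj₂ (inj₁ p)
  ... | inj₂ (inj₁ p) = inj₁ p
  ... | inj₂ (inj₂ (x , xl , xm)) = inj₂ (inj₂ (I*.coplanar⇒Meet xl xm))

  chambers-flip : ∀ {X} → Chambers X → C*.Chambers (flip X)
  chambers-flip ch h = proj₂ (ch h) , proj₁ (ch h)

tame-flip : ∀ {q} (G : Geometry q) {X} → Tame G X → Tame (dual G) (flip G X)
tame-flip G t = tame (chambers-flip G chambers) (light-flip G light) nonrich* nonrich
  where open Tame t

-- Chambers in prescribed relations to fixed points and lines

module Parts {q : ℕ} (G : Geometry q) where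
  open Geometry G
  open Incidence G
  open ChamberSets G
  private module I* = Incidence (dual G)

  K = cube q

  lines-through-meeting : ∀ {x l₂} → pl x l₂ ≡ false → # (λ l → pl x l ∧ meets l l₂) ≤ suc q
  lines-through-meeting {x} {l₂} x∉l₂ = ≤-trans
    (matching _ (λ y → pl y l₂) (λ l y → pl y l)
      (λ l h → let (xl , lm) = ∧-elim {pl x l} h ; (y , yl , yl₂) = meets-elim lm in y , yl₂ , yl)
      (λ l l′ y h h′ yl₂ yl yl′ → join-unique (∌⇒≢ yl₂ x∉l₂) (proj₁ (∧-elim h)) yl (proj₁ (∧-elim h′)) yl′))
    (≤-reflexive (#points-on l₂))

  -- There is at most one common point of `l₁` and `l₂`, and it accounts for at most q² + q + 1
  -- lines. Any other line meets `l₁` in a point off `l₂`, from which at most q + 1 lines lead to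
  -- `l₂`.
  lines-meeting-both : ∀ {l₁ l₂} → l₁ ≢ l₂ → # (λ l → meets l l₁ ∧ meets l l₂) ≤ 2 * (suc q * suc q)
  lines-meeting-both {l₁} {l₂} l₁≢l₂ = begin
    # D      ≡⟨ #-split D common ⟩
    # D₁ + # D₂      ≡⟨ cong₂ _+_ (*-identityʳ (# D₁)) (*-identityʳ (# D₂)) ⟨
    # D₁ * 1 + # D₂ * 1      ≤⟨ +-mono-≤ part₁ part₂ ⟩
    # E₁ * (q * q + q + 1) + # E₂ * suc q      ≤⟨ +-mono-≤ (*-monoˡ-≤ (q * q + q + 1) #E₁) (*-monoˡ-≤ (suc q) #E₂) ⟩
    1 * (q * q + q + 1) + suc q * suc q      ≤⟨ m≤m+n _ q ⟩
    1 * (q * q + q + 1) + suc q * suc q + q      ≡⟨ arith q ⟩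
    2 * (suc q * suc q)      ∎
    where
    open ≤-Reasoning
    arith : ∀ q → 1 * (q * q + q + 1) + suc q * suc q + q ≡ 2 * (suc q * suc q)
    arith = solve-∀
    common : Fin nL → Bool
    common l = some (λ z → (pl z l₁ ∧ pl z l₂) ∧ pl z l)
    D = λ l → meets l l₁ ∧ meets l l₂
    D₁ = λ l → D l ∧ common l
    D₂ = λ l → D l ∧ not (common l)
    E₁ = λ z → pl z l₁ ∧ pl z l₂
    E₂ = λ z → pl z l₁ ∧ not (pl z l₂)
    #E₁ : # E₁ ≤ 1
    #E₁ = #-≤1 E₁ (λ x y hx hy → let (a , b) = ∧-elim {pl x l₁} hx ; (c , d) = ∧-elim {pl y l₁} hy
                                  in meet-point-unique l₁≢l₂ a b c d)
    #E₂ : # E₂ ≤ suc q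
    #E₂ = ≤-trans (#-mono (λ z h → proj₁ (∧-elim h))) (≤-reflexive (#points-on l₁))
    part₁ : # D₁ * 1 ≤ # E₁ * (q * q + q + 1)
    part₁ = double D₁ E₁ (λ l z → pl z l) 1 _
      (λ l h → let (z , k) = some-elim _ (proj₂ (∧-elim {D l} h)) in #-≥1 _ z k)
      (λ z h → ≤-trans (#-mono (λ l k → proj₂ (∧-elim {D₁ l} k))) (≤-reflexive (#lines-on z)))
    part₂ : # D₂ * 1 ≤ # E₂ * suc q
    part₂ = double D₂ E₂ (λ l z → pl z l) 1 _
      (λ l h → let (d , nc) = ∧-elim {D l} h
                   (z , zl , zl₁) = meets-elim (proj₁ (∧-elim d))
               in #-≥1 _ z (∧-intro (∧-intro zl₁ (off l z zl zl₁ (not-false nc))) zl))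
      (λ z h → ≤-trans (#-mono (λ l k → let (d₂ , zl) = ∧-elim {D₂ l} k in
                          ∧-intro zl (proj₂ (∧-elim {meets l l₁} (proj₁ (∧-elim {D l} d₂))))))
                       (lines-through-meeting (not-false (proj₂ (∧-elim {pl z l₁} h)))))
      where
      off : ∀ l z → pl z l ≡ true → pl z l₁ ≡ true → common l ≡ false → not (pl z l₂) ≡ true
      off l z zl zl₁ nc with decide (pl z l₂)
      ... | inj₂ n = not-true n
      ... | inj₁ zl₂ = ⊥-elim (true≢false (some-intro _ z (∧-intro (∧-intro zl₁ zl₂) zl)) nc)

  module _ {Y} (t : Tame G Y) where
    open Tame t

    -- In the names `ll`, `lp` and `pp` each letter stands for a relation to one of two fixed
    -- chambers: the lines meet, or the plane contains the fixed point. A star marks the dual, with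
    -- the point in a fixed plane.
    part-ll : ∀ {l₁ l₂} → l₁ ≢ l₂ → (∀ {x l e} → Y x l e ≡ true → Meet l l₁ × Meet l l₂) → card Y ≤ 4 * K
    part-ll {l₁} {l₂} ne sup = begin
      card Y      ≤⟨ by-lines Y (λ l → meets l l₁ ∧ meets l l₂) (suc (q + q))
                                               (λ h → let (a , b) = sup h in ∧-intro (meets-intro a) (meets-intro b)) (λ l _ → light l) ⟩
      # (λ l → meets l l₁ ∧ meets l l₂) * suc (q + q)  ≤⟨ *-mono-≤ (lines-meeting-both ne) (m≤m+n (suc (q + q)) 1) ⟩
      2 * (suc q * suc q) * (suc (q + q) + 1)      ≡⟨ trans (arith q) (cong (4 *_) (cube-def q)) ⟩
      4 * K      ∎
      where
      open ≤-Reasoning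
      arith : ∀ q → 2 * (suc q * suc q) * (suc (q + q) + 1) ≡ 4 * (suc q * (suc q * suc q))
      arith = solve-∀

    in-plane≤ : ∀ e → in-plane Y e ≤ suc q * suc q
    in-plane≤ e = in-plane-all chambers e (nonrich e) (I*.#lines-on e)

    part-pp : ∀ {x₁ x₂} → x₁ ≢ x₂ → (∀ {x l e} → Y x l e ≡ true → pe x₁ e ≡ true × pe x₂ e ≡ true) → card Y ≤ K
    part-pp {x₁} {x₂} ne sup with join x₁ x₂
    ... | m , x₁m , x₂m = begin
      card Y      ≤⟨ by-planes Y (λ e → le e m) (suc q * suc q)
                                               (λ h → let (a , b) = sup h in line⊆ ne x₁m x₂m a b) (λ e _ → in-plane≤ e) ⟩
      # (λ e → le e m) * (suc q * suc q)   ≡⟨ trans (cong (_* (suc q * suc q)) (#planes-on m)) (cube-def q) ⟩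
      K      ∎
      where open ≤-Reasoning

    part-on-line : ∀ {m} → (∀ {x l e} → Y x l e ≡ true → le e m ≡ true) → card Y ≤ K
    part-on-line {m} sup = ≤-trans (by-planes Y (λ e → le e m) (suc q * suc q) sup (λ e _ → in-plane≤ e))
                                   (≤-reflexive (trans (cong (_* (suc q * suc q)) (#planes-on m)) (cube-def q)))

    -- A plane on `x₂` that does not contain `l₁` meets it in a single point `x₀`, and all lines of
    -- `Y` in this plane pass through `x₀`, so it contributes at most 2q + 1. Only a plane on both
    -- `x₂` and `l₁` can contribute (q + 1)², and there is at most one because `x₂` is off `l₁`.
    part-lp : ∀ {l₁ x₂} → pl x₂ l₁ ≡ false → (∀ {x l e} → Y x l e ≡ true → Meet l l₁ × pe x₂ e ≡ true) → card Y ≤ 2 * K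
    part-lp {l₁} {x₂} x₂∉l₁ sup = begin
      card Y      ≡⟨ card-by-plane Y ⟩
      sum (in-plane Y)      ≤⟨ sum-mono pointwise ⟩
      sum (λ e → ι (pe x₂ e) * suc (q + q) + ι (E e) * (suc q * suc q))
                                                    ≡⟨ ∑-distrib-+ (λ e → ι (pe x₂ e) * suc (q + q)) (λ e → ι (E e) * (suc q * suc q)) ⟩
      sum (λ e → ι (pe x₂ e) * suc (q + q)) + sum (λ e → ι (E e) * (suc q * suc q))
                                                    ≡⟨ cong₂ _+_ (*-distribʳ-sum (suc (q + q)) (λ e → ι (pe x₂ e))) (*-distribʳ-sum (suc q * suc q) (ι ∘ E)) ⟨
      # (λ e → pe x₂ e) * suc (q + q) + # E * (suc q * suc q)
                                                    ≤⟨ +-mono-≤ (≤-reflexive (cong (_* suc (q + q)) (I*.#points-in x₂))) (*-monoˡ-≤ (suc q * suc q) #E) ⟩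
      (q * q + q + 1) * suc (q + q) + 1 * (suc q * suc q)     ≤⟨ m≤m+n _ _ ⟩
      (q * q + q + 1) * suc (q + q) + 1 * (suc q * suc q) + (2 * (q * q) + q)    ≡⟨ trans (arith q) (cong (2 *_) (cube-def q)) ⟩
      2 * K      ∎
      where
      open ≤-Reasoning
      arith : ∀ q → (q * q + q + 1) * suc (q + q) + 1 * (suc q * suc q) + (2 * (q * q) + q) ≡ 2 * (suc q * (suc q * suc q))
      arith = solve-∀
      E = λ e → pe x₂ e ∧ le e l₁
      #E : # E ≤ 1
      #E = #-≤1 E (λ e f he hf → let (a , b) = ∧-elim {pe x₂ e} he ; (c , d) = ∧-elim {pe x₂ f} hf in
                     case e Fin.≟ f of λ { (yes eq) → eq ; (no e≢f) → ⊥-elim (true≢false (line∋ e≢f b d a c) x₂∉l₁) })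
      pointwise : ∀ e → in-plane Y e ≤ ι (pe x₂ e) * suc (q + q) + ι (E e) * (suc q * suc q)
      pointwise e with decide (pe x₂ e) | decide (le e l₁)
      ... | inj₂ ne | _ = ≤-trans (≤-reflexive (sum-none (λ l x → Y x l e) (λ l x h → true≢false (proj₂ (sup h)) ne))) z≤n
      ... | inj₁ x₂e | inj₁ el₁ rewrite x₂e | el₁ = ≤-trans (in-plane≤ e)
                                      (≤-trans (≤-reflexive (sym (+-identityʳ _))) (m≤n+m _ (suc (q + q) + 0)))
      ... | inj₁ x₂e | inj₂ ne rewrite x₂e | ne with cut e l₁
      ... | x₀ , x₀l₁ , x₀e = ≤-trans (in-nonrich chambers e (nonrich e) (λ l → pl x₀ l)
                (λ {x} {l} h → let ((y , yl , yl₁) , _) = sup h in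
                   subst (λ z → pl z l ≡ true) (cut-unique ne yl₁ (flag yl (proj₂ (chambers h))) x₀l₁ x₀e) yl))
             (≤-reflexive (trans (cong (_+ q) (#pencil x₀e)) (arith′ q)))
        where
        arith′ : ∀ q → suc q + q ≡ suc (q + q) + 0 + 0
        arith′ = solve-∀

  light-through : ∀ {Y} → Light Y → ∀ {x₁} → (∀ {x l e} → Y x l e ≡ true → pl x₁ l ≡ true) → card Y ≤ 2 * K
  light-through {Y} li {x₁} sup = begin
    card Y      ≤⟨ by-lines Y (λ l → pl x₁ l) (suc (q + q)) sup (λ l _ → li l) ⟩
    # (λ l → pl x₁ l) * suc (q + q)      ≡⟨ cong (_* suc (q + q)) (#lines-on x₁) ⟩
    (q * q + q + 1) * suc (q + q)      ≤⟨ m≤m+n _ _ ⟩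
    (q * q + q + 1) * suc (q + q) + (3 * (q * q) + 3 * q + 1) ≡⟨ trans (arith q) (cong (2 *_) (cube-def q)) ⟩
    2 * K      ∎
    where
    open ≤-Reasoning
    arith : ∀ q → (q * q + q + 1) * suc (q + q) + (3 * (q * q) + 3 * q + 1) ≡ 2 * (suc q * (suc q * suc q))
    arith = solve-∀

-- Independent sets without heavy lines, rich planes and rich points

∨-elim : ∀ {a b} → a ∨ b ≡ true → a ≡ true ⊎ b ≡ true
∨-elim {true}  _ = inj₁ refl
∨-elim {false} h = inj₂ h

∨-false : ∀ {a b} → a ∨ b ≡ false → a ≡ false × b ≡ false
∨-false {false} {false} _ = refl , refl

module TameSets {q : ℕ} (G : Geometry q) where
  open Geometry G
  open Incidence G
  open ChamberSets G
  open Parts G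
  private
    module I* = Incidence (dual G)
    module P* = Parts (dual G)

  infixl 6 _∩_
  opaque
    _∩_ : ChSet → ChSet → ChSet
    (X ∩ Y) x l e = X x l e ∧ Y x l e

    ∩-intro : ∀ {X Y x l e} → X x l e ≡ true → Y x l e ≡ true → (X ∩ Y) x l e ≡ true
    ∩-intro = ∧-intro

    ∩⊆ : ∀ X Y → X ∩ Y ⊆ X
    ∩⊆ X Y {x} {l} {e} h = proj₁ (∧-elim {X x l e} h)

    ∩⊆ʳ : ∀ X Y → X ∩ Y ⊆ Y
    ∩⊆ʳ X Y {x} {l} {e} h = proj₂ (∧-elim {X x l e} h)

  part-lp* : ∀ {Y} → Tame G Y → ∀ {l₁ e₂} → le e₂ l₁ ≡ false →
             (∀ {x l e} → Y x l e ≡ true → Meet l l₁ × pe x e₂ ≡ true) → card Y ≤ 2 * K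
  part-lp* {Y} t ne sup = ≤-trans (≤-reflexive (sym (card-flip G Y)))
    (P*.part-lp (tame-flip G t) ne (λ h → let ((x , xl , xm) , b) = sup h in I*.coplanar⇒Meet xl xm , b))

  part-pp* : ∀ {Y} → Tame G Y → ∀ {e₁ e₂} → e₁ ≢ e₂ →
             (∀ {x l e} → Y x l e ≡ true → pe x e₁ ≡ true × pe x e₂ ≡ true) → card Y ≤ K
  part-pp* {Y} t ne sup = ≤-trans (≤-reflexive (sym (card-flip G Y))) (P*.part-pp (tame-flip G t) ne sup)

  part-on-line* : ∀ {Y} → Tame G Y → ∀ {m} → (∀ {x l e} → Y x l e ≡ true → pl x m ≡ true) → card Y ≤ K
  part-on-line* {Y} t sup = ≤-trans (≤-reflexive (sym (card-flip G Y))) (P*.part-on-line (tame-flip G t) sup)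

  light-in : ∀ {Y} → Light Y → ∀ {e₁} → (∀ {x l e} → Y x l e ≡ true → le e₁ l ≡ true) → card Y ≤ 2 * K
  light-in {Y} li sup = ≤-trans (≤-reflexive (sym (card-flip G Y))) (P*.light-through (light-flip G li) sup)

  search : ∀ (X : ChSet) → (∃ λ x → ∃₂ λ l e → X x l e ≡ true) ⊎ (∀ {x l e} → X x l e ≡ true → ⊥)
  search X with Fin.any? (λ x → Fin.any? (λ l → Fin.any? (λ e → true? (X x l e))))
  ... | yes found = inj₁ found
  ... | no none = inj₂ (λ {x} {l} {e} h → none (x , l , e , h))

  card-empty : ∀ X → (∀ {x l e} → X x l e ≡ true → ⊥) → card X ≡ 0
  card-empty X h = trans (sum-cong-≗ (λ l → sum-none (λ x e → X x l e) (λ x e → h))) (sum-zero nL)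

  meeting : Fin nL → ChSet
  meeting l₁ x l e = meets l l₁

  plane∋ : Fin nP → ChSet
  plane∋ x₁ x l e = pe x₁ e

  point∈ : Fin nE → ChSet
  point∈ e₁ x l e = pe x e₁

  -- The four degenerate positions in which the bounds for parts would lose their hypotheses. For
  -- two chambers, excluding them also makes the points, the lines and the planes distinct.
  close : Fin nP → Fin nL → Fin nE → ChSet
  close x₁ l₁ e₁ x l e = pl x₁ l ∨ (pl x l₁ ∨ (le e₁ l ∨ le e l₁))

  record Far (x₁ : Fin nP) (l₁ : Fin nL) (e₁ : Fin nE) (x₂ : Fin nP) (l₂ : Fin nL) (e₂ : Fin nE) : Set where
    field
      x₁∉l₂ : pl x₁ l₂ ≡ false
      x₂∉l₁ : pl x₂ l₁ ≡ false
      l₂⊄e₁ : le e₁ l₂ ≡ false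
      l₁⊄e₂ : le e₂ l₁ ≡ false

  far : ∀ x₁ l₁ e₁ x₂ l₂ e₂ → close x₁ l₁ e₁ x₂ l₂ e₂ ≡ false → Far x₁ l₁ e₁ x₂ l₂ e₂
  far x₁ l₁ e₁ x₂ l₂ e₂ h =
    let (a , h₁) = ∨-false {pl x₁ l₂} h ; (b , h₂) = ∨-false {pl x₂ l₁} h₁ ; (c , d) = ∨-false {le e₁ l₂} h₂
    in record { x₁∉l₂ = a ; x₂∉l₁ = b ; l₂⊄e₁ = c ; l₁⊄e₂ = d }

  -- Prescribing a point or a plane of the line costs `2 * K`; placing the point on `l₁` or the
  -- plane on `l₁` costs `K`.
  card-close : ∀ {X} → Tame G X → ∀ x₁ l₁ e₁ → card (X ∩ close x₁ l₁ e₁) ≤ 6 * K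
  card-close {X} t x₁ l₁ e₁ = begin
    card (X ∩ close x₁ l₁ e₁)      ≤⟨ card-∪ (X ∩ close x₁ l₁ e₁) (X ∩ A) (X ∩ BCD) (distribute A BCD) ⟩
    card (X ∩ A) + card (X ∩ BCD)      ≤⟨ +-monoʳ-≤ (card (X ∩ A)) (card-∪ (X ∩ BCD) (X ∩ B) (X ∩ CD) (distribute B CD)) ⟩
    card (X ∩ A) + (card (X ∩ B) + card (X ∩ CD))      ≤⟨ +-monoʳ-≤ (card (X ∩ A)) (+-monoʳ-≤ (card (X ∩ B)) (card-∪ (X ∩ CD) (X ∩ C) (X ∩ D) (distribute C D))) ⟩
    card (X ∩ A) + (card (X ∩ B) + (card (X ∩ C) + card (X ∩ D)))
      ≤⟨ +-mono-≤ (light-through (Tame.light (sub A)) (∩⊆ʳ X A))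
          (+-mono-≤ (part-on-line* (sub B) (∩⊆ʳ X B))
          (+-mono-≤ (light-in (Tame.light (sub C)) (∩⊆ʳ X C))
                    (part-on-line (sub D) (∩⊆ʳ X D)))) ⟩
    2 * K + (K + (2 * K + K))      ≡⟨ arith K ⟩
    6 * K      ∎
    where
    open ≤-Reasoning
    arith : ∀ K → 2 * K + (K + (2 * K + K)) ≡ 6 * K
    arith = solve-∀
    A B C D BCD CD : ChSet
    A x l e = pl x₁ l
    B x l e = pl x l₁
    C x l e = le e₁ l
    D x l e = le e l₁
    CD x l e = C x l e ∨ D x l e
    BCD x l e = B x l e ∨ CD x l e
    sub : ∀ Z → Tame G (X ∩ Z)
    sub Z = tame-sub G (∩⊆ X Z) t
    distribute : ∀ (Y Z : ChSet) {x l e} → (X ∩ (λ x l e → Y x l e ∨ Z x l e)) x l e ≡ true → (X ∩ Y) x l e ≡ true ⊎ (X ∩ Z) x l e ≡ true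
    distribute Y Z {x} {l} {e} h with ∩⊆ X (λ x l e → Y x l e ∨ Z x l e) h , ∩⊆ʳ X (λ x l e → Y x l e ∨ Z x l e) h
    ... | a , b with ∨-elim {Y x l e} b
    ... | inj₁ y = inj₁ (∩-intro {X} {Y} a y)
    ... | inj₂ z = inj₂ (∩-intro {X} {Z} a z)

  module _ {X} (t : Tame G X) (ind : Independent X) where

    split : ∀ {Y} → Y ⊆ X → ∀ {x₁ l₁ e₁} → X x₁ l₁ e₁ ≡ true →
            card Y ≤ card (Y ∩ meeting l₁) + (card (Y ∩ plane∋ x₁) + card (Y ∩ point∈ e₁))
    split {Y} Y⊆X {x₁} {l₁} {e₁} c₁ = ≤-trans
      (card-∪ Y (Y ∩ meeting l₁) (λ x l e → Y x l e ∧ (pe x₁ e ∨ pe x e₁)) first)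
      (+-monoʳ-≤ (card (Y ∩ meeting l₁)) (card-∪ _ (Y ∩ plane∋ x₁) (Y ∩ point∈ e₁) second))
      where
      first : ∀ {x l e} → Y x l e ≡ true → (Y ∩ meeting l₁) x l e ≡ true ⊎ (Y x l e ∧ (pe x₁ e ∨ pe x e₁)) ≡ true
      first {x} {l} {e} h with ind (Y⊆X h) c₁
      ... | inj₁ p = inj₂ (∧-intro h (∨-introʳ (pe x₁ e) p))
        where
        ∨-introʳ : ∀ a {b} → b ≡ true → a ∨ b ≡ true
        ∨-introʳ true  _ = refl
        ∨-introʳ false p = p
      ... | inj₂ (inj₁ p) rewrite p = inj₂ (∧-intro h refl)
      ... | inj₂ (inj₂ m) = inj₁ (∩-intro {Y} {meeting l₁} h (meets-intro m))
      second : ∀ {x l e} → (Y x l e ∧ (pe x₁ e ∨ pe x e₁)) ≡ true → (Y ∩ plane∋ x₁) x l e ≡ true ⊎ (Y ∩ point∈ e₁) x l e ≡ true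
      second {x} {l} {e} h with ∧-elim {Y x l e} h
      ... | y , z with ∨-elim {pe x₁ e} z
      ... | inj₁ p = inj₁ (∩-intro {Y} {plane∋ x₁} y p)
      ... | inj₂ p = inj₂ (∩-intro {Y} {point∈ e₁} y p)

    module _ {x₁ l₁ e₁ x₂ l₂ e₂ x₃ l₃ e₃}
             (c₁ : X x₁ l₁ e₁ ≡ true) (c₂ : X x₂ l₂ e₂ ≡ true) (c₃ : X x₃ l₃ e₃ ≡ true)
             (f₁₂ : Far x₁ l₁ e₁ x₂ l₂ e₂) (f₁₃ : Far x₁ l₁ e₁ x₃ l₃ e₃) (f₂₃ : Far x₂ l₂ e₂ x₃ l₃ e₃) where
      private
        module F₁₂ = Far f₁₂
        module F₁₃ = Far f₁₃
        module F₂₃ = Far f₂₃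
        sub₁ : ∀ C → X ∩ C ⊆ X
        sub₁ C = ∩⊆ X C
        sub₂ : ∀ C D → X ∩ C ∩ D ⊆ X
        sub₂ C D h = sub₁ C (∩⊆ (X ∩ C) D h)
        sub₃ : ∀ C D E → X ∩ C ∩ D ∩ E ⊆ X
        sub₃ C D E h = sub₂ C D (∩⊆ (X ∩ C ∩ D) E h)
        tame₂ : ∀ C D → Tame G (X ∩ C ∩ D)
        tame₂ C D = tame-sub G (sub₂ C D) t
        tame₃ : ∀ C D E → Tame G (X ∩ C ∩ D ∩ E)
        tame₃ C D E = tame-sub G (sub₃ C D E) t
        in₂ : ∀ C D {x l e} → (X ∩ C ∩ D) x l e ≡ true → C x l e ≡ true × D x l e ≡ true
        in₂ C D h = ∩⊆ʳ X C (∩⊆ (X ∩ C) D h) , ∩⊆ʳ (X ∩ C) D h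
        in₁₃ : ∀ C D E {x l e} → (X ∩ C ∩ D ∩ E) x l e ≡ true → C x l e ≡ true × E x l e ≡ true
        in₁₃ C D E h = proj₁ (in₂ C D (∩⊆ (X ∩ C ∩ D) E h)) , ∩⊆ʳ (X ∩ C ∩ D) E h
        in₂₃ : ∀ C D E {x l e} → (X ∩ C ∩ D ∩ E) x l e ≡ true → D x l e ≡ true × E x l e ≡ true
        in₂₃ C D E h = proj₂ (in₂ C D (∩⊆ (X ∩ C ∩ D) E h)) , ∩⊆ʳ (X ∩ C ∩ D) E h
        swap-meet : ∀ {l l₁} {P : Set} → meets l l₁ ≡ true × P → Meet l l₁ × P
        swap-meet (m , p) = meets-elim m , p
        swap-meet′ : ∀ {l l₁} {P : Set} → P × meets l l₁ ≡ true → Meet l l₁ × P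
        swap-meet′ (p , m) = meets-elim m , p
        split₂ : ∀ C {x₁ l₁ e₁} → X x₁ l₁ e₁ ≡ true →
            card (X ∩ C) ≤ card (X ∩ C ∩ meeting l₁) + (card (X ∩ C ∩ plane∋ x₁) + card (X ∩ C ∩ point∈ e₁))
        split₂ C = split (sub₁ C)
        split₃ : ∀ C D {x₁ l₁ e₁} → X x₁ l₁ e₁ ≡ true →
            card (X ∩ C ∩ D) ≤ card (X ∩ C ∩ D ∩ meeting l₁) + (card (X ∩ C ∩ D ∩ plane∋ x₁) + card (X ∩ C ∩ D ∩ point∈ e₁))
        split₃ C D = split (sub₂ C D)
        L₁ = meeting l₁
        L₂ = meeting l₂
        L₃ = meeting l₃
        P₁ = plane∋ x₁
        P₂ = plane∋ x₂
        P₃ = plane∋ x₃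
        E₁ = point∈ e₁
        E₂ = point∈ e₂
        E₃ = point∈ e₃
        open Tame t using (chambers)
        pl₁ = proj₁ (chambers c₁)
        pl₂ = proj₁ (chambers c₂)
        le₁ = proj₂ (chambers c₁)
        le₂ = proj₂ (chambers c₂)

      bound-L₁ : card (X ∩ L₁) ≤ 4 * K + (2 * K + 2 * K)
      bound-L₁ = ≤-trans (split₂ L₁ c₂) (+-mono-≤
        (part-ll (tame₂ L₁ L₂) (λ { refl → true≢false pl₁ F₁₂.x₁∉l₂ })
          (λ h → let (a , b) = in₂ L₁ L₂ h in meets-elim a , meets-elim b))
        (+-mono-≤ (part-lp (tame₂ L₁ P₂) F₁₂.x₂∉l₁ (λ h → swap-meet (in₂ L₁ P₂ h)))
                  (part-lp* (tame₂ L₁ E₂) F₁₂.l₁⊄e₂ (λ h → swap-meet (in₂ L₁ E₂ h)))))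

      -- With the plane on `x₁` and the point in `e₂`, none of the bounds for two relations applies.
      -- The third chamber settles this mixed case: whatever relation holds to it combines with one
      -- of the two earlier relations, at a cost of 2 + 1 + 1. The same device serves for `E₁` with
      -- `P₂`.
      bound-P₁ : card (X ∩ P₁) ≤ 2 * K + (K + (2 * K + (K + K)))
      bound-P₁ = ≤-trans (split₂ P₁ c₂) (+-mono-≤
        (part-lp (tame₂ P₁ L₂) F₁₂.x₁∉l₂ (λ h → swap-meet′ (in₂ P₁ L₂ h)))
        (+-mono-≤ (part-pp (tame₂ P₁ P₂) (λ { refl → true≢false pl₁ F₁₂.x₂∉l₁ }) (in₂ P₁ P₂))
          (≤-trans (split₃ P₁ E₂ c₃) (+-mono-≤
            (part-lp (tame₃ P₁ E₂ L₃) F₁₃.x₁∉l₂ (λ h → swap-meet′ (in₁₃ P₁ E₂ L₃ h)))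
            (+-mono-≤ (part-pp (tame₃ P₁ E₂ P₃) (λ { refl → true≢false pl₁ F₁₃.x₂∉l₁ }) (in₁₃ P₁ E₂ P₃))
                      (part-pp* (tame₃ P₁ E₂ E₃) (λ { refl → true≢false le₂ F₂₃.l₁⊄e₂ }) (in₂₃ P₁ E₂ E₃)))))))

      bound-E₁ : card (X ∩ E₁) ≤ 2 * K + ((2 * K + (K + K)) + K)
      bound-E₁ = ≤-trans (split₂ E₁ c₂) (+-mono-≤
        (part-lp* (tame₂ E₁ L₂) F₁₂.l₂⊄e₁ (λ h → swap-meet′ (in₂ E₁ L₂ h)))
        (+-mono-≤ (≤-trans (split₃ E₁ P₂ c₃) (+-mono-≤
            (part-lp* (tame₃ E₁ P₂ L₃) F₁₃.l₂⊄e₁ (λ h → swap-meet′ (in₁₃ E₁ P₂ L₃ h)))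
            (+-mono-≤ (part-pp (tame₃ E₁ P₂ P₃) (λ { refl → true≢false pl₂ F₂₃.x₂∉l₁ }) (in₂₃ E₁ P₂ P₃))
                      (part-pp* (tame₃ E₁ P₂ E₃) (λ { refl → true≢false le₁ F₁₃.l₁⊄e₂ }) (in₁₃ E₁ P₂ E₃)))))
          (part-pp* (tame₂ E₁ E₂) (λ { refl → true≢false le₁ F₁₂.l₁⊄e₂ }) (in₂ E₁ E₂))))

      three-far : card X ≤ 22 * K
      three-far = ≤-trans (split (λ h → h) c₁) (≤-trans
        (+-mono-≤ bound-L₁ (+-mono-≤ bound-P₁ bound-E₁)) (≤-reflexive (arith K)))
        where
        arith : ∀ K → 4 * K + (2 * K + 2 * K) + (2 * K + (K + (2 * K + (K + K))) + (2 * K + ((2 * K + (K + K)) + K))) ≡ 22 * K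
        arith = solve-∀

    -- Three pairwise far chambers are sought greedily. If the search stops after one or two of
    -- them, all of `X` is close to one of these, at a cost of 6 or 12 instead of 22.
    tame-bound : card X ≤ 22 * K
    tame-bound with search X
    ... | inj₂ none = ≤-trans (≤-reflexive (card-empty X none)) z≤n
    ... | inj₁ (x₁ , l₁ , e₁ , c₁) with search (λ x l e → X x l e ∧ not (close x₁ l₁ e₁ x l e))
    ... | inj₂ none = ≤-trans (card-mono {X} {X ∩ close x₁ l₁ e₁} inside)
                        (≤-trans (card-close t x₁ l₁ e₁) (*-monoˡ-≤ K (m≤m+n 6 16)))
      where
      inside : X ⊆ X ∩ close x₁ l₁ e₁
      inside {x} {l} {e} h with decide (close x₁ l₁ e₁ x l e)
      ... | inj₁ c = ∩-intro {X} {close x₁ l₁ e₁} h c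
      ... | inj₂ n = ⊥-elim (none (∧-intro h (not-true n)))
    ... | inj₁ (x₂ , l₂ , e₂ , h₂) with ∧-elim {X x₂ l₂ e₂} h₂
    ... | c₂ , n₁₂ with search (λ x l e → X x l e ∧ (not (close x₁ l₁ e₁ x l e) ∧ not (close x₂ l₂ e₂ x l e)))
    ... | inj₁ (x₃ , l₃ , e₃ , h₃) = let (c₃ , n) = ∧-elim {X x₃ l₃ e₃} h₃ ; (n₁₃ , n₂₃) = ∧-elim {not (close x₁ l₁ e₁ x₃ l₃ e₃)} n in
      three-far c₁ c₂ c₃ (far x₁ l₁ e₁ x₂ l₂ e₂ (not-false n₁₂)) (far x₁ l₁ e₁ x₃ l₃ e₃ (not-false n₁₃)) (far x₂ l₂ e₂ x₃ l₃ e₃ (not-false n₂₃))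
    ... | inj₂ none = ≤-trans (card-∪ X (X ∩ close x₁ l₁ e₁) (X ∩ close x₂ l₂ e₂) inside)
                        (≤-trans (+-mono-≤ (card-close t x₁ l₁ e₁) (card-close t x₂ l₂ e₂))
                          (≤-trans (≤-reflexive (sym (*-distribʳ-+ K 6 6))) (*-monoˡ-≤ K (m≤m+n 12 10))))
      where
      inside : ∀ {x l e} → X x l e ≡ true → (X ∩ close x₁ l₁ e₁) x l e ≡ true ⊎ (X ∩ close x₂ l₂ e₂) x l e ≡ true
      inside {x} {l} {e} h with decide (close x₁ l₁ e₁ x l e) | decide (close x₂ l₂ e₂ x l e)
      ... | inj₁ c | _ = inj₁ (∩-intro {X} {close x₁ l₁ e₁} h c)
      ... | _ | inj₁ c = inj₂ (∩-intro {X} {close x₂ l₂ e₂} h c)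
      ... | inj₂ n | inj₂ n′ = ⊥-elim (none (∧-intro h (∧-intro (not-true n) (not-true n′))))

-- Light and heavy lines

module Rich {q : ℕ} (G : Geometry q) where
  open Geometry G
  open Incidence G
  open ChamberSets G
  open Parts G
  open TameSets G

  opaque
    full : ChSet → Fin nL → Fin nE → Bool
    full X l e = ⌊ 2 ≤? # (λ x → X x l e) ⌋

    full-intro : ∀ X {l e} → 2 ≤ # (λ x → X x l e) → full X l e ≡ true
    full-intro X = does-true (2 ≤? _)

    full-points : ∀ {X l e} → full X l e ≡ true → ∃₂ λ x y → x ≢ y × X x l e ≡ true × X y l e ≡ true
    full-points {X} {l} {e} h = #-≥2 _ (does-elim (2 ≤? # (λ x → X x l e)) h)

  -- Independence is applied to two points of `l`. The only outcome that is not immediate is that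
  -- both lie in `e′`; then `l` lies in `e′` together with `l′`, and coplanar lines meet.
  full-meet : ∀ {X} → Independent X → Chambers X → ∀ {l e} → full X l e ≡ true →
              ∀ {x′ l′ e′} → X x′ l′ e′ ≡ true → Meet l l′ ⊎ pe x′ e ≡ true
  full-meet {X} ind ch {l} {e} h c′ with full-points {X} h
  ... | x , y , x≢y , cx , cy with ind cx c′ | ind cy c′
  ... | inj₂ (inj₁ p) | _ = inj₂ p
  ... | inj₂ (inj₂ m) | _ = inj₁ m
  ... | _ | inj₂ (inj₁ p) = inj₂ p
  ... | _ | inj₂ (inj₂ m) = inj₁ m
  ... | inj₁ xe′ | inj₁ ye′ =
        inj₁ (coplanar⇒Meet (line⊆ x≢y (proj₁ (ch cx)) (proj₁ (ch cy)) xe′ ye′) (proj₂ (ch c′)))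

  rich : ChSet → Fin nE → Bool
  rich X e = some (λ l → some (λ m → not (l == m) ∧ (full X l e ∧ full X m e)))

  rich-lines : ∀ {X e} → rich X e ≡ true → ∃₂ λ l m → l ≢ m × full X l e ≡ true × full X m e ≡ true
  rich-lines {X} {e} h with some-elim _ h
  ... | l , h₁ with some-elim _ h₁
  ... | m , h₂ with ∧-elim {not (l == m)} h₂
  ... | ne , h₃ = l , m , ≠⇒≢ (not-false ne) , ∧-elim h₃

  nonrich : ∀ {X e} → rich X e ≡ false → NonRich X e
  nonrich {X} {e} h l m fl fm with l Fin.≟ m
  ... | yes eq = eq
  ... | no ne = ⊥-elim (true≢false (some-intro _ l (some-intro _ m
        (∧-intro (not-true (≢⇒≠ ne)) (∧-intro (full-intro X fl) (full-intro X fm))))) h)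

  -- The centre is the intersection of two full lines of `e`. A chamber with its point off `e` has a
  -- line that meets both; not lying in `e`, this line meets them in the same point.
  rich-centre : ∀ {X} → Independent X → Chambers X → ∀ {e} → rich X e ≡ true →
                ∃ λ r → ∀ {x′ l′ e′} → X x′ l′ e′ ≡ true → pl r l′ ≡ true ⊎ pe x′ e ≡ true
  rich-centre {X} ind ch {e} h with rich-lines {X} h
  ... | l , m , l≢m , fl , fm with full-points {X} fl | full-points {X} fm
  ... | _ , _ , _ , cl , _ | _ , _ , _ , cm , _ with coplanar⇒Meet (proj₂ (ch cl)) (proj₂ (ch cm))
  ... | r , rl , rm = r , centre
    where
    centre : ∀ {x′ l′ e′} → X x′ l′ e′ ≡ true → pl r l′ ≡ true ⊎ pe x′ e ≡ true
    centre c′ with full-meet ind ch fl c′ | full-meet ind ch fm c′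
    ... | inj₂ p | _ = inj₂ p
    ... | _ | inj₂ p = inj₂ p
    ... | inj₁ (y , yl , yl′) | inj₁ (z , zm , zl′) with y Fin.≟ z
    ... | yes refl rewrite meet-point-unique l≢m yl zm rl rm = inj₁ yl′
    ... | no y≢z = inj₂ (flag (proj₁ (ch c′))
                     (line⊆ y≢z yl′ zl′ (flag yl (proj₂ (ch cl))) (flag zm (proj₂ (ch cm)))))

-- Light sets with rich planes or rich points

module Peeling {q : ℕ} (G : Geometry q) where
  open Geometry G
  open Incidence G
  open ChamberSets G
  open Parts G
  open TameSets G
  open Rich G

  -- One step of peeling: the chambers in `Y` are paid for at once, and the rest of the estimate
  -- concerns those in `Z`.
  cover : ∀ X Y Z {c} → (∀ {x l e} → X x l e ≡ true → Y x l e ≡ true ⊎ Z x l e ≡ true) →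
          card (X ∩ Y) ≤ c → card X ≤ c + card (X ∩ Z)
  cover X Y Z h b = ≤-trans (card-∪ X (X ∩ Y) (X ∩ Z) each) (+-monoˡ-≤ (card (X ∩ Z)) b)
    where
    each : ∀ {x l e} → X x l e ≡ true → (X ∩ Y) x l e ≡ true ⊎ (X ∩ Z) x l e ≡ true
    each c with h c
    ... | inj₁ y = inj₁ (∩-intro {X} {Y} c y)
    ... | inj₂ z = inj₂ (∩-intro {X} {Z} c z)

  through : Fin nP → ChSet
  through r x l e = pl r l

  inside : Fin nE → ChSet
  inside f x l e = le f l

  light-∩ : ∀ {X} Y → Light X → Light (X ∩ Y)
  light-∩ {X} Y = light-sub G (∩⊆ X Y)

  card-through : ∀ {X} → Light X → ∀ r → card (X ∩ through r) ≤ 2 * K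
  card-through {X} li r = light-through (light-∩ (through r) li) (∩⊆ʳ X (through r))

  card-inside : ∀ {X} → Light X → ∀ f → card (X ∩ inside f) ≤ 2 * K
  card-inside {X} li f = light-in (light-∩ (inside f) li) (∩⊆ʳ X (inside f))

  peel-through : ∀ {X Z r c} → Light X → (∀ {x l e} → X x l e ≡ true → pl r l ≡ true ⊎ Z x l e ≡ true) →
                 card (X ∩ Z) ≤ c → card X ≤ 2 * K + c
  peel-through {X} {Z} {r} li h b = ≤-trans (cover X (through r) Z h (card-through li r)) (+-monoʳ-≤ (2 * K) b)

  peel-inside : ∀ {X Z f c} → Light X → (∀ {x l e} → X x l e ≡ true → le f l ≡ true ⊎ Z x l e ≡ true) →
                card (X ∩ Z) ≤ c → card X ≤ 2 * K + c
  peel-inside {X} {Z} {f} li h b = ≤-trans (cover X (inside f) Z h (card-inside li f)) (+-monoʳ-≤ (2 * K) b)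

  -- Each of the q + 1 points of `m` has at most q + 1 lines in `e`, so the bound is valid in rich
  -- planes too.
  in-plane-crude : ∀ {X} → Chambers X → ∀ m e → (∀ {x l} → X x l e ≡ true → pl x m ≡ true) → in-plane X e ≤ suc q * suc q
  in-plane-crude {X} ch m e sup = ≤-trans (≤-reflexive (∑-comm (λ l x → ι (X x l e))))
    (≤-trans (sum-support (λ x → # (λ l → X x l e)) (λ x → pl x m) (suc q) each
      (λ x n → #-none _ (λ l c → true≢false (sup c) n)))
    (≤-reflexive (cong (_* suc q) (#points-on m))))
    where
    each : ∀ x → pl x m ≡ true → # (λ l → X x l e) ≤ suc q
    each x _ with decide (pe x e)
    ... | inj₁ xe = ≤-trans (#-mono (λ l c → ∧-intro (proj₁ (ch c)) (proj₂ (ch c)))) (≤-reflexive (#pencil xe))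
    ... | inj₂ n = ≤-trans (≤-reflexive (#-none _ (λ l c → true≢false (flag (proj₁ (ch c)) (proj₂ (ch c))) n))) z≤n

  in-plane-total : ∀ {X} → Chambers X → ∀ e → in-plane X e ≤ K
  in-plane-total {X} ch e = begin
    in-plane X e      ≤⟨ sum-mono (λ l → column-bound ch l e) ⟩
    sum (λ l → ι (le e l) * suc q)    ≡⟨ *-distribʳ-sum (suc q) (λ l → ι (le e l)) ⟨
    # (λ l → le e l) * suc q      ≡⟨ cong (_* suc q) (Incidence.#lines-on (dual G) e) ⟩
    (q * q + q + 1) * suc q      ≤⟨ m≤m+n _ (q * suc q) ⟩
    (q * q + q + 1) * suc q + q * suc q ≡⟨ trans (arith q) (cube-def q) ⟩
    K      ∎
    where
    open ≤-Reasoning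
    arith : ∀ q → (q * q + q + 1) * suc q + q * suc q ≡ suc q * (suc q * suc q)
    arith = solve-∀

  one-plane : ∀ {X} → Chambers X → (D : Fin nE → Bool) → # D ≤ 1 → (∀ {x l e} → X x l e ≡ true → D e ≡ true) → card X ≤ K
  one-plane {X} ch D d sup = ≤-trans (by-planes X D K sup (λ e _ → in-plane-total ch e))
    (≤-trans (*-monoˡ-≤ K d) (≤-reflexive (*-identityˡ K)))

module LightSets {q : ℕ} (G : Geometry q) where
  open Geometry G
  open Incidence G
  open ChamberSets G
  open Parts G
  open TameSets G
  open Rich G
  open Peeling G
  private
    module C* = ChamberSets (dual G)
    module L* = Rich (dual G)
    module L₂* = Peeling (dual G)

  rich* : ChSet → Fin nP → Bool
  rich* X = L*.rich (flip G X)

  chambers-∩ : ∀ {X} Y → Chambers X → Chambers (X ∩ Y)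
  chambers-∩ {X} Y ch h = ch (∩⊆ X Y h)

  one-point : ∀ {X} → Chambers X → (D : Fin nP → Bool) → # D ≤ 1 → (∀ {x l e} → X x l e ≡ true → D x ≡ true) → card X ≤ K
  one-point {X} ch D d sup = ≤-trans (≤-reflexive (sym (card-flip G X))) (L₂*.one-plane (chambers-flip G ch) D d sup)

  -- The conclusion of `rich-centre` for a plane `e`; `Axis` is the dual conclusion for a point.
  Centre : ChSet → Fin nP → Fin nE → Set
  Centre X r e = ∀ {x′ l′ e′} → X x′ l′ e′ ≡ true → pl r l′ ≡ true ⊎ pe x′ e ≡ true

  Axis : ChSet → Fin nE → Fin nP → Set
  Axis X f x = ∀ {x′ l′ e′} → X x′ l′ e′ ≡ true → le f l′ ≡ true ⊎ pe x e′ ≡ true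

  -- Peeling off the chambers through the two centres and in the two axial planes costs 4 times 2.
  -- In what is left the point lies on `m`, where `e₁` and `e₂` meet, and the plane contains `k`,
  -- the join of `x₁` and `x₂`: q + 1 planes with (q + 1)² chambers each.
  two-centres-two-axes : ∀ {X} → Chambers X → Light X →
    ∀ {e₁ e₂ x₁ x₂ r₁ r₂ f₁ f₂} → e₁ ≢ e₂ → x₁ ≢ x₂ →
    Centre X r₁ e₁ → Centre X r₂ e₂ → Axis X f₁ x₁ → Axis X f₂ x₂ →
    ∀ {m k} → le e₁ m ≡ true → le e₂ m ≡ true → pl x₁ k ≡ true → pl x₂ k ≡ true → card X ≤ 9 * K
  two-centres-two-axes {X} ch li {e₁} {e₂} {x₁} {x₂} {r₁} {r₂} {f₁} {f₂} e₁≢e₂ x₁≢x₂ cr₁ cr₂ cf₁ cf₂ {m} {k} e₁m e₂m x₁k x₂k =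
    ≤-trans (peel-through {X} {Z₁} {r₁} li cr₁
      (peel-through {X ∩ Z₁} {Z₂} {r₂} (light-∩ Z₁ li) (λ c → cr₂ (∩⊆ X Z₁ c))
      (peel-inside {X ∩ Z₁ ∩ Z₂} {Z₃} {f₁} (light-∩ Z₂ (light-∩ Z₁ li)) (λ c → cf₁ (∩⊆ X Z₁ (∩⊆ (X ∩ Z₁) Z₂ c)))
      (peel-inside {X ∩ Z₁ ∩ Z₂ ∩ Z₃} {Z₄} {f₂} (light-∩ Z₃ (light-∩ Z₂ (light-∩ Z₁ li)))
         (λ c → cf₂ (∩⊆ X Z₁ (∩⊆ (X ∩ Z₁) Z₂ (∩⊆ (X ∩ Z₁ ∩ Z₂) Z₃ c))))
         rest))))
      (≤-reflexive (arith K))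
    where
    arith : ∀ K → 2 * K + (2 * K + (2 * K + (2 * K + K))) ≡ 9 * K
    arith = solve-∀
    Z₁ Z₂ Z₃ Z₄ R : ChSet
    Z₁ x l e = pe x e₁
    Z₂ x l e = pe x e₂
    Z₃ x l e = pe x₁ e
    Z₄ x l e = pe x₂ e
    R = X ∩ Z₁ ∩ Z₂ ∩ Z₃ ∩ Z₄
    on-m : ∀ {x l e} → R x l e ≡ true → pl x m ≡ true
    on-m h = let h₁ = ∩⊆ (X ∩ Z₁ ∩ Z₂) Z₃ (∩⊆ (X ∩ Z₁ ∩ Z₂ ∩ Z₃) Z₄ h) in
      line∋ e₁≢e₂ e₁m e₂m (∩⊆ʳ X Z₁ (∩⊆ (X ∩ Z₁) Z₂ h₁)) (∩⊆ʳ (X ∩ Z₁) Z₂ h₁)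
    on-k : ∀ {x l e} → R x l e ≡ true → le e k ≡ true
    on-k h = line⊆ x₁≢x₂ x₁k x₂k (∩⊆ʳ (X ∩ Z₁ ∩ Z₂) Z₃ (∩⊆ (X ∩ Z₁ ∩ Z₂ ∩ Z₃) Z₄ h))
                                             (∩⊆ʳ (X ∩ Z₁ ∩ Z₂ ∩ Z₃) Z₄ h)
    chR : Chambers R
    chR = chambers-∩ {X ∩ Z₁ ∩ Z₂ ∩ Z₃} Z₄ (chambers-∩ {X ∩ Z₁ ∩ Z₂} Z₃ (chambers-∩ {X ∩ Z₁} Z₂ (chambers-∩ {X} Z₁ ch)))
    rest : card R ≤ K
    rest = ≤-trans (by-planes R (λ e → le e k) (suc q * suc q) on-k
        (λ e _ → in-plane-crude {R} chR m e on-m))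
      (≤-reflexive (trans (cong (_* (suc q * suc q)) (#planes-on k)) (cube-def q)))

  two-rich-planes-and-points : ∀ {X} → Independent X → Chambers X → Light X →
    2 ≤ # (rich X) → 2 ≤ # (rich* X) → card X ≤ 9 * K
  two-rich-planes-and-points {X} ind ch li 2e 2x =
    let (e₁ , e₂ , e₁≢e₂ , re₁ , re₂) = #-≥2 (rich X) 2e
        (x₁ , x₂ , x₁≢x₂ , rx₁ , rx₂) = #-≥2 (rich* X) 2x
        (m , e₁m , e₂m) = meet e₁ e₂
        (k , x₁k , x₂k) = join x₁ x₂
    in two-centres-two-axes ch li e₁≢e₂ x₁≢x₂
         (proj₂ (rich-centre ind ch re₁)) (proj₂ (rich-centre ind ch re₂))
         (proj₂ (L*.rich-centre (independent-flip G ind) (chambers-flip G ch) rx₁))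
         (proj₂ (L*.rich-centre (independent-flip G ind) (chambers-flip G ch) rx₂)) e₁m e₂m x₁k x₂k

  at-point-nonrich : ∀ {X} → Chambers X → ∀ x → rich* X x ≡ false → at-point X x ≤ suc q * suc q
  at-point-nonrich {X} ch x n = C*.in-plane-all {X = flip G X} (chambers-flip G ch) x (L*.nonrich {X = flip G X} {e = x} n) (#lines-on x)

  -- Once the two centres are peeled off, all points lie on `m`. A point of `m` that is not rich has
  -- at most (q + 1)² chambers, and a rich point, if there is one, is deleted at the cost `K`.
  two-centres : ∀ {X} → Chambers X → Light X → # (rich* X) ≤ 1 →
    ∀ {e₁ e₂ r₁ r₂} → e₁ ≢ e₂ → Centre X r₁ e₁ → Centre X r₂ e₂ →
    ∀ {m} → le e₁ m ≡ true → le e₂ m ≡ true → card X ≤ 6 * K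
  two-centres {X} ch li 1x {e₁} {e₂} {r₁} {r₂} e₁≢e₂ cr₁ cr₂ {m} e₁m e₂m =
    ≤-trans (peel-through {X} {Z₁} {r₁} li cr₁
      (peel-through {X ∩ Z₁} {Z₂} {r₂} (light-∩ Z₁ li) (λ c → cr₂ (∩⊆ X Z₁ c))
      (≤-trans (cover R (λ x l e → rich* X x) N (λ {x} _ → decide-not (rich* X x))
          (one-point {R ∩ (λ x l e → rich* X x)} (λ h → ch (∩⊆ X Z₁ (∩⊆ (X ∩ Z₁) Z₂ (∩⊆ R (λ x l e → rich* X x) h))))
             (rich* X) 1x (∩⊆ʳ R (λ x l e → rich* X x))))
        (+-monoʳ-≤ K nonrich-part))))
      (≤-reflexive (arith K))
    where
    arith : ∀ K → 2 * K + (2 * K + (K + K)) ≡ 6 * K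
    arith = solve-∀
    Z₁ Z₂ R N : ChSet
    Z₁ x l e = pe x e₁
    Z₂ x l e = pe x e₂
    R = X ∩ Z₁ ∩ Z₂
    N x l e = not (rich* X x)
    R⊆X : ∀ {x l e} → R x l e ≡ true → X x l e ≡ true
    R⊆X h = ∩⊆ X Z₁ (∩⊆ (X ∩ Z₁) Z₂ h)
    D : Fin nP → Bool
    D x = pl x m ∧ not (rich* X x)
    on-D : ∀ {x l e} → (R ∩ N) x l e ≡ true → D x ≡ true
    on-D h = let h₁ = ∩⊆ R N h in ∧-intro
      (line∋ e₁≢e₂ e₁m e₂m (∩⊆ʳ X Z₁ (∩⊆ (X ∩ Z₁) Z₂ h₁)) (∩⊆ʳ (X ∩ Z₁) Z₂ h₁))
      (∩⊆ʳ R N h)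
    nonrich-part : card (R ∩ N) ≤ K
    nonrich-part = begin
      card (R ∩ N)      ≡⟨ card-by-point (R ∩ N) ⟩
      sum (at-point (R ∩ N))      ≤⟨ sum-support (at-point (R ∩ N)) D (suc q * suc q)
         (λ x d → ≤-trans (sum-mono (λ l → #-mono (λ e h → R⊆X (∩⊆ R N h))))
                          (at-point-nonrich ch x (not-false (proj₂ (∧-elim {pl x m} d)))))
         (λ x n → sum-none (λ l e → (R ∩ N) x l e) (λ l e h → true≢false (on-D h) n)) ⟩
      # D * (suc q * suc q)      ≤⟨ *-monoˡ-≤ (suc q * suc q) (#-mono (λ x d → proj₁ (∧-elim {pl x m} d))) ⟩
      # (λ x → pl x m) * (suc q * suc q) ≡⟨ trans (cong (_* (suc q * suc q)) (#points-on m)) (cube-def q) ⟩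
      K      ∎
      where open ≤-Reasoning

  two-rich-planes : ∀ {X} → Independent X → Chambers X → Light X →
    2 ≤ # (rich X) → # (rich* X) ≤ 1 → card X ≤ 6 * K
  two-rich-planes {X} ind ch li 2e 1x =
    let (e₁ , e₂ , e₁≢e₂ , re₁ , re₂) = #-≥2 (rich X) 2e
        (m , e₁m , e₂m) = meet e₁ e₂
    in two-centres ch li 1x e₁≢e₂ (proj₂ (rich-centre ind ch re₁)) (proj₂ (rich-centre ind ch re₂)) e₁m e₂m

  few-rich : ∀ {X} → Independent X → Chambers X → Light X → # (rich X) ≤ 1 → # (rich* X) ≤ 1 → card X ≤ 24 * K
  few-rich {X} ind ch li 1e 1x = begin
      card X      ≤⟨ cover X A N₁ (λ {x l e} _ → decide-not (rich X e)) (one-plane {X ∩ A} (chambers-∩ A ch) (rich X) 1e (∩⊆ʳ X A)) ⟩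
      K + card (X ∩ N₁)      ≤⟨ +-monoʳ-≤ K (cover (X ∩ N₁) B N₂ (λ {x} _ → decide-not (rich* X x))
                                                    (one-point {X ∩ N₁ ∩ B} (chambers-∩ {X ∩ N₁} B (chambers-∩ {X} N₁ ch)) (rich* X) 1x (∩⊆ʳ (X ∩ N₁) B))) ⟩
      K + (K + card Y)      ≤⟨ +-monoʳ-≤ K (+-monoʳ-≤ K (tame-bound {Y} tameY (λ c c′ → ind (Y⊆X c) (Y⊆X c′)))) ⟩
      K + (K + 22 * K)      ≡⟨ arith K ⟩
      24 * K      ∎
    where
    open ≤-Reasoning
    arith : ∀ K → K + (K + 22 * K) ≡ 24 * K
    arith = solve-∀
    A B N₁ N₂ Y : ChSet
    A x l e = rich X e
    B x l e = rich* X x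
    N₁ x l e = not (rich X e)
    N₂ x l e = not (rich* X x)
    Y = X ∩ N₁ ∩ N₂
    Y⊆X : ∀ {x l e} → Y x l e ≡ true → X x l e ≡ true
    Y⊆X h = ∩⊆ X N₁ (∩⊆ (X ∩ N₁) N₂ h)
    nrE : ∀ e → NonRich Y e
    -- A chamber of `Y` in the plane `e` shows that `e` survived the deletion and so is not rich in
    -- `X`; lines that are full for `Y` are full for `X`.
    nrE e l m hl hm with #-≥2 _ hl
    ... | x , _ , _ , c , _ = nonrich {X} (not-false (∩⊆ʳ X N₁ (∩⊆ (X ∩ N₁) N₂ c))) l m
          (≤-trans hl (#-mono (λ x → Y⊆X))) (≤-trans hm (#-mono (λ x → Y⊆X {x} {m} {e})))
    nrP : ∀ x → C*.NonRich (flip G Y) x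
    nrP x l m hl hm with #-≥2 _ hl
    ... | e , _ , _ , c , _ = L*.nonrich {flip G X} (not-false (∩⊆ʳ (X ∩ N₁) N₂ c)) l m
          (≤-trans hl (#-mono (λ e → Y⊆X))) (≤-trans hm (#-mono (λ e → Y⊆X {x} {m} {e})))
    tameY : Tame G Y
    tameY = tame (λ h → ch (Y⊆X h)) (light-sub G Y⊆X li) nrE nrP

-- Heavy lines and the trichotomy for independent sets

module Heavy {q : ℕ} (G : Geometry q) where
  open Geometry G
  open Incidence G
  open ChamberSets G
  open Parts G
  open TameSets G
  open Rich G
  open Peeling G
  open LightSets G
  private
    module L₃* = LightSets (dual G)

  light-bound : ∀ {X} → Independent X → Chambers X → Light X → card X ≤ 24 * K
  light-bound {X} ind ch li with 2 ≤? # (rich X) | 2 ≤? # (rich* X)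
  ... | yes 2e | yes 2x = ≤-trans (two-rich-planes-and-points ind ch li 2e 2x) (*-monoˡ-≤ K (m≤m+n 9 15))
  ... | yes 2e | no ¬2x = ≤-trans (two-rich-planes ind ch li 2e (≤-pred (≰⇒> ¬2x))) (*-monoˡ-≤ K (m≤m+n 6 18))
  ... | no ¬2e | yes 2x = ≤-trans (≤-trans (≤-reflexive (sym (card-flip G X)))
        (L₃*.two-rich-planes (independent-flip G ind) (chambers-flip G ch) (light-flip G li) 2x (≤-pred (≰⇒> ¬2e)))) (*-monoˡ-≤ K (m≤m+n 6 18))
  ... | no ¬2e | no ¬2x = few-rich ind ch li (≤-pred (≰⇒> ¬2e)) (≤-pred (≰⇒> ¬2x))

  heavy : ChSet → Fin nL → Bool
  heavy X l = some (λ e → some (λ f → not (e == f) ∧ (full X l e ∧ full X l f)))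

  heavy-planes : ∀ {X l} → heavy X l ≡ true → ∃₂ λ e f → e ≢ f × full X l e ≡ true × full X l f ≡ true
  heavy-planes {X} {l} h with some-elim _ h
  ... | e , h₁ with some-elim _ h₁
  ... | f , h₂ with ∧-elim {not (e == f)} h₂
  ... | ne , h₃ = e , f , ≠⇒≢ (not-false ne) , ∧-elim h₃

  nonheavy : ∀ {X l} → heavy X l ≡ false → NonHeavy X l
  nonheavy {X} {l} h e f fe ff with e Fin.≟ f
  ... | yes eq = eq
  ... | no ne = ⊥-elim (true≢false (some-intro _ e (some-intro _ f
        (∧-intro (not-true (≢⇒≠ ne)) (∧-intro (full-intro X fe) (full-intro X ff))))) h)

  heavy-chamber : ∀ {X l} → heavy X l ≡ true → ∃₂ λ x e → X x l e ≡ true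
  heavy-chamber {X} h with heavy-planes {X} h
  ... | e , _ , _ , fe , _ with full-points {X} fe
  ... | x , _ , _ , c , _ = x , e , c

  -- Unless `full-meet` already gives the intersection, the point `x′` lies in both planes in which
  -- `l` is full, that is, on `l`.
  heavy-meet : ∀ {X} → Independent X → Chambers X → ∀ {l} → heavy X l ≡ true →
               ∀ {x′ l′ e′} → X x′ l′ e′ ≡ true → Meet l l′
  heavy-meet {X} ind ch {l} h {x′} c′ with heavy-planes {X} h
  ... | e , f , e≢f , fe , ff with full-points {X} fe | full-points {X} ff
  ... | _ , _ , _ , ce , _ | _ , _ , _ , cf , _ with full-meet ind ch fe c′ | full-meet ind ch ff c′
  ... | inj₁ m | _ = m
  ... | _ | inj₁ m = m
  ... | inj₂ p | inj₂ r = x′ , line∋ e≢f (proj₂ (ch ce)) (proj₂ (ch cf)) p r , proj₁ (ch c′)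

module Triangle {q : ℕ} (G : Geometry q) where
  open Geometry G
  open Incidence G

  -- The line `h₃` misses `r` and therefore lies in `f`. A line not in `f` meets `f` only once, and
  -- a point common to all three sides would have to be `r`. The dual statement treats three lines
  -- through a point that are not coplanar.
  triangle : ∀ {r f h₁ h₂ h₃ l} → h₁ ≢ h₂ → pl r h₁ ≡ true → pl r h₂ ≡ true → le f h₁ ≡ true → le f h₂ ≡ true →
             pl r h₃ ≡ false → Meet h₁ h₃ → Meet h₂ h₃ → Meet h₁ l → Meet h₂ l → Meet h₃ l → le f l ≡ true
  triangle {r} {f} {h₁} {h₂} {h₃} {l} ne r₁ r₂ f₁ f₂ r∉ (z₁ , z₁₁ , z₁₃) (z₂ , z₂₂ , z₂₃) (y₁ , y₁₁ , y₁l) (y₂ , y₂₂ , y₂l) (y₃ , y₃₃ , y₃l)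
    with decide (le f l)
  ... | inj₁ fl = fl
  ... | inj₂ l⊄f = ⊥-elim (true≢false (subst (λ y → pl y h₃ ≡ true) y₃≡r y₃₃) r∉)
    where
    z₁≢z₂ : z₁ ≢ z₂
    z₁≢z₂ refl = true≢false (subst (λ z → pl z h₃ ≡ true) (meet-point-unique ne z₁₁ z₂₂ r₁ r₂) z₁₃) r∉
    f₃ : le f h₃ ≡ true
    f₃ = line⊆ z₁≢z₂ z₁₃ z₂₃ (flag z₁₁ f₁) (flag z₂₂ f₂)
    y₁≡y₂ : y₁ ≡ y₂
    y₁≡y₂ = cut-unique l⊄f y₁l (flag y₁₁ f₁) y₂l (flag y₂₂ f₂)
    y₃≡r : y₃ ≡ r
    y₃≡r = trans (cut-unique l⊄f y₃l (flag y₃₃ f₃) y₁l (flag y₁₁ f₁))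
                 (meet-point-unique ne y₁₁ (subst (λ y → pl y h₂ ≡ true) (sym y₁≡y₂) y₂₂) r₁ r₂)

module Trichotomy {q : ℕ} (G : Geometry q) where
  open Geometry G
  open Incidence G
  open ChamberSets G
  open Parts G
  open TameSets G
  open Peeling G
  open Heavy G
  open Triangle G
  private
    module I* = Incidence (dual G)
    module T* = Triangle (dual G)

  Through : ChSet → Fin nP → Set
  Through X r = ∀ {x l e} → X x l e ≡ true → pl r l ≡ true

  Inside : ChSet → Fin nE → Set
  Inside X f = ∀ {x l e} → X x l e ≡ true → le f l ≡ true

  lines-satisfy? : ∀ (X : ChSet) (D : Fin nL → Bool) → (∀ {x l e} → X x l e ≡ true → D l ≡ true) ⊎
                   (∃ λ x → ∃₂ λ l e → X x l e ≡ true × D l ≡ false)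
  lines-satisfy? X D with search (λ x l e → X x l e ∧ not (D l))
  ... | inj₁ (x , l , e , h) = let (c , n) = ∧-elim {X x l e} h in inj₂ (x , l , e , c , not-false n)
  ... | inj₂ none = inj₁ each
    where
    each : ∀ {x l e} → X x l e ≡ true → D l ≡ true
    each {l = l} c with decide (D l)
    ... | inj₁ p = p
    ... | inj₂ n = ⊥-elim (none (∧-intro c (not-true n)))

  few-heavy : ∀ {X} → Independent X → Chambers X →
              (∃ λ r → Through X r) ⊎ ((∃ λ f → Inside X f) ⊎ # (heavy X) ≤ suc q)
  few-heavy {X} ind ch with 2 ≤? # (heavy X)
  ... | no ¬2 = inj₂ (inj₂ (≤-trans (≤-pred (≰⇒> ¬2)) (s≤s z≤n)))
  ... | yes 2h with #-≥2 (heavy X) 2h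
  ... | h₁ , h₂ , ne , hv₁ , hv₂ with heavy-chamber {X} hv₂
  ... | _ , _ , c₂ with heavy-meet ind ch hv₁ c₂
  ... | r , r₁ , r₂ with I*.coplanar⇒Meet r₁ r₂
  ... | f , f₁ , f₂ with lines-satisfy? X (pl r) | lines-satisfy? X (le f)
  ... | inj₁ t | _ = inj₁ (r , t)
  ... | _ | inj₁ i = inj₂ (inj₁ (f , i))
  -- The lines `l` off `r` and `m` outside `f` occur in `X` and refute the conclusions of the dual
  -- and of `triangle` itself. So every heavy line belongs to the pencil of `r` in `f`.
  ... | inj₂ (_ , l , _ , c , r∉l) | inj₂ (_ , m , _ , d , m⊄f) = inj₂ (inj₂ (≤-trans
        (#-mono pencil) (≤-reflexive (#pencil (flag r₁ f₁)))))
    where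
    hm : ∀ {h} → heavy X h ≡ true → ∀ {h′} → heavy X h′ ≡ true → Meet h h′
    hm hv hv′ = let (_ , _ , c′) = heavy-chamber {X} hv′ in heavy-meet ind ch hv c′
    dualMeet : ∀ {l l′} → Meet l l′ → I*.Meet l l′
    dualMeet (x , a , b) = I*.coplanar⇒Meet a b
    pencil : ∀ h → heavy X h ≡ true → pl r h ∧ le f h ≡ true
    pencil h hv with decide (pl r h) | decide (le f h)
    ... | inj₁ a | inj₁ b = ∧-intro a b
    ... | inj₂ n | _ = ⊥-elim (true≢false (triangle ne r₁ r₂ f₁ f₂ n (hm hv₁ hv) (hm hv₂ hv)
            (heavy-meet ind ch hv₁ d) (heavy-meet ind ch hv₂ d) (heavy-meet ind ch hv d)) m⊄f)
    ... | _ | inj₂ n = ⊥-elim (true≢false (T*.triangle ne f₁ f₂ r₁ r₂ n (dualMeet (hm hv₁ hv)) (dualMeet (hm hv₂ hv))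
            (dualMeet (heavy-meet ind ch hv₁ c)) (dualMeet (heavy-meet ind ch hv₂ c)) (dualMeet (heavy-meet ind ch hv c))) r∉l)

  trichotomy : ∀ {X} → Independent X → Chambers X →
               (∃ λ r → Through X r) ⊎ ((∃ λ f → Inside X f) ⊎ card X ≤ 25 * K)
  trichotomy {X} ind ch with few-heavy ind ch
  ... | inj₁ t = inj₁ t
  ... | inj₂ (inj₁ i) = inj₂ (inj₁ i)
  ... | inj₂ (inj₂ few) = inj₂ (inj₂ (begin
        card X      ≤⟨ cover X H N (λ {x l} _ → decide-not (heavy X l)) cardH ⟩
        K + card (X ∩ N)      ≤⟨ +-monoʳ-≤ K (light-bound {X ∩ N}
             (λ c c′ → ind (∩⊆ X N c) (∩⊆ X N c′))
             (λ h → ch (∩⊆ X N h)) lightN) ⟩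
        25 * K      ∎))
    where
    open ≤-Reasoning
    H N : ChSet
    H x l e = heavy X l
    N x l e = not (heavy X l)
    cardH : card (X ∩ H) ≤ K
    cardH = ≤-trans (by-lines (X ∩ H) (heavy X) (suc q * suc q) (∩⊆ʳ X H)
               (λ l _ → on-line-crude (λ h → ch (∩⊆ X H h)) l))
             (≤-trans (*-monoˡ-≤ (suc q * suc q) few) (≤-reflexive (cube-def q)))
    lightN : Light (X ∩ N)
    lightN l with decide (heavy X l)
    ... | inj₁ h = ≤-trans (≤-reflexive (sum-none (λ x e → (X ∩ N) x l e)
            (λ x e c → true≢false h (not-false (∩⊆ʳ X N c))))) z≤n
    ... | inj₂ n = ≤-trans (sum-mono (λ x → #-mono (λ e c → ∩⊆ X N c))) (nonheavy⇒light ch l (nonheavy {X} n))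

-- Covering lines by points and planes

module Blocking {q : ℕ} (G : Geometry q) (A : Fin (Geometry.nP G) → Bool) where
  open Geometry G
  open Incidence G

  blocked : Fin nL → Bool
  blocked l = some (λ x → A x ∧ pl x l)

  #A-in : Fin nE → ℕ
  #A-in e = # (λ x → A x ∧ pe x e)

  -- One point `p` of `A` in `e` blocks q + 1 lines; every further point adds at most q, since its
  -- line to `p` is already counted.
  blocked-in-plane : ∀ e → # (λ l → le e l ∧ blocked l) ≤ q * #A-in e + 1
  blocked-in-plane e with Fin.any? (λ x → true? (A x ∧ pe x e))
  ... | no none = ≤-trans (≤-reflexive (#-none _ (λ l h → let (el , b) = ∧-elim {le e l} h ; (x , k) = some-elim _ b ; (a , xl) = ∧-elim {A x} k in
                    none (x , ∧-intro a (flag xl el))))) z≤n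
  ... | yes (p , h) = begin
      # D      ≡⟨ #-split D (λ l → pl p l) ⟩
      # (λ l → D l ∧ pl p l) + # D′      ≤⟨ +-mono-≤ (≤-trans (#-mono (λ l k → let (d , b) = ∧-elim {D l} k in ∧-intro b (proj₁ (∧-elim d)))) (≤-reflexive (#pencil pe-e)))
                                                          (≤-trans (≤-reflexive (sym (*-identityʳ (# D′)))) part) ⟩
      suc q + # E * q      ≡⟨ arith q (# E) ⟩
      q * suc (# E) + 1      ≡⟨ cong (λ z → q * z + 1) (#-remove (λ x → A x ∧ pe x e) p h) ⟨
      q * #A-in e + 1      ∎
    where
    open ≤-Reasoning
    arith : ∀ q z → suc q + z * q ≡ q * suc z + 1
    arith = solve-∀
    pe-e = proj₂ (∧-elim {A p} h)
    D = λ l → le e l ∧ blocked l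
    D′ = λ l → D l ∧ not (pl p l)
    E = λ x → (A x ∧ pe x e) ∧ not (x == p)
    part : # D′ * 1 ≤ # E * q
    part = double D′ E (λ l x → pl x l) 1 q
      (λ l k → let (d , n) = ∧-elim {D l} k ; (el , b) = ∧-elim d ; (x , ax) = some-elim _ b ; (a , xl) = ∧-elim {A x} ax
               in #-≥1 _ x (∧-intro (∧-intro (∧-intro a (flag xl el)) (≠-intro (∌⇒≢′ xl (not-false n)))) xl))
      (λ x k → let (ax , n) = ∧-elim {A x ∧ pe x e} k
                   xe = proj₂ (∧-elim {A x} ax)
                   (m , xm , pm , em) = join-in-plane xe pe-e (≠-elim n)
               in ≤-trans (#-mono (λ l j → let (d′ , xl) = ∧-elim {D′ l} j ; (d , np) = ∧-elim {D l} d′ in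
                             ∧-intro (∧-intro xl (proj₁ (∧-elim {le e l} d))) (≠-intro (λ eq → true≢false (subst (λ z → pl p z ≡ true) (sym eq) pm) (not-false np)))))
                    (≤-reflexive (suc-injective (trans (sym (#-remove (λ l → pl x l ∧ le e l) m (∧-intro xm em))) (#pencil xe)))))
      where
      ∌⇒≢′ : ∀ {x l} → pl x l ≡ true → pl p l ≡ false → x ≢ p
      ∌⇒≢′ xl n refl = true≢false xl n

  #A-in-total : sum #A-in ≡ # A * (q * q + q + 1)
  #A-in-total = begin
    sum (λ e → # (λ x → A x ∧ pe x e))     ≡⟨ ∑-comm (λ e x → ι (A x ∧ pe x e)) ⟩
    sum (λ x → # (λ e → A x ∧ pe x e))     ≡⟨ sum-cong-≗ each ⟩
    sum (λ x → ι (A x) * (q * q + q + 1))  ≡⟨ *-distribʳ-sum (q * q + q + 1) (ι ∘ A) ⟨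
    # A * (q * q + q + 1)      ∎
    where
    open ≡-Reasoning
    each : ∀ x → # (λ e → A x ∧ pe x e) ≡ ι (A x) * (q * q + q + 1)
    each x with A x
    ... | true = trans (Incidence.#points-in (dual G) x) (sym (+-identityʳ _))
    ... | false = sum-zero nE

  -- Count two points of `A` together with a plane on both: there are q + 1 planes for distinct
  -- points, and q² more on the diagonal.
  #A-in-square : # A * (q * q) + # A * # A * suc q ≤ sum (λ e → #A-in e * #A-in e)
  #A-in-square = begin
    # A * (q * q) + # A * # A * suc q      ≡⟨ arith (# A) q ⟩
    # A * (q * q + # A * suc q)      ≡⟨ *-distribʳ-sum (q * q + # A * suc q) (ι ∘ A) ⟩
    sum (λ x → ι (A x) * (q * q + # A * suc q))      ≤⟨ sum-mono each ⟩
    sum (λ x → sum (λ e → ι (A x ∧ pe x e) * #A-in e))      ≡⟨ ∑-comm (λ x e → ι (A x ∧ pe x e) * #A-in e) ⟩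
    sum (λ e → sum (λ x → ι (A x ∧ pe x e) * #A-in e))      ≡⟨ sum-cong-≗ (λ e → *-distribʳ-sum (#A-in e) (λ x → ι (A x ∧ pe x e))) ⟨
    sum (λ e → #A-in e * #A-in e)      ∎
    where
    open ≤-Reasoning
    arith : ∀ a q → a * (q * q) + a * a * suc q ≡ a * (q * q + a * suc q)
    arith = solve-∀
    -- The last summand keeps the inequality valid for `y` outside `A`; it vanishes in the
    -- application, where `x` belongs to `A`.
    pairs : ∀ x y → ι (A y) * suc q + ι (x == y) * (q * q) ≤ # (λ e → pe x e ∧ (A y ∧ pe y e)) + ι (not (A y)) * (ι (x == y) * (q * q))
    pairs x y with A y
    ... | false = ≤-trans (≤-reflexive (sym (+-identityʳ (ι (x == y) * (q * q))))) (m≤n+m _ (# (λ e → pe x e ∧ (false ∧ pe y e))))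
    ... | true with decide (x == y)
    ... | inj₁ eq rewrite ==-elim x y eq | ==-refl {i = y} refl = ≤-trans (≤-reflexive (trans (arith′ q) (sym (Incidence.#points-in (dual G) y))))
            (≤-trans (#-mono (λ e h → ∧-intro h h)) (m≤m+n _ _))
      where
      arith′ : ∀ q → suc q + 0 + (q * q + 0) ≡ q * q + q + 1
      arith′ = solve-∀
    ... | inj₂ ne rewrite ne = ≤-trans (≤-reflexive (trans (arith′ q) (sym (#planes-on m)))) (≤-trans (#-mono (λ e em → ∧-intro (flag xm em) (flag ym em))) (m≤m+n _ _))
      where
      m = proj₁ (join x y)
      xm = proj₁ (proj₂ (join x y))
      ym = proj₂ (proj₂ (join x y))
      arith′ : ∀ q → suc q + 0 + 0 ≡ suc q
      arith′ = solve-∀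
    each : ∀ x → ι (A x) * (q * q + # A * suc q) ≤ sum (λ e → ι (A x ∧ pe x e) * #A-in e)
    each x with A x in Ax
    ... | false = z≤n
    ... | true = begin
      q * q + # A * suc q + 0      ≡⟨ arith₁ (q * q) (# A * suc q) ⟩
      # A * suc q + 1 * (q * q)      ≡⟨ cong₂ (λ u v → u + v * (q * q)) (*-distribʳ-sum (suc q) (ι ∘ A)) (sym single) ⟩
      sum (λ y → ι (A y) * suc q) + # (λ y → x == y) * (q * q)      ≡⟨ cong (sum (λ y → ι (A y) * suc q) +_) (*-distribʳ-sum (q * q) (λ y → ι (x == y))) ⟩
      sum (λ y → ι (A y) * suc q) + sum (λ y → ι (x == y) * (q * q))     ≡⟨ ∑-distrib-+ (λ y → ι (A y) * suc q) (λ y → ι (x == y) * (q * q)) ⟨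
      sum (λ y → ι (A y) * suc q + ι (x == y) * (q * q))      ≤⟨ sum-mono (λ y → ≤-trans (pairs x y) (≤-reflexive (cong (# (λ e → pe x e ∧ (A y ∧ pe y e)) +_) (vanish y)))) ⟩
      sum (λ y → # (λ e → pe x e ∧ (A y ∧ pe y e)) + 0)      ≡⟨ sum-cong-≗ (λ y → +-identityʳ _) ⟩
      sum (λ y → # (λ e → pe x e ∧ (A y ∧ pe y e)))      ≡⟨ ∑-comm (λ y e → ι (pe x e ∧ (A y ∧ pe y e))) ⟩
      sum (λ e → # (λ y → pe x e ∧ (A y ∧ pe y e)))      ≡⟨ sum-cong-≗ factor ⟩
      sum (λ e → ι (pe x e) * #A-in e)      ∎
      where
      arith₁ : ∀ u v → u + v + 0 ≡ v + 1 * u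
      arith₁ = solve-∀
      single : # (λ y → x == y) ≡ 1
      single = ≤-antisym (#-≤1 _ (λ y z p r → trans (sym (==-elim x y p)) (==-elim x z r))) (#-≥1 _ x (==-refl refl))
      vanish : ∀ y → ι (not (A y)) * (ι (x == y) * (q * q)) ≡ 0
      vanish y with decide (x == y)
      ... | inj₂ ne rewrite ne = *-zeroʳ (ι (not (A y)))
      ... | inj₁ eq rewrite sym (==-elim x y eq) | Ax = refl
      factor : ∀ e → # (λ y → pe x e ∧ (A y ∧ pe y e)) ≡ ι (pe x e) * #A-in e
      factor e with pe x e
      ... | true = sym (+-identityʳ _)
      ... | false = sum-zero nP

  -- For a plane e with many points of A, every point of A is charged with at most q² of the blocked lines outside e.
  module _ (e : Fin nE) (many : suc q ≤ #A-in e) where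

    charge : Fin nP → Fin nL → Bool
    charge x l = pl x l ∧ (if pe x e then not (le e l) else not (some (λ y → (A y ∧ pe y e) ∧ pl y l)))

    -- In both cases at least q + 1 of the q² + q + 1 lines on `x` are exempt: those in `e`, or
    -- those that join `x` to the points of `A` in `e`. The latter are distinct because a line not
    -- in `e` meets it once.
    #charge : ∀ x → # (charge x) ≤ q * q
    #charge x with decide (pe x e)
    ... | inj₁ xe rewrite xe = ≤-reflexive (+-cancelˡ-≡ (suc q) _ _ (trans (cong (_+ # (λ l → pl x l ∧ not (le e l))) (sym (#pencil xe)))
            (trans (sym (#-split (λ l → pl x l) (le e))) (trans (#lines-on x) (arith q)))))
      where
      arith : ∀ q → q * q + q + 1 ≡ suc q + q * q
      arith = solve-∀
    ... | inj₂ ne rewrite ne = +-cancelˡ-≤ (suc q) _ _ (≤-trans (+-monoˡ-≤ (# (λ l → pl x l ∧ not (R l))) many′)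
            (≤-reflexive (trans (sym (#-split (λ l → pl x l) R)) (trans (#lines-on x) (arith q)))))
      where
      arith : ∀ q → q * q + q + 1 ≡ suc q + q * q
      arith = solve-∀
      R : Fin nL → Bool
      R l = some (λ y → (A y ∧ pe y e) ∧ pl y l)
      outside : ∀ {l} → pl x l ≡ true → le e l ≡ false
      outside {l} xl with decide (le e l)
      ... | inj₁ el = ⊥-elim (true≢false (flag xl el) ne)
      ... | inj₂ n = n
      many′ : suc q ≤ # (λ l → pl x l ∧ R l)
      many′ = ≤-trans many (matching (λ y → A y ∧ pe y e) (λ l → pl x l ∧ R l) (λ y l → pl y l ∧ pl x l)
        (λ y h → let (m , xm , ym) = join x y in m , ∧-intro xm (some-intro _ y (∧-intro h ym)) , ∧-intro ym xm)
        (λ y z l hy hz _ ry rz → cut-unique (outside (proj₂ (∧-elim {pl y l} ry))) (proj₁ (∧-elim ry)) (proj₂ (∧-elim {A y} hy))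
                                             (proj₁ (∧-elim rz)) (proj₂ (∧-elim {A z} hz))))

    -- A blocked line outside `e` is charged to its point in `e` if that belongs to `A`, and
    -- otherwise to `x`.
    charged : ∀ {x l} → A x ≡ true → pl x l ≡ true → le e l ≡ false → ∃ λ y → A y ∧ charge y l ≡ true
    charged {x} {l} ax xl n with decide (pe x e)
    ... | inj₁ xe = x , ∧-intro ax (∧-intro xl (subst (λ b → (if b then not (le e l) else not (some (λ y → (A y ∧ pe y e) ∧ pl y l))) ≡ true) (sym xe) (not-true n)))
    ... | inj₂ x∉e with decide (some (λ y → (A y ∧ pe y e) ∧ pl y l))
    ... | inj₂ none = x , ∧-intro ax (∧-intro xl (subst (λ b → (if b then not (le e l) else not (some (λ y → (A y ∧ pe y e) ∧ pl y l))) ≡ true) (sym x∉e) (not-true none)))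
    ... | inj₁ s = let (y , h) = some-elim _ s ; (ay-e , yl) = ∧-elim {A y ∧ pe y e} h ; (ay , ye) = ∧-elim {A y} ay-e in
          y , ∧-intro ay (∧-intro yl (subst (λ b → (if b then not (le e l) else not (some (λ y → (A y ∧ pe y e) ∧ pl y l))) ≡ true) (sym ye) (not-true n)))

    total-charge : sum (λ l → # (λ x → A x ∧ charge x l)) ≤ # A * (q * q)
    total-charge = ≤-trans (≤-reflexive (∑-comm (λ l x → ι (A x ∧ charge x l))))
      (≤-trans (sum-mono each) (≤-reflexive (sym (*-distribʳ-sum (q * q) (ι ∘ A)))))
      where
      each : ∀ x → # (λ l → A x ∧ charge x l) ≤ ι (A x) * (q * q)
      each x with A x
      ... | true = ≤-trans (#charge x) (≤-reflexive (sym (+-identityʳ _)))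
      ... | false = ≤-reflexive (sum-zero nL)

module Uncovered {q : ℕ} (G : Geometry q) (A : Fin (Geometry.nP G) → Bool) (B : Fin (Geometry.nE G) → Bool) where
  open Geometry G
  open Incidence G
  open Blocking G A
  private
    module I* = Incidence (dual G)
    module B* = Blocking (dual G) B

  uncovered : Fin nL → Bool
  uncovered l = not (blocked l) ∧ not (B*.blocked l)

  U = # uncovered
  m = q * q + q + 1

  #uncovered-in : Fin nE → ℕ
  #uncovered-in e = # (λ l → le e l ∧ uncovered l)

  uncovered-total : sum #uncovered-in ≡ U * suc q
  uncovered-total = begin
    sum (λ e → # (λ l → le e l ∧ uncovered l))   ≡⟨ ∑-comm (λ e l → ι (le e l ∧ uncovered l)) ⟩
    sum (λ l → # (λ e → le e l ∧ uncovered l))   ≡⟨ sum-cong-≗ each ⟩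
    sum (λ l → ι (uncovered l) * suc q)      ≡⟨ *-distribʳ-sum (suc q) (ι ∘ uncovered) ⟨
    U * suc q      ∎
    where
    open ≡-Reasoning
    each : ∀ l → # (λ e → le e l ∧ uncovered l) ≡ ι (uncovered l) * suc q
    each l with uncovered l
    ... | true = trans (#-cong (λ e h → proj₁ (∧-elim h)) (λ e h → ∧-intro h refl)) (trans (#planes-on l) (sym (+-identityʳ _)))
    ... | false = #-none _ (λ e h → true≢false (proj₂ (∧-elim {le e l} h)) refl)

  -- A plane of `B` blocks just one line of `e`, its intersection with `e`. The 1 in the bound for
  -- lines blocked by points cancels against the 1 in q² + q + 1.
  plane-cover : ∀ e → B e ≡ false → q * q + q ≤ #uncovered-in e + q * #A-in e + # B
  plane-cover e e∉B = +-cancelʳ-≤ 1 _ _ (begin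
    q * q + q + 1      ≡⟨ I*.#lines-on e ⟨
    # (le e)      ≤⟨ sum-mono each ⟩
    sum (λ l → ι (le e l ∧ uncovered l) + ι (le e l ∧ blocked l) + ι (le e l ∧ B*.blocked l))
       ≡⟨ ∑-distrib-+ (λ l → ι (le e l ∧ uncovered l) + ι (le e l ∧ blocked l)) (λ l → ι (le e l ∧ B*.blocked l)) ⟩
    sum (λ l → ι (le e l ∧ uncovered l) + ι (le e l ∧ blocked l)) + # (λ l → le e l ∧ B*.blocked l)
       ≡⟨ cong (_+ # (λ l → le e l ∧ B*.blocked l)) (∑-distrib-+ (λ l → ι (le e l ∧ uncovered l)) (λ l → ι (le e l ∧ blocked l))) ⟩
    #uncovered-in e + # (λ l → le e l ∧ blocked l) + # (λ l → le e l ∧ B*.blocked l)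
       ≤⟨ +-mono-≤ (+-monoʳ-≤ (#uncovered-in e) (blocked-in-plane e)) traces ⟩
    #uncovered-in e + (q * #A-in e + 1) + # B      ≡⟨ arith (#uncovered-in e) (q * #A-in e) (# B) ⟩
    #uncovered-in e + q * #A-in e + # B + 1      ∎)
    where
    open ≤-Reasoning
    arith : ∀ u v w → u + (v + 1) + w ≡ u + v + w + 1
    arith = solve-∀
    each : ∀ l → ι (le e l) ≤ ι (le e l ∧ uncovered l) + ι (le e l ∧ blocked l) + ι (le e l ∧ B*.blocked l)
    each l with le e l
    ... | false = z≤n
    ... | true with blocked l | B*.blocked l
    ... | true  | _     = s≤s z≤n
    ... | false | true  = s≤s z≤n
    ... | false | false = s≤s z≤n
    traces : # (λ l → le e l ∧ B*.blocked l) ≤ # B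
    traces = matching _ B (λ l f → le f l)
      (λ l h → let (f , k) = some-elim _ (proj₂ (∧-elim {le e l} h)) ; (bf , fl) = ∧-elim {B f} k in f , bf , fl)
      (λ l l′ f h h′ bf fl fl′ → meet-unique (λ { refl → true≢false bf e∉B }) (proj₁ (∧-elim h)) fl (proj₁ (∧-elim h′)) fl′)

  -- The lines in `e` and the lines through `x` are given away. Every other blocked line is charged
  -- to an element of `A` or of `B`, and each of these bears at most q² lines.
  structured : ∀ {e x} → suc q ≤ #A-in e → suc q ≤ B*.#A-in x →
               (q * q + 1) * m ≤ U + m + m + (# A + # B) * (q * q)
  structured {e} {x} manyA manyB = begin
    (q * q + 1) * m      ≡⟨ #lines ⟨
    nL      ≡⟨ #-all nL ⟨
    # {nL} (λ _ → true)      ≤⟨ sum-mono each ⟩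
    sum (λ l → ι (uncovered l) + ι (le e l) + ι (pl x l) + (cA l + cB l))
       ≡⟨ ∑-distrib-+ (λ l → ι (uncovered l) + ι (le e l) + ι (pl x l)) (λ l → cA l + cB l) ⟩
    sum (λ l → ι (uncovered l) + ι (le e l) + ι (pl x l)) + sum (λ l → cA l + cB l)
       ≡⟨ cong₂ _+_ (trans (∑-distrib-+ (λ l → ι (uncovered l) + ι (le e l)) (λ l → ι (pl x l)))
                           (cong (_+ # (λ l → pl x l)) (∑-distrib-+ (λ l → ι (uncovered l)) (λ l → ι (le e l)))))
                    (∑-distrib-+ cA cB) ⟩
    U + # (le e) + # (λ l → pl x l) + (sum cA + sum cB)
       ≤⟨ +-mono-≤ (≤-reflexive (cong₂ (λ u v → U + u + v) (I*.#lines-on e) (#lines-on x)))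
                   (≤-trans (+-mono-≤ (total-charge e manyA) (B*.total-charge x manyB)) (≤-reflexive (sym (*-distribʳ-+ (q * q) (# A) (# B))))) ⟩
    U + m + m + (# A + # B) * (q * q) ∎
    where
    open ≤-Reasoning
    cA cB : Fin nL → ℕ
    cA l = # (λ y → A y ∧ charge e manyA y l)
    cB l = # (λ f → B f ∧ B*.charge x manyB f l)
    each : ∀ l → 1 ≤ ι (uncovered l) + ι (le e l) + ι (pl x l) + (cA l + cB l)
    each l with decide (le e l) | decide (pl x l)
    ... | inj₁ el | _ = ≤-trans (≤-reflexive (cong ι (sym el))) (≤-trans (m≤n+m (ι (le e l)) (ι (uncovered l))) (≤-trans (m≤m+n _ (ι (pl x l))) (m≤m+n _ (cA l + cB l))))
    ... | _ | inj₁ xl = ≤-trans (≤-reflexive (cong ι (sym xl))) (≤-trans (m≤n+m (ι (pl x l)) (ι (uncovered l) + ι (le e l))) (m≤m+n _ (cA l + cB l)))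
    ... | inj₂ ne | inj₂ nx with decide (blocked l) | decide (B*.blocked l)
    ... | inj₁ bA | _ = let (y , h) = some-elim _ bA ; (ay , yl) = ∧-elim {A y} h ; (z , c) = charged e manyA ay yl ne in
          ≤-trans (#-≥1 _ z c) (≤-trans (m≤m+n (cA l) (cB l)) (m≤n+m _ (ι (uncovered l) + ι (le e l) + ι (pl x l))))
    ... | _ | inj₁ bB = let (y , h) = some-elim _ bB ; (ay , yl) = ∧-elim {B y} h ; (z , c) = B*.charged x manyB ay yl nx in
          ≤-trans (#-≥1 _ z c) (≤-trans (m≤n+m (cB l) (cA l)) (m≤n+m _ (ι (uncovered l) + ι (le e l) + ι (pl x l))))
    ... | inj₂ nA | inj₂ nB rewrite nA | nB = s≤s z≤n

-- Arithmetic of the counting contradiction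

four-products : ∀ x y → 4 * (x * y) ≤ (x + y) * (x + y)
four-products x y = go (≤-total x y)
  where
  square : ∀ x d → 4 * (x * (x + d)) ≤ (x + (x + d)) * (x + (x + d))
  square x d = ≤-trans (m≤m+n _ (d * d)) (≤-reflexive (arith x d))
    where
    arith : ∀ x d → 4 * (x * (x + d)) + d * d ≡ (x + (x + d)) * (x + (x + d))
    arith = solve-∀
  go : x ≤ y ⊎ y ≤ x → 4 * (x * y) ≤ (x + y) * (x + y)
  go (inj₁ x≤y) = subst (λ z → 4 * (x * z) ≤ (x + z) * (x + z)) (m+[n∸m]≡n x≤y) (square x (y ∸ x))
  go (inj₂ y≤x) = subst₂ _≤_ (cong (4 *_) (*-comm y x)) (cong₂ _*_ (+-comm y x) (+-comm y x))
    (subst (λ z → 4 * (y * z) ≤ (y + z) * (y + z)) (m+[n∸m]≡n y≤x) (square y (x ∸ y)))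

-- Equivalent to 45(q + 1)² ≤ q³, for which 47 is the least solution. After the shift by 47 the
-- difference is a polynomial with nonnegative coefficients.
cubic : ∀ q → 47 ≤ q → 225 * (suc q * suc q) ≤ 5 * (q * q * q)
cubic q 47≤q = subst (λ q → 225 * (suc q * suc q) ≤ 5 * (q * q * q)) (m+[n∸m]≡n 47≤q) (shifted (q ∸ 47))
  where
  shifted : ∀ t → 225 * (suc (47 + t) * suc (47 + t)) ≤ 5 * ((47 + t) * (47 + t) * (47 + t))
  shifted t = ≤-trans (m≤m+n _ (715 + (11535 * t + (480 * (t * t) + 5 * (t * t * t))))) (≤-reflexive (arith t))
    where
    arith : ∀ t → 225 * (suc (47 + t) * suc (47 + t)) + (715 + (11535 * t + (480 * (t * t) + 5 * (t * t * t)))) ≡ 5 * ((47 + t) * (47 + t) * (47 + t))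
    arith = solve-∀

-- Here q = s + 1, and a points and b planes with a + b = q² + q − ρ leave U lines uncovered.
module Contradiction (s a b ρ U : ℕ)
  (47≤q : 47 ≤ suc s) (total : suc s * suc s + suc s ≡ a + b + ρ) (1≤ρ : 1 ≤ ρ)
  (small : U + 25 * suc (suc s) ≤ 25 * (ρ * suc (suc s))) where

  open ≤-Reasoning

  q = suc s
  m = q * q + q + 1
  -- By `small`, the product q(q + 1)`U` is at most (ρ - 1)`M`. The number `w` below is q² - q + 1,
  -- written without subtraction.
  M = 25 * (q * (suc q * suc q))
  w = s * q + 1
  W = b * w + ρ * (q * q + 1)

  9M≤5q⁴ : 9 * M ≤ 5 * (q * q * q * q)
  9M≤5q⁴ = begin
    9 * M      ≡⟨ arith₁ q ⟩
    q * (225 * (suc q * suc q))      ≤⟨ *-monoʳ-≤ q (cubic q 47≤q) ⟩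
    q * (5 * (q * q * q))      ≡⟨ arith₂ q ⟩
    5 * (q * q * q * q)      ∎
    where
    arith₁ : ∀ q → 9 * (25 * (q * (suc q * suc q))) ≡ q * (225 * (suc q * suc q))
    arith₁ = solve-∀
    arith₂ : ∀ q → q * (5 * (q * q * q)) ≡ 5 * (q * q * q * q)
    arith₂ = solve-∀

  -- The number of all lines is (q² + q)q² + 2m - (q + 1). So the ρ elements short of q² + q leave
  -- at least ρq² - (q + 1) lines uncovered, too many for `small` because 25(q + 1) < q².
  not-structured : (q * q + 1) * m ≤ U + m + m + (a + b) * (q * q) → ⊥
  not-structured h = <⇒≱ big (*-cancelˡ-≤ ρ {{>-nonZero 1≤ρ}} bound)
    where
    bound : ρ * (q * q) ≤ ρ * (25 * suc q)
    bound = +-cancelʳ-≤ ((a + b) * (q * q) + m + m) _ _ (begin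
      ρ * (q * q) + ((a + b) * (q * q) + m + m)      ≡⟨ arith₁ ρ (a + b) (q * q) m ⟩
      (a + b + ρ) * (q * q) + (m + m)      ≡⟨ cong (λ z → z * (q * q) + (m + m)) total ⟨
      (q * q + q) * (q * q) + (m + m)      ≡⟨ arith₂ s ⟩
      (q * q + 1) * m + suc q      ≤⟨ +-mono-≤ h (m≤m+n (suc q) (24 * suc q)) ⟩
      U + m + m + (a + b) * (q * q) + 25 * suc q      ≡⟨ arith₃ U m ((a + b) * (q * q)) (25 * suc q) ⟩
      U + 25 * suc q + ((a + b) * (q * q) + m + m)      ≤⟨ +-monoˡ-≤ _ small ⟩
      25 * (ρ * suc q) + ((a + b) * (q * q) + m + m)      ≡⟨ cong (_+ ((a + b) * (q * q) + m + m)) (arith₄ ρ (suc q)) ⟩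
      ρ * (25 * suc q) + ((a + b) * (q * q) + m + m)      ∎)
      where
      arith₁ : ∀ ρ c q² m → ρ * q² + (c * q² + m + m) ≡ (c + ρ) * q² + (m + m)
      arith₁ = solve-∀
      arith₂ : ∀ s → (suc s * suc s + suc s) * (suc s * suc s) + ((suc s * suc s + suc s + 1) + (suc s * suc s + suc s + 1))
               ≡ (suc s * suc s + 1) * (suc s * suc s + suc s + 1) + suc (suc s)
      arith₂ = solve-∀
      arith₃ : ∀ U m c d → U + m + m + c + d ≡ U + d + (c + m + m)
      arith₃ = solve-∀
      arith₄ : ∀ ρ q → 25 * (ρ * q) ≡ ρ * (25 * q)
      arith₄ = solve-∀
    big : 25 * suc q < q * q
    big = begin-strict
      25 * suc q      ≡⟨ *-suc 25 q ⟩
      25 + 25 * q      <⟨ +-monoˡ-< (25 * q) (≤-trans (m≤m+n 26 21) 47≤q) ⟩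
      q + 25 * q      ≤⟨ *-monoˡ-≤ q (≤-trans (m≤m+n 26 21) 47≤q) ⟩
      q * q      ∎

  module _ (n′ : ℕ) (n′+b : n′ + b ≡ q * m + 1)
    (first : (q * q + q) * (n′ + b) ≤ U * suc q + q * (a * m) + n′ * b + b * (q * q + q)) where

    -- Substituting a + b + ρ for q² + q in `first` leaves ρn′ against `U * suc q` and the single
    -- product `a * b`; and n′ is at least q³.
    ρq³≤ : ρ * (q * q * q) ≤ U * suc q + a * b
    ρq³≤ = ≤-trans (*-monoʳ-≤ ρ q³≤n′) (≤-trans (m≤m+n (ρ * n′) a) step)
      where
      q³≤n′ : q * q * q ≤ n′
      q³≤n′ = +-cancelʳ-≤ b _ _ (begin
        q * q * q + b      ≤⟨ +-monoʳ-≤ (q * q * q) (≤-trans (m≤n+m b a) (≤-trans (m≤m+n (a + b) ρ) (≤-reflexive (sym total)))) ⟩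
        q * q * q + (q * q + q)      ≤⟨ m≤m+n _ 1 ⟩
        q * q * q + (q * q + q) + 1  ≡⟨ arith s ⟩
        q * m + 1      ≡⟨ n′+b ⟨
        n′ + b      ∎)
        where
        arith : ∀ s → suc s * suc s * suc s + (suc s * suc s + suc s) + 1 ≡ suc s * (suc s * suc s + suc s + 1) + 1
        arith = solve-∀
      step : ρ * n′ + a ≤ U * suc q + a * b
      step = +-cancelʳ-≤ (a * (q * m) + (b * n′ + b * (a + b + ρ))) _ _ (begin
        ρ * n′ + a + (a * (q * m) + (b * n′ + b * (a + b + ρ)))      ≡⟨ arith₁ ρ n′ a b (q * m) ⟩
        ρ * n′ + a * (q * m + 1) + (b * n′ + b * (a + b + ρ))      ≡⟨ cong (λ z → ρ * n′ + a * z + (b * n′ + b * (a + b + ρ))) n′+b ⟨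
        ρ * n′ + a * (n′ + b) + (b * n′ + b * (a + b + ρ))      ≡⟨ arith₂ ρ n′ a b ⟩
        (a + b + ρ) * (n′ + b) + a * b      ≡⟨ cong (λ z → z * (n′ + b) + a * b) total ⟨
        (q * q + q) * (n′ + b) + a * b      ≤⟨ +-monoˡ-≤ (a * b) first ⟩
        U * suc q + q * (a * m) + n′ * b + b * (q * q + q) + a * b   ≡⟨ cong (λ z → U * suc q + q * (a * m) + n′ * b + b * z + a * b) total ⟩
        U * suc q + q * (a * m) + n′ * b + b * (a + b + ρ) + a * b   ≡⟨ arith₃ (U * suc q) q a m n′ b (a + b + ρ) ⟩
        U * suc q + a * b + (a * (q * m) + (b * n′ + b * (a + b + ρ))) ∎)
        where
        arith₁ : ∀ ρ n a b c → ρ * n + a + (a * c + (b * n + b * (a + b + ρ))) ≡ ρ * n + a * (c + 1) + (b * n + b * (a + b + ρ))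
        arith₁ = solve-∀
        arith₂ : ∀ ρ n a b → ρ * n + a * (n + b) + (b * n + b * (a + b + ρ)) ≡ (a + b + ρ) * (n + b) + a * b
        arith₂ = solve-∀
        arith₃ : ∀ u q a m n b t → u + q * (a * m) + n * b + b * t + a * b ≡ u + a * b + (a * (q * m) + (b * n + b * t))
        arith₃ = solve-∀

    -- By `small` and `cubic` the uncovered lines account for at most five ninths of ρq³, so four
    -- ninths fall to `a * b`.
    4ρq³≤9ab : 4 * (ρ * (q * q * q)) ≤ 9 * (a * b)
    4ρq³≤9ab = +-cancelˡ-≤ (5 * (ρ * (q * q * q))) _ _ (begin
      5 * (ρ * (q * q * q)) + 4 * (ρ * (q * q * q))      ≡⟨ arith₁ (ρ * (q * q * q)) ⟩
      9 * (ρ * (q * q * q))      ≤⟨ *-monoʳ-≤ 9 ρq³≤ ⟩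
      9 * (U * suc q + a * b)      ≡⟨ *-distribˡ-+ 9 (U * suc q) (a * b) ⟩
      9 * (U * suc q) + 9 * (a * b)      ≤⟨ +-monoˡ-≤ (9 * (a * b)) (*-monoʳ-≤ 9 (*-monoˡ-≤ (suc q) (≤-trans (m≤m+n U _) small))) ⟩
      9 * (25 * (ρ * suc q) * suc q) + 9 * (a * b)      ≡⟨ cong (_+ 9 * (a * b)) (arith₂ ρ (suc q)) ⟩
      ρ * (225 * (suc q * suc q)) + 9 * (a * b)      ≤⟨ +-monoˡ-≤ (9 * (a * b)) (*-monoʳ-≤ ρ (cubic q 47≤q)) ⟩
      ρ * (5 * (q * q * q)) + 9 * (a * b)      ≡⟨ cong (_+ 9 * (a * b)) (arith₃ ρ (q * q * q)) ⟩
      5 * (ρ * (q * q * q)) + 9 * (a * b)      ∎)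
      where
      arith₁ : ∀ x → 5 * x + 4 * x ≡ 9 * x
      arith₁ = solve-∀
      arith₂ : ∀ ρ q → 9 * (25 * (ρ * q) * q) ≡ ρ * (225 * (q * q))
      arith₂ = solve-∀
      arith₃ : ∀ ρ q → ρ * (5 * q) ≡ 5 * (ρ * q)
      arith₃ = solve-∀

    module _ (D₁ D₂ : ℕ) (eq₁ : D₁ + a * m ≡ q * (q * m + 1)) (ineq₂ : D₂ + (a * (q * q) + a * a * suc q) ≤ q * (a * m))
      (second : (a + ρ) * D₁ ≤ q * (U * suc q) + q * D₂ + b * (q * (a + ρ))) where

      -- Eliminates `D₁` and `D₂` from `second`. The identity needed holds only modulo `total`,
      -- which equates `Q` and `T`; adding their multiples by `P₁` and `P₂` crosswise makes it an
      -- identity of polynomials without subtraction.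
      quadratic : s * (a * a) + ρ * W ≤ s * (a * q) + q * (U * suc q)
      quadratic = +-cancelʳ-≤ Z _ _ (begin
        s * (a * a) + ρ * W + Z      ≡⟨⟩
        s * (a * a) + ρ * W + (R + (P₁ * T + P₂ * Q))      ≡⟨ cong (λ z → s * (a * a) + ρ * W + (R + (P₁ * T + P₂ * z))) total ⟩
        s * (a * a) + ρ * W + (R + (P₁ * T + P₂ * T))      ≡⟨ cong (λ z → s * (a * a) + ρ * W + (R + (P₁ * z + P₂ * T))) total ⟨
        s * (a * a) + ρ * W + (R + (P₁ * Q + P₂ * T))      ≡⟨ identity s a b ρ ⟩
        s * (a * q) + L + (P₁ * T + P₂ * Q)      ≤⟨ +-monoˡ-≤ (P₁ * T + P₂ * Q) (+-monoʳ-≤ (s * (a * q)) raw) ⟩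
        s * (a * q) + (q * (U * suc q) + R) + (P₁ * T + P₂ * Q) ≡⟨ arith (s * (a * q)) (q * (U * suc q)) R (P₁ * T + P₂ * Q) ⟩
        s * (a * q) + q * (U * suc q) + Z      ∎)
        where
        E = a + ρ
        T = a + b + ρ
        Q = q * q + q
        P₁ = E * (q * q + 1)
        P₂ = a * w
        L = E * (q * (q * m + 1)) + q * (a * (q * q) + a * a * suc q)
        R = q * (q * (a * m)) + b * (q * E) + E * (a * m)
        Z = R + (P₁ * T + P₂ * Q)
        arith : ∀ x y r z → x + (y + r) + z ≡ x + y + (r + z)
        arith = solve-∀
        identity : ∀ s a b ρ →
          let q = suc s
              m = q * q + q + 1
              w = s * q + 1
              W = b * w + ρ * (q * q + 1)
              E = a + ρ
              T = a + b + ρ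
              Q = q * q + q
              P₁ = E * (q * q + 1)
              P₂ = a * w
              L = E * (q * (q * m + 1)) + q * (a * (q * q) + a * a * suc q)
              R = q * (q * (a * m)) + b * (q * E) + E * (a * m)
          in
                   s * (a * a) + ρ * W + (R + (P₁ * Q + P₂ * T)) ≡ s * (a * q) + L + (P₁ * T + P₂ * Q)
        identity = solve-∀
        raw : L ≤ q * (U * suc q) + R
        raw = begin
          L      ≡⟨ cong (λ z → E * z + q * (a * (q * q) + a * a * suc q)) eq₁ ⟨
          E * (D₁ + a * m) + q * (a * (q * q) + a * a * suc q)    ≡⟨ arith₁ E D₁ (a * m) (q * (a * (q * q) + a * a * suc q)) ⟩
          E * D₁ + (E * (a * m) + q * (a * (q * q) + a * a * suc q)) ≤⟨ +-monoˡ-≤ _ second ⟩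
          q * (U * suc q) + q * D₂ + b * (q * E) + (E * (a * m) + q * (a * (q * q) + a * a * suc q))
              ≡⟨ arith₂ (q * (U * suc q)) q D₂ (b * (q * E)) (E * (a * m)) (a * (q * q) + a * a * suc q) ⟩
          q * (U * suc q) + (q * (D₂ + (a * (q * q) + a * a * suc q)) + b * (q * E) + E * (a * m))
              ≤⟨ +-monoʳ-≤ (q * (U * suc q)) (+-monoˡ-≤ (E * (a * m)) (+-monoˡ-≤ (b * (q * E)) (*-monoʳ-≤ q ineq₂))) ⟩
          q * (U * suc q) + R      ∎
          where
          arith₁ : ∀ e d x y → e * (d + x) + y ≡ e * d + (e * x + y)
          arith₁ = solve-∀
          arith₂ : ∀ u q d x y z → u + q * d + x + (y + q * z) ≡ u + (q * (d + z) + x + y)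
          arith₂ = solve-∀

      main : s * (a * a) + ρ * W + M ≤ s * (a * q) + ρ * M
      main = begin
        s * (a * a) + ρ * W + M      ≤⟨ +-monoˡ-≤ M quadratic ⟩
        s * (a * q) + q * (U * suc q) + M      ≡⟨ arith₁ (s * (a * q)) q (suc q) U ⟩
        s * (a * q) + q * suc q * (U + 25 * suc q)      ≤⟨ +-monoʳ-≤ (s * (a * q)) (*-monoʳ-≤ (q * suc q) small) ⟩
        s * (a * q) + q * suc q * (25 * (ρ * suc q))      ≡⟨ arith₂ (s * (a * q)) q (suc q) ρ ⟩
        s * (a * q) + ρ * M      ∎
        where
        arith₁ : ∀ x q k U → x + q * (U * k) + 25 * (q * (k * k)) ≡ x + q * k * (U + 25 * k)
        arith₁ = solve-∀
        arith₂ : ∀ x q k ρ → x + q * k * (25 * (ρ * k)) ≡ x + ρ * (25 * (q * (k * k)))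
        arith₂ = solve-∀

      sqq≤M : s * (q * q) ≤ M
      sqq≤M = begin
        s * (q * q)      ≤⟨ m≤m+n _ _ ⟩
        s * (q * q) + (24 * (s * (q * q)) + (75 * (q * q) + 25 * q))  ≡⟨ arith s ⟩
        M      ∎
        where
        arith : ∀ s → s * (suc s * suc s) + (24 * (s * (suc s * suc s)) + (75 * (suc s * suc s) + 25 * suc s)) ≡ 25 * (suc s * (suc (suc s) * suc (suc s)))
        arith = solve-∀

      reduced : M < W → s * (a * a) + ρ + M ≤ s * (a * q)
      reduced M<W = +-cancelʳ-≤ (ρ * M) _ _ (≤-trans (≤-reflexive (arith (s * (a * a)) ρ M))
        (≤-trans (+-monoˡ-≤ M (+-monoʳ-≤ (s * (a * a)) (*-monoʳ-≤ ρ M<W))) main))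
        where
        arith : ∀ x ρ M → x + ρ + M + ρ * M ≡ x + ρ * suc M + M
        arith = solve-∀

      -- Otherwise sa² would lie below saq by more than `M`. For a ≤ q the number saq is itself at
      -- most `M`, and for a > q it is at most sa².
      W≤M : W ≤ M
      W≤M with W ≤? M
      ... | yes h = h
      ... | no ¬h with a ≤? q
      ...   | yes a≤q = ⊥-elim (<⇒≱ (≤-trans 1≤ρ (m≤n+m ρ (s * (a * a)))) (+-cancelʳ-≤ M (s * (a * a) + ρ) 0
                (≤-trans (reduced (≰⇒> ¬h)) (≤-trans (*-monoʳ-≤ s (*-monoˡ-≤ q a≤q)) sqq≤M))))
      ...   | no a≰q = ⊥-elim (<⇒≱ (≤-trans 1≤ρ (m≤m+n ρ M)) (+-cancelˡ-≤ (s * (a * a)) (ρ + M) 0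
                (≤-trans (≤-reflexive (sym (+-assoc (s * (a * a)) ρ M))) (≤-trans (reduced (≰⇒> ¬h))
                (≤-trans (*-monoʳ-≤ s (*-monoʳ-≤ a (<⇒≤ (≰⇒> a≰q)))) (≤-reflexive (sym (+-identityʳ _))))))))

      z = M ∸ W

      W+z : W + z ≡ M
      W+z = m+[n∸m]≡n W≤M

      saa≤ : s * (a * a) ≤ s * (a * q) + ρ * z
      saa≤ = +-cancelʳ-≤ (ρ * W) _ _ (begin
        s * (a * a) + ρ * W      ≤⟨ m≤m+n _ M ⟩
        s * (a * a) + ρ * W + M      ≤⟨ main ⟩
        s * (a * q) + ρ * M      ≡⟨ cong (λ y → s * (a * q) + ρ * y) W+z ⟨
        s * (a * q) + ρ * (W + z)      ≡⟨ arith (s * (a * q)) ρ W z ⟩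
        s * (a * q) + ρ * z + ρ * W      ∎)
        where
        arith : ∀ x ρ W z → x + ρ * (W + z) ≡ x + ρ * z + ρ * W
        arith = solve-∀

      1≤a : 1 ≤ a
      1≤a with 1 ≤? a
      ... | yes h = h
      ... | no ¬h = ⊥-elim (<⇒≱ (*-mono-≤ (s≤s (z≤n {3})) (*-mono-≤ 1≤ρ (s≤s (z≤n {0}))))
              (≤-trans (*-monoʳ-≤ 4 (*-monoʳ-≤ ρ (s≤s z≤n))) (≤-trans 4ρq³≤9ab (≤-reflexive (cong (λ a → 9 * (a * b)) (n<1⇒n≡0 (≰⇒> ¬h)))))))

      -- Multiplication by 4q³ turns ρ into a multiple of `a * b` by `4ρq³≤9ab`; then `a` can be
      -- cancelled and ρ is gone.
      divided : 4 * (q * q * q) * (s * a) ≤ 4 * (q * q * q) * (s * q) + 9 * (b * z)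
      divided = *-cancelˡ-≤ a {{>-nonZero 1≤a}} (begin
        a * (4 * (q * q * q) * (s * a))      ≡⟨ arith₁ a (q * q * q) s ⟩
        4 * (q * q * q) * (s * (a * a))      ≤⟨ *-monoʳ-≤ (4 * (q * q * q)) saa≤ ⟩
        4 * (q * q * q) * (s * (a * q) + ρ * z)      ≡⟨ arith₂ (q * q * q) s a q ρ z ⟩
        4 * (q * q * q) * (s * (a * q)) + 4 * (ρ * (q * q * q)) * z  ≤⟨ +-monoʳ-≤ (4 * (q * q * q) * (s * (a * q))) (*-monoˡ-≤ z 4ρq³≤9ab) ⟩
        4 * (q * q * q) * (s * (a * q)) + 9 * (a * b) * z    ≡⟨ arith₃ (q * q * q) s a q b z ⟩
        a * (4 * (q * q * q) * (s * q) + 9 * (b * z))      ∎)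
        where
        arith₁ : ∀ a c s → a * (4 * c * (s * a)) ≡ 4 * c * (s * (a * a))
        arith₁ = solve-∀
        arith₂ : ∀ c s a q ρ z → 4 * c * (s * (a * q) + ρ * z) ≡ 4 * c * (s * (a * q)) + 4 * (ρ * c) * z
        arith₂ = solve-∀
        arith₃ : ∀ c s a q b z → 4 * c * (s * (a * q)) + 9 * (a * b) * z ≡ a * (4 * c * (s * q) + 9 * (b * z))
        arith₃ = solve-∀

      4bwz≤M² : 4 * (b * w * z) ≤ M * M
      4bwz≤M² = ≤-trans (four-products (b * w) z) (*-mono-≤ le le)
        where
        le : b * w + z ≤ M
        le = ≤-trans (+-monoˡ-≤ z (m≤m+n (b * w) (ρ * (q * q + 1)))) (≤-reflexive W+z)

      w≤q² : w ≤ q * q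
      w≤q² = begin
        s * q + 1      ≤⟨ +-monoʳ-≤ (s * q) (s≤s (z≤n {s})) ⟩
        s * q + q      ≡⟨ +-comm (s * q) q ⟩
        q * q      ∎

      -- Since (q² + q)w = q⁴ + q, the bound `W≤M` forces aw to be at least q⁴ - `M`, and 9`M` is at
      -- most 5q⁴.
      4q⁴≤9aw : 4 * (q * q * q * q) ≤ 9 * (a * w)
      4q⁴≤9aw = +-cancelʳ-≤ (5 * (q * q * q * q)) _ _ (begin
        4 * (q * q * q * q) + 5 * (q * q * q * q)  ≡⟨ arith₁ (q * q * q * q) ⟩
        9 * (q * q * q * q)      ≤⟨ *-monoʳ-≤ 9 below ⟩
        9 * (a * w + M)      ≡⟨ *-distribˡ-+ 9 (a * w) M ⟩
        9 * (a * w) + 9 * M      ≤⟨ +-monoʳ-≤ (9 * (a * w)) 9M≤5q⁴ ⟩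
        9 * (a * w) + 5 * (q * q * q * q)      ∎)
        where
        arith₁ : ∀ x → 4 * x + 5 * x ≡ 9 * x
        arith₁ = solve-∀
        arith₂ : ∀ s → suc s * suc s * suc s * suc s + suc s ≡ (suc s * suc s + suc s) * (s * suc s + 1)
        arith₂ = solve-∀
        arith₃ : ∀ a b ρ w → (a + b + ρ) * w ≡ a * w + (b * w + ρ * w)
        arith₃ = solve-∀
        below : q * q * q * q ≤ a * w + M
        below = begin
          q * q * q * q      ≤⟨ m≤m+n _ q ⟩
          q * q * q * q + q      ≡⟨ arith₂ s ⟩
          (q * q + q) * w      ≡⟨ cong (_* w) total ⟩
          (a + b + ρ) * w      ≡⟨ arith₃ a b ρ w ⟩
          a * w + (b * w + ρ * w)      ≤⟨ +-monoʳ-≤ (a * w) (+-monoʳ-≤ (b * w) (*-monoʳ-≤ ρ (≤-trans w≤q² (m≤m+n (q * q) 1)))) ⟩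
          a * w + W      ≤⟨ +-monoʳ-≤ (a * w) W≤M ⟩
          a * w + M      ∎

      -- By `4q⁴≤9aw` the number `a` has order q², while in `divided` its excess over q is governed
      -- by `b * z`. The inequality of arithmetic and geometric means bounds this, as bw + z ≤ `M`.
      -- After cancelling q⁶ the claim reads 64qs ≤ 144s + 25q².
      contradiction : ⊥
      contradiction = <⇒≱ big (*-cancelˡ-≤ (q * q * q * q * q * q) (begin
        q * q * q * q * q * q * (64 * (q * s))      ≡⟨ arith₁ s ⟩
        16 * (q * q * q) * s * (4 * (q * q * q * q))      ≤⟨ *-monoʳ-≤ (16 * (q * q * q) * s) 4q⁴≤9aw ⟩
        16 * (q * q * q) * s * (9 * (a * w))      ≡⟨ arith₂ (q * q * q) s a w ⟩
        36 * w * (4 * (q * q * q) * (s * a))      ≤⟨ *-monoʳ-≤ (36 * w) divided ⟩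
        36 * w * (4 * (q * q * q) * (s * q) + 9 * (b * z))      ≡⟨ arith₃ w (q * q * q) s q b z ⟩
        144 * (q * q * q) * (s * q) * w + 81 * (4 * (b * w * z))      ≤⟨ +-mono-≤ (*-monoʳ-≤ (144 * (q * q * q) * (s * q)) w≤q²) (*-monoʳ-≤ 81 4bwz≤M²) ⟩
        144 * (q * q * q) * (s * q) * (q * q) + 81 * (M * M)      ≡⟨ cong (144 * (q * q * q) * (s * q) * (q * q) +_) (arith₄ M) ⟩
        144 * (q * q * q) * (s * q) * (q * q) + 9 * M * (9 * M)      ≤⟨ +-monoʳ-≤ (144 * (q * q * q) * (s * q) * (q * q)) (*-mono-≤ 9M≤5q⁴ 9M≤5q⁴) ⟩
        144 * (q * q * q) * (s * q) * (q * q) + 5 * (q * q * q * q) * (5 * (q * q * q * q)) ≡⟨ arith₅ s ⟩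
        q * q * q * q * q * q * (144 * s + 25 * (q * q))      ∎))
        where
        arith₁ : ∀ s → let q = suc s in q * q * q * q * q * q * (64 * (q * s)) ≡ 16 * (q * q * q) * s * (4 * (q * q * q * q))
        arith₁ = solve-∀
        arith₂ : ∀ c s a w → 16 * c * s * (9 * (a * w)) ≡ 36 * w * (4 * c * (s * a))
        arith₂ = solve-∀
        arith₃ : ∀ w c s q b z → 36 * w * (4 * c * (s * q) + 9 * (b * z)) ≡ 144 * c * (s * q) * w + 81 * (4 * (b * w * z))
        arith₃ = solve-∀
        arith₄ : ∀ M → 81 * (M * M) ≡ 9 * M * (9 * M)
        arith₄ = solve-∀
        arith₅ : ∀ s → let q = suc s in 144 * (q * q * q) * (s * q) * (q * q) + 5 * (q * q * q * q) * (5 * (q * q * q * q)) ≡ q * q * q * q * q * q * (144 * s + 25 * (q * q))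
        arith₅ = solve-∀
        25≤s : 25 ≤ s
        25≤s = ≤-pred (≤-trans (m≤m+n 26 21) 47≤q)
        big : 144 * s + 25 * (q * q) < 64 * (q * s)
        big = begin-strict
          144 * s + 25 * (q * q)      ≡⟨ arith₆ s ⟩
          -- Here 144 ≤ 188 = 4 · 47 ≤ 4q and 25 ≤ `s`, so every term is bounded by a multiple of
          -- `q * s`.
          144 * s + (25 * q + 25 * (q * s))      ≤⟨ +-mono-≤ (≤-trans (*-monoˡ-≤ s (m≤m+n 144 44)) (≤-trans (≤-reflexive (arith₇ s)) (*-monoʳ-≤ 4 (*-monoˡ-≤ s 47≤q))))
                                                                 (+-monoˡ-≤ (25 * (q * s)) (≤-trans (*-monoˡ-≤ q 25≤s) (≤-reflexive (*-comm s q)))) ⟩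
          4 * (q * s) + (q * s + 25 * (q * s))      ≡⟨ arith₈ (q * s) ⟩
          30 * (q * s)      <⟨ *-monoˡ-< (q * s) {{>-nonZero (*-mono-≤ (s≤s (z≤n {s})) (≤-trans (s≤s (z≤n {24})) 25≤s))}} (m≤m+n 31 33) ⟩
          64 * (q * s)      ∎
          where
          arith₆ : ∀ s → 144 * s + 25 * (suc s * suc s) ≡ 144 * s + (25 * suc s + 25 * (suc s * s))
          arith₆ = solve-∀
          arith₇ : ∀ s → 188 * s ≡ 4 * (47 * s)
          arith₇ = solve-∀
          arith₈ : ∀ x → 4 * x + (x + 25 * x) ≡ 30 * x
          arith₈ = solve-∀

-- Covers with at most q points in every plane

module FewPointsInPlanes {s : ℕ} (G : Geometry (suc s)) (A : Fin (Geometry.nP G) → Bool) (B : Fin (Geometry.nE G) → Bool) where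
  open Geometry G
  open Incidence G
  open Blocking G A
  open Uncovered G A B
  private q = suc s

  -- `first` sums `plane-cover` over the planes, with a trivial contribution for those of `B`.
  -- `second` sums it with the weight `d`, whose truncated subtraction is exact by `few`; the sum of
  -- `d e * #A-in e` is q times the first moment minus the second.
  no-small-planes : ∀ {ρ} → 47 ≤ q → q * q + q ≡ # A + # B + ρ → 1 ≤ ρ → U + 25 * suc q ≤ 25 * (ρ * suc q) →
                    (∀ e → #A-in e ≤ q) → ⊥
  no-small-planes {ρ} 47≤q total 1≤ρ small few = contradiction n′ #planes first D₁ D₂ eq₁ ineq₂ second
    where
    open ≤-Reasoning
    open Contradiction s (# A) (# B) ρ U 47≤q total 1≤ρ small using (contradiction)
    a = # A
    b = # B
    E = a + ρ
    n′ = # (λ e → not (B e))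
    d : Fin nE → ℕ
    d e = q ∸ #A-in e
    d+ : ∀ e → d e + #A-in e ≡ q
    d+ e = m∸n+n≡m (few e)
    D₁ = sum d
    D₂ = sum (λ e → d e * #A-in e)
    nE≡ : nE ≡ q * m + 1
    nE≡ = trans (Incidence.#points (dual G)) (arith q)
      where
      arith : ∀ q → q * q * q + q * q + q + 1 ≡ q * (q * q + q + 1) + 1
      arith = solve-∀
    #planes : n′ + b ≡ q * m + 1
    #planes = trans (+-comm n′ b) (trans (sym (#-split (λ _ → true) B)) (trans (#-all nE) nE≡))
    first : (q * q + q) * (n′ + b) ≤ U * suc q + q * (a * m) + n′ * b + b * (q * q + q)
    first = begin
      (q * q + q) * (n′ + b)      ≡⟨ cong ((q * q + q) *_) (trans #planes (sym nE≡)) ⟩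
      (q * q + q) * nE      ≡⟨ *-comm (q * q + q) nE ⟩
      nE * (q * q + q)      ≡⟨ sum-const nE (q * q + q) ⟨
      sum {nE} (λ _ → q * q + q)      ≤⟨ sum-mono each ⟩
      sum (λ e → #uncovered-in e + #A-in e * q + ι (not (B e)) * b + ι (B e) * (q * q + q))
        ≡⟨ ∑-distrib-+ (λ e → #uncovered-in e + #A-in e * q + ι (not (B e)) * b) (λ e → ι (B e) * (q * q + q)) ⟩
      sum (λ e → #uncovered-in e + #A-in e * q + ι (not (B e)) * b) + sum (λ e → ι (B e) * (q * q + q))
        ≡⟨ cong₂ _+_ (trans (∑-distrib-+ (λ e → #uncovered-in e + #A-in e * q) (λ e → ι (not (B e)) * b))
                            (cong₂ _+_ (∑-distrib-+ #uncovered-in (λ e → #A-in e * q)) (sym (*-distribʳ-sum b (ι ∘ not ∘ B)))))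
                     (sym (*-distribʳ-sum (q * q + q) (ι ∘ B))) ⟩
      sum #uncovered-in + sum (λ e → #A-in e * q) + n′ * b + b * (q * q + q)
        ≡⟨ cong₂ (λ u v → u + v + n′ * b + b * (q * q + q)) uncovered-total
              (trans (sym (*-distribʳ-sum q #A-in)) (trans (cong (_* q) #A-in-total) (*-comm (a * m) q))) ⟩
      U * suc q + q * (a * m) + n′ * b + b * (q * q + q) ∎
      where
      each : ∀ e → q * q + q ≤ #uncovered-in e + #A-in e * q + ι (not (B e)) * b + ι (B e) * (q * q + q)
      each e with decide (B e)
      ... | inj₁ Be rewrite Be = ≤-trans (≤-reflexive (sym (+-identityʳ (q * q + q)))) (m≤n+m _ _)
      ... | inj₂ ¬Be rewrite ¬Be = ≤-trans (plane-cover e ¬Be) (≤-reflexive (arith (#uncovered-in e) q (#A-in e) b))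
        where
        arith : ∀ u q a b → u + q * a + b ≡ u + a * q + (b + 0) + 0
        arith = solve-∀
    eq₁ : D₁ + a * m ≡ q * (q * m + 1)
    eq₁ = begin-equality
      D₁ + a * m      ≡⟨ cong (D₁ +_) #A-in-total ⟨
      D₁ + sum #A-in      ≡⟨ ∑-distrib-+ d #A-in ⟨
      sum (λ e → d e + #A-in e)      ≡⟨ sum-cong-≗ d+ ⟩
      sum {nE} (λ _ → q)      ≡⟨ sum-const nE q ⟩
      nE * q      ≡⟨ *-comm nE q ⟩
      q * nE      ≡⟨ cong (q *_) nE≡ ⟩
      q * (q * m + 1)      ∎
    ineq₂ : D₂ + (a * (q * q) + a * a * suc q) ≤ q * (a * m)
    ineq₂ = begin
      D₂ + (a * (q * q) + a * a * suc q)      ≤⟨ +-monoʳ-≤ D₂ #A-in-square ⟩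
      D₂ + sum (λ e → #A-in e * #A-in e)      ≡⟨ ∑-distrib-+ (λ e → d e * #A-in e) (λ e → #A-in e * #A-in e) ⟨
      sum (λ e → d e * #A-in e + #A-in e * #A-in e)   ≡⟨ sum-cong-≗ (λ e → trans (sym (*-distribʳ-+ (#A-in e) (d e) (#A-in e)))
                                                            (trans (cong (_* #A-in e) (d+ e)) (*-comm q (#A-in e)))) ⟩
      sum (λ e → #A-in e * q)      ≡⟨ *-distribʳ-sum q #A-in ⟨
      sum #A-in * q      ≡⟨ cong (_* q) #A-in-total ⟩
      a * m * q      ≡⟨ *-comm (a * m) q ⟩
      q * (a * m)      ∎
    second : E * D₁ ≤ q * (U * suc q) + q * D₂ + b * (q * E)
    second = begin
      E * D₁      ≡⟨ trans (*-comm E D₁) (*-distribʳ-sum E d) ⟩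
      sum (λ e → d e * E)      ≤⟨ sum-mono each ⟩
      sum (λ e → #uncovered-in e * q + d e * #A-in e * q + ι (B e) * (q * E))
        ≡⟨ trans (∑-distrib-+ (λ e → #uncovered-in e * q + d e * #A-in e * q) (λ e → ι (B e) * (q * E)))
                 (cong₂ _+_ (∑-distrib-+ (λ e → #uncovered-in e * q) (λ e → d e * #A-in e * q)) (sym (*-distribʳ-sum (q * E) (ι ∘ B)))) ⟩
      sum (λ e → #uncovered-in e * q) + sum (λ e → d e * #A-in e * q) + b * (q * E)
        ≡⟨ cong₂ (λ u v → u + v + b * (q * E))
             (trans (sym (*-distribʳ-sum q #uncovered-in)) (trans (cong (_* q) uncovered-total) (*-comm (U * suc q) q)))
             (trans (sym (*-distribʳ-sum q (λ e → d e * #A-in e))) (*-comm D₂ q)) ⟩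
      q * (U * suc q) + q * D₂ + b * (q * E)      ∎
      where
      d≤q : ∀ e → d e ≤ q
      d≤q e = m∸n≤m q (#A-in e)
      each : ∀ e → d e * E ≤ #uncovered-in e * q + d e * #A-in e * q + ι (B e) * (q * E)
      each e with decide (B e)
      ... | inj₁ Be rewrite Be = ≤-trans (*-monoˡ-≤ E (d≤q e)) (≤-trans (≤-reflexive (sym (+-identityʳ (q * E)))) (m≤n+m (q * E + 0) (#uncovered-in e * q + d e * #A-in e * q)))
      ... | inj₂ ¬Be rewrite ¬Be = begin
        d e * E      ≤⟨ *-monoʳ-≤ (d e) E≤ ⟩
        d e * (#uncovered-in e + q * #A-in e)      ≡⟨ arith₁ (d e) (#uncovered-in e) q (#A-in e) ⟩
        #uncovered-in e * d e + d e * #A-in e * q + 0      ≤⟨ +-monoˡ-≤ 0 (+-monoˡ-≤ (d e * #A-in e * q) (*-monoʳ-≤ (#uncovered-in e) (d≤q e))) ⟩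
        #uncovered-in e * q + d e * #A-in e * q + 0      ∎
        where
        arith₁ : ∀ d u q a → d * (u + q * a) ≡ u * d + d * a * q + 0
        arith₁ = solve-∀
        arith₂ : ∀ a b ρ → a + ρ + b ≡ a + b + ρ
        arith₂ = solve-∀
        E≤ : E ≤ #uncovered-in e + q * #A-in e
        E≤ = +-cancelʳ-≤ b _ _ (≤-trans (≤-reflexive (trans (arith₂ a b ρ) (sym total))) (plane-cover e ¬Be))

module _ {s : ℕ} (G : Geometry (suc s)) (A : Fin (Geometry.nP G) → Bool) (B : Fin (Geometry.nE G) → Bool) where
  open Uncovered G A B
  private q = suc s

  few-elements-do-not-cover : ∀ {ρ} → 47 ≤ q → q * q + q ≡ # A + # B + ρ → 1 ≤ ρ → U + 25 * suc q ≤ 25 * (ρ * suc q) → ⊥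
  few-elements-do-not-cover {ρ} 47≤q total 1≤ρ small
    with Fin.any? (λ e → suc q ≤? Blocking.#A-in G A e) | Fin.any? (λ x → suc q ≤? Blocking.#A-in (dual G) B x)
  ... | yes (e , manyA) | yes (x , manyB) =
        Contradiction.not-structured s (# A) (# B) ρ U 47≤q total 1≤ρ small (structured {e} {x} manyA manyB)
  ... | no few | _ = FewPointsInPlanes.no-small-planes G A B {ρ} 47≤q total 1≤ρ small (λ e → ≤-pred (≰⇒> (λ h → few (e , h))))
  ... | _ | no few = FewPointsInPlanes.no-small-planes (dual G) B A {ρ} 47≤q (trans total (cong (_+ ρ) (+-comm (# A) (# B)))) 1≤ρ
        (≤-trans (+-monoˡ-≤ (25 * suc q) (#-mono swap)) small) (λ x → ≤-pred (≰⇒> (λ h → few (x , h))))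
    where
    swap : ∀ l → Uncovered.uncovered (dual G) B A l ≡ true → uncovered l ≡ true
    swap l h = let (u , v) = ∧-elim {not (Blocking.blocked (dual G) B l)} h in ∧-intro v u

-- The number ρ is the true deficit and exceeds `r`. So `U` is at most 25(ρ - 1)(q + 1), which is
-- passed on with the subtrahend moved to the other side.
no-cover : ∀ {q} (G : Geometry q) (A : Fin (Geometry.nP G) → Bool) (B : Fin (Geometry.nE G) → Bool) r → 47 ≤ q →
           # A + # B + suc r ≤ q * q + q → Uncovered.U G A B ≤ 25 * (r * suc q) → ⊥
no-cover {suc s} G A B r 47≤q bound small = few-elements-do-not-cover G A B {ρ} 47≤q total (≤-trans (s≤s z≤n) r<ρ)
    (≤-trans (+-monoˡ-≤ (25 * suc q) small) (≤-trans (≤-reflexive (arith r (suc q))) (*-monoʳ-≤ 25 (*-monoˡ-≤ (suc q) r<ρ))))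
  where
  q = suc s
  ρ = q * q + q ∸ (# A + # B)
  total : q * q + q ≡ # A + # B + ρ
  total = sym (m+[n∸m]≡n (≤-trans (m≤m+n (# A + # B) (suc r)) bound))
  r<ρ : suc r ≤ ρ
  r<ρ = +-cancelˡ-≤ (# A + # B) _ _ (≤-trans bound (≤-reflexive total))
  arith : ∀ r k → 25 * (r * k) + 25 * k ≡ 25 * (suc r * k)
  arith = solve-∀

-- Colourings and colour classes

opaque
  unfolding sum

  ranking : ∀ {n} (p : Fin n → Bool) → ∃ λ (rank : ∀ i → p i ≡ true → Fin (# p)) →
            ∀ i j pi pj → rank i pi ≡ rank j pj → i ≡ j
  ranking {zero} p = (λ ()) , λ ()
  ranking {suc n} p with p zero in eq | ranking (p ∘ suc)
  ... | true | f , inj = g , g-inj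
    where
    g : ∀ i → p i ≡ true → Fin (suc (# (p ∘ suc)))
    g zero    _ = zero
    g (suc i) h = suc (f i h)
    g-inj : ∀ i j pi pj → g i pi ≡ g j pj → i ≡ j
    g-inj zero    zero    _  _  _ = refl
    g-inj (suc i) (suc j) pi pj h = cong suc (inj i j pi pj (Fin.suc-injective h))
  ... | false | f , inj = g , g-inj
    where
    g : ∀ i → p i ≡ true → Fin (# (p ∘ suc))
    g zero    h = ⊥-elim (true≢false h eq)
    g (suc i) h = f i h
    g-inj : ∀ i j pi pj → g i pi ≡ g j pj → i ≡ j
    g-inj zero    _      pi _  _ = ⊥-elim (true≢false pi eq)
    g-inj (suc i) zero    _  pj _ = ⊥-elim (true≢false pj eq)
    g-inj (suc i) (suc j) pi pj h = cong suc (inj i j pi pj h)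

rank : ∀ {n} (p : Fin n → Bool) i → p i ≡ true → Fin (# p)
rank p = proj₁ (ranking p)

rank-injective : ∀ {n} (p : Fin n → Bool) i j (pi : p i ≡ true) (pj : p j ≡ true) → rank p i pi ≡ rank p j pj → i ≡ j
rank-injective p = proj₂ (ranking p)

module LineColouring {q : ℕ} (G : Geometry q) where
  open Geometry G
  open Incidence G
  private module I* = Incidence (dual G)

  line-colouring : ∃ λ (col : Fin nL → Fin (q * q + q)) → ∀ l m → col l ≡ col m → Meet l m
  line-colouring = (λ l → Fin.cast size (code (pick l))) , λ l m eq → sound l m (pick l) (pick m)
                     (cast-injective size eq)
    where
    cast-injective : ∀ {m n} (eq : m ≡ n) {i j : Fin m} → Fin.cast eq i ≡ Fin.cast eq j → i ≡ j
    cast-injective refl {i} {j} h = trans (sym (Fin.cast-is-id refl i)) (trans h (Fin.cast-is-id refl j))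
    e₀ = a-plane
    l₀ = proj₁ (line-in-plane e₀)
    e₀l₀ = proj₂ (line-in-plane e₀)
    D₁ : Fin nP → Bool
    D₁ x = pe x e₀ ∧ not (pl x l₀)
    D₂ : Fin nE → Bool
    D₂ f = le f l₀ ∧ not (f == e₀)
    #D₁ : # D₁ ≡ q * q
    #D₁ = +-cancelˡ-≡ (suc q) _ _ (trans (cong (_+ # D₁) (trans (sym (#points-on l₀)) (#-cong (λ x h → ∧-intro (flag h e₀l₀) h) (λ x h → proj₂ (∧-elim {pe x e₀} h)))))
            (trans (sym (#-split (λ x → pe x e₀) (λ x → pl x l₀))) (trans (#points-in e₀) (arith q))))
      where
      arith : ∀ q → q * q + q + 1 ≡ suc q + q * q
      arith = solve-∀
    #D₂ : # D₂ ≡ q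
    #D₂ = suc-injective (trans (sym (#-remove (λ f → le f l₀) e₀ e₀l₀)) (#planes-on l₀))
    size : # D₁ + # D₂ ≡ q * q + q
    size = cong₂ _+_ #D₁ #D₂
    Choice : Fin nL → Set
    Choice l = (∃ λ x → D₁ x ≡ true × pl x l ≡ true) ⊎ (∃ λ f → D₂ f ≡ true × le f l ≡ true)
    other-plane-choice : ∀ {l f} → le f l₀ ≡ true → le f l ≡ true → f ≢ e₀ → Choice l
    other-plane-choice {l} {f} a b ne = inj₂ (f , ∧-intro a (≠-intro ne) , b)
    -- A line of `e₀` may have been cut in a point of `l₀`, so a second point of the line is tried.
    -- If that is on `l₀` as well, the line is `l₀` itself and receives any plane on it other than
    -- `e₀`.
    inside : ∀ l x → le e₀ l ≡ true → pl x l ≡ true → pl x l₀ ≡ true → Choice l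
    inside l x e₀l xl xl₀ with #-other (λ y → pl y l) (≤-trans (s≤s 1≤q) (≤-reflexive (sym (#points-on l)))) x
    ... | y , y≢x , yl with decide (pl y l₀)
    ... | inj₂ n = inj₁ (y , ∧-intro (flag yl e₀l) (not-true n) , yl)
    ... | inj₁ yl₀ = let (f , f≢e₀ , fl₀) = other-plane l₀ e₀ in
          other-plane-choice fl₀ (subst (λ z → le f z ≡ true) (join-unique y≢x yl₀ xl₀ yl xl) fl₀) f≢e₀
    pick : ∀ l → Choice l
    pick l with cut e₀ l
    ... | x , xl , xe₀ with decide (pl x l₀)
    ... | inj₂ n = inj₁ (x , ∧-intro xe₀ (not-true n) , xl)
    ... | inj₁ xl₀ with I*.coplanar⇒Meet xl xl₀
    ... | f , fl , fl₀ with f Fin.≟ e₀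
    ... | no ne = other-plane-choice fl₀ fl ne
    ... | yes refl = inside l x fl xl xl₀
    code : ∀ {l} → Choice l → Fin (# D₁ + # D₂)
    code (inj₁ (x , d , _)) = Fin.join (# D₁) (# D₂) (inj₁ (rank D₁ x d))
    code (inj₂ (f , d , _)) = Fin.join (# D₁) (# D₂) (inj₂ (rank D₂ f d))
    join-injective : ∀ {i j : Fin (# D₁) ⊎ Fin (# D₂)} → Fin.join (# D₁) (# D₂) i ≡ Fin.join (# D₁) (# D₂) j → i ≡ j
    join-injective {i} {j} h = trans (sym (Fin.splitAt-join (# D₁) (# D₂) i)) (trans (cong (Fin.splitAt (# D₁)) h) (Fin.splitAt-join (# D₁) (# D₂) j))
    sound : ∀ l m (c : Choice l) (d : Choice m) → code c ≡ code d → Meet l m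
    sound l m (inj₁ (x , d , xl)) (inj₁ (y , d′ , ym)) h with join-injective {inj₁ _} {inj₁ _} h
    ... | eq = x , xl , subst (λ z → pl z m ≡ true) (sym (rank-injective D₁ x y d d′ (inj₁-inj eq))) ym
      where
      inj₁-inj : ∀ {A B : Set} {a b : A} → inj₁ {B = B} a ≡ inj₁ b → a ≡ b
      inj₁-inj refl = refl
    sound l m (inj₂ (f , d , fl)) (inj₂ (g , d′ , gm)) h with join-injective {inj₂ _} {inj₂ _} h
    ... | eq = coplanar⇒Meet fl (subst (λ z → le z m ≡ true) (sym (rank-injective D₂ f g d d′ (inj₂-inj eq))) gm)
      where
      inj₂-inj : ∀ {A B : Set} {a b : B} → inj₂ {A = A} a ≡ inj₂ b → a ≡ b
      inj₂-inj refl = refl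
    sound l m (inj₁ _) (inj₂ _) h with join-injective {inj₁ _} {inj₂ _} h
    ... | ()
    sound l m (inj₂ _) (inj₁ _) h with join-injective {inj₂ _} {inj₁ _} h
    ... | ()

module ClassColouring {q : ℕ} (G : Geometry q) where
  open Geometry G
  open Incidence G
  open ChamberSets G
  open Parts G
  open Trichotomy G

  Kind : ChSet → Set
  Kind X = (∃ λ r → Through X r) ⊎ ((∃ λ f → Inside X f) ⊎ card X ≤ 25 * K)

  point-kind plane-kind small-kind : ∀ {X} → Kind X → Bool
  point-kind (inj₁ _) = true
  point-kind (inj₂ _) = false
  plane-kind (inj₂ (inj₁ _)) = true
  plane-kind _ = false
  small-kind (inj₂ (inj₂ _)) = true
  small-kind _ = false

  at : ∀ {X} → Kind X → Fin nP → Bool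
  at (inj₁ (r , _)) x = r == x
  at (inj₂ _) x = false

  on : ∀ {X} → Kind X → Fin nE → Bool
  on (inj₂ (inj₁ (f , _))) e = f == e
  on _ e = false

  at-kind : ∀ {X} (k : Kind X) {x} → at k x ≡ true → point-kind k ≡ true
  at-kind (inj₁ _) _ = refl

  on-kind : ∀ {X} (k : Kind X) {e} → on k e ≡ true → plane-kind k ≡ true
  on-kind (inj₂ (inj₁ _)) _ = refl

  at-unique : ∀ {X} (k : Kind X) {x y} → at k x ≡ true → at k y ≡ true → x ≡ y
  at-unique (inj₁ (r , _)) {x} {y} h h′ = trans (sym (==-elim r x h)) (==-elim r y h′)

  on-unique : ∀ {X} (k : Kind X) {e f} → on k e ≡ true → on k f ≡ true → e ≡ f
  on-unique (inj₂ (inj₁ (r , _))) {x} {y} h h′ = trans (sym (==-elim r x h)) (==-elim r y h′)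

  union-bound : ∀ {n} (Z : ChSet) (s : Fin n → Bool) (X : Fin n → ChSet) →
    (∀ {x l e} → Z x l e ≡ true → ∃ λ c → s c ≡ true × X c x l e ≡ true) → card Z ≤ sum (λ c → ι (s c) * card (X c))
  union-bound {n} Z s X h = begin
    card Z      ≤⟨ sum-mono (λ l → sum-mono (λ x → sum-mono (λ e → pointwise x l e))) ⟩
    sum (λ l → sum (λ x → sum (λ e → sum (λ c → t c x l e))))      ≡⟨ sum-cong-≗ (λ l → sum-cong-≗ (λ x → ∑-comm (λ e c → t c x l e))) ⟩
    sum (λ l → sum (λ x → sum (λ c → sum (λ e → t c x l e))))      ≡⟨ sum-cong-≗ (λ l → ∑-comm (λ x c → sum (λ e → t c x l e))) ⟩
    sum (λ l → sum (λ c → sum (λ x → sum (λ e → t c x l e))))      ≡⟨ ∑-comm (λ l c → sum (λ x → sum (λ e → t c x l e))) ⟩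
    sum (λ c → sum (λ l → sum (λ x → sum (λ e → t c x l e))))      ≤⟨ sum-mono factor ⟩
    sum (λ c → ι (s c) * card (X c))      ∎
    where
    open ≤-Reasoning
    t : Fin n → Fin nP → Fin nL → Fin nE → ℕ
    t c x l e = ι (s c ∧ X c x l e)
    pointwise : ∀ x l e → ι (Z x l e) ≤ sum (λ c → t c x l e)
    pointwise x l e with Z x l e in eq
    ... | false = z≤n
    ... | true = let (c , sc , Xc) = h eq in #-≥1 (λ c → s c ∧ X c x l e) c (∧-intro sc Xc)
    factor : ∀ c → sum (λ l → sum (λ x → sum (λ e → t c x l e))) ≤ ι (s c) * card (X c)
    factor c with s c
    ... | true = ≤-reflexive (sym (+-identityʳ _))
    ... | false = ≤-reflexive (trans (sum-cong-≗ (λ l → trans (sum-cong-≗ (λ x → sum-zero nE)) (sum-zero nP))) (sum-zero nL))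

  chambers-on : (Fin nL → Bool) → ChSet
  chambers-on D x l e = (pl x l ∧ le e l) ∧ D l

  card-chambers-on : ∀ D → card (chambers-on D) ≡ # D * (suc q * suc q)
  card-chambers-on D = trans (sum-cong-≗ each) (sym (*-distribʳ-sum (suc q * suc q) (ι ∘ D)))
    where
    row : ∀ l x → D l ≡ true → # (λ e → chambers-on D x l e) ≡ ι (pl x l) * suc q
    row l x Dl with pl x l
    ... | true rewrite Dl = trans (#-cong (λ e h → proj₁ (∧-elim h)) (λ e h → ∧-intro h refl)) (trans (#planes-on l) (sym (+-identityʳ _)))
    ... | false = sum-zero nE
    each : ∀ l → on-line (chambers-on D) l ≡ ι (D l) * (suc q * suc q)
    each l with decide (D l)
    ... | inj₁ Dl = trans (sum-cong-≗ (λ x → row l x Dl)) (trans (sym (*-distribʳ-sum (suc q) (λ x → ι (pl x l))))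
                      (trans (cong (_* suc q) (#points-on l)) (sym (trans (cong (λ b → ι b * (suc q * suc q)) Dl) (+-identityʳ _)))))
    ... | inj₂ n = trans (sum-none (λ x e → chambers-on D x l e) (λ x e h → true≢false (proj₂ (∧-elim {pl x l ∧ le e l} h)) n))
                     (cong (λ b → ι b * (suc q * suc q)) (sym n))

  -- Coinciding centres are merged in `A` and `B`, which only lowers their number. A chamber on an
  -- uncovered line must belong to a small class, and such a line has (q + 1)² chambers; hence `r`
  -- small classes account for at most 25r(q + 1) lines.
  too-few-classes : ∀ {k} (X : Fin k → ChSet) → 47 ≤ q → k < q * q + q →
    (∀ c → Independent (X c)) → (∀ c → Chambers (X c)) →
    (∀ x l e → pl x l ≡ true → le e l ≡ true → ∃ λ c → X c x l e ≡ true) → ⊥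
  too-few-classes {k} X 47≤q k< ind ch cov = no-cover G A B r 47≤q count U≤
    where
    open ≤-Reasoning
    kind : ∀ c → Kind (X c)
    kind c = trichotomy (ind c) (ch c)
    A : Fin nP → Bool
    A x = some (λ c → at (kind c) x)
    B : Fin nE → Bool
    B e = some (λ c → on (kind c) e)
    small : Fin k → Bool
    small c = small-kind (kind c)
    r = # small
    open Uncovered G A B using (U; uncovered)
    #A≤ : # A ≤ # (λ c → point-kind (kind c))
    #A≤ = matching A _ (λ x c → at (kind c) x) (λ x h → let (c , k) = some-elim _ h in c , at-kind (kind c) k , k)
            (λ x y c _ _ _ h h′ → at-unique (kind c) h h′)
    #B≤ : # B ≤ # (λ c → plane-kind (kind c))
    #B≤ = matching B _ (λ x c → on (kind c) x) (λ x h → let (c , k) = some-elim _ h in c , on-kind (kind c) k , k)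
            (λ x y c _ _ _ h h′ → on-unique (kind c) h h′)
    kinds : # (λ c → point-kind (kind c)) + # (λ c → plane-kind (kind c)) + r ≡ k
    kinds = begin-equality
      # (λ c → point-kind (kind c)) + # (λ c → plane-kind (kind c)) + r
        ≡⟨ cong (_+ r) (∑-distrib-+ (λ c → ι (point-kind (kind c))) (λ c → ι (plane-kind (kind c)))) ⟨
      sum (λ c → ι (point-kind (kind c)) + ι (plane-kind (kind c))) + r
        ≡⟨ ∑-distrib-+ (λ c → ι (point-kind (kind c)) + ι (plane-kind (kind c))) (ι ∘ small) ⟨
      sum (λ c → ι (point-kind (kind c)) + ι (plane-kind (kind c)) + ι (small c))
        ≡⟨ sum-cong-≗ (λ c → one (kind c)) ⟩
      sum {k} (λ _ → 1)      ≡⟨ #-all k ⟩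
      k      ∎
      where
      one : ∀ {X} (κ : Kind X) → ι (point-kind κ) + ι (plane-kind κ) + ι (small-kind κ) ≡ 1
      one (inj₁ _) = refl
      one (inj₂ (inj₁ _)) = refl
      one (inj₂ (inj₂ _)) = refl
    count : # A + # B + suc r ≤ q * q + q
    count = ≤-trans (≤-reflexive (+-suc (# A + # B) r))
              (≤-trans (s≤s (≤-trans (+-monoˡ-≤ r (+-mono-≤ #A≤ #B≤)) (≤-reflexive kinds))) k<)
    Z = chambers-on uncovered
    in-small : ∀ {x l e} → Z x l e ≡ true → ∃ λ c → small c ≡ true × X c x l e ≡ true
    in-small {x} {l} {e} h with ∧-elim {pl x l ∧ le e l} h
    ... | p , u with ∧-elim {pl x l} p | ∧-elim {not (some (λ y → A y ∧ pl y l))} u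
    ... | xl , el | nA , nB with cov x l e xl el
    ... | c , Xc = c , is-small (kind c) refl , Xc
      where
      -- `A` and `B` are defined through `kind c`, so its value is passed with an equation that
      -- transports membership back.
      is-small : (κ : Kind (X c)) → kind c ≡ κ → small c ≡ true
      is-small (inj₂ (inj₂ _)) eq = cong small-kind eq
      is-small (inj₁ (y , t)) eq = ⊥-elim (true≢false (some-intro (λ y → A y ∧ pl y l) y (∧-intro
        (some-intro _ c (subst (λ κ → at κ y ≡ true) (sym eq) (==-refl refl))) (t Xc))) (not-false nA))
      is-small (inj₂ (inj₁ (f , i))) eq = ⊥-elim (true≢false (some-intro (λ f → B f ∧ le f l) f (∧-intro
        (some-intro _ c (subst (λ κ → on κ f ≡ true) (sym eq) (==-refl refl))) (i Xc))) (not-false nB))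
    small-card : ∀ c → small c ≡ true → card (X c) ≤ 25 * K
    small-card c h = go (kind c) h
      where
      go : (κ : Kind (X c)) → small-kind κ ≡ true → card (X c) ≤ 25 * K
      go (inj₂ (inj₂ b)) _ = b
    U≤ : U ≤ 25 * (r * suc q)
    U≤ = *-cancelʳ-≤ U (25 * (r * suc q)) (suc q * suc q) (begin
      U * (suc q * suc q)      ≡⟨ card-chambers-on uncovered ⟨
      card Z      ≤⟨ union-bound Z small X (λ {x l e} → in-small {x} {l} {e}) ⟩
      sum (λ c → ι (small c) * card (X c))   ≤⟨ weighted-sum-≤ small (λ c → card (X c)) (25 * K) small-card ⟩
      r * (25 * K)      ≡⟨ cong (λ z → r * (25 * z)) (cube-def q) ⟨
      r * (25 * (suc q * (suc q * suc q)))   ≡⟨ arith r (suc q) ⟩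
      25 * (r * suc q) * (suc q * suc q)     ∎)
      where
      arith : ∀ r k → r * (25 * (k * (k * k))) ≡ 25 * (r * k) * (k * k)
      arith = solve-∀

-- Linear algebra over a finite field

-- If `y` were missed it could be punched out, giving an injection into a smaller set.
injective⇒surjective : ∀ {n} (f : Fin n → Fin n) → (∀ {i j} → f i ≡ f j → i ≡ j) → ∀ y → ∃ λ x → f x ≡ y
injective⇒surjective {suc n} f inj y with Fin.any? (λ x → f x Fin.≟ y)
... | yes found = found
... | no none = ⊥-elim (1+n≰n (Fin.injective⇒≤ {f = λ x → Fin.punchOut (λ eq → none (x , sym eq))}
                  (λ {i} {j} eq → inj (Fin.punchOut-injective (λ e → none (i , sym e)) (λ e → none (j , sym e)) eq))))

funToFin-cong : ∀ {m n} {f g : Fin m → Fin n} → (∀ i → f i ≡ g i) → Fin.funToFin f ≡ Fin.funToFin g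
funToFin-cong {zero} h = refl
funToFin-cong {suc m} h = cong₂ Fin.combine (h zero) (funToFin-cong (h ∘ suc))

module Identities {c ℓ} (R : CommutativeRing c ℓ) where
  open CommutativeRing R using (_≈_; commutativeSemiring) renaming (_+_ to _⊕_; _*_ to _⊗_; refl to ≈-refl)
  open import Algebra.Solver.Ring.NaturalCoefficients.Default commutativeSemiring using (solve; _:+_; _:*_; _:=_)

  bilinear : ∀ s t f₀ f₁ f₂ f₃ u₀ u₁ u₂ u₃ w₀ w₁ w₂ w₃ →
    f₀ ⊗ (s ⊗ u₀ ⊕ t ⊗ w₀) ⊕ f₁ ⊗ (s ⊗ u₁ ⊕ t ⊗ w₁) ⊕ f₂ ⊗ (s ⊗ u₂ ⊕ t ⊗ w₂) ⊕ f₃ ⊗ (s ⊗ u₃ ⊕ t ⊗ w₃)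
    ≈ s ⊗ (f₀ ⊗ u₀ ⊕ f₁ ⊗ u₁ ⊕ f₂ ⊗ u₂ ⊕ f₃ ⊗ u₃) ⊕ t ⊗ (f₀ ⊗ w₀ ⊕ f₁ ⊗ w₁ ⊕ f₂ ⊗ w₂ ⊕ f₃ ⊗ w₃)
  bilinear = solve 14 (λ s t f₀ f₁ f₂ f₃ u₀ u₁ u₂ u₃ w₀ w₁ w₂ w₃ →
    f₀ :* (s :* u₀ :+ t :* w₀) :+ f₁ :* (s :* u₁ :+ t :* w₁) :+ f₂ :* (s :* u₂ :+ t :* w₂) :+ f₃ :* (s :* u₃ :+ t :* w₃) :=
    s :* (f₀ :* u₀ :+ f₁ :* u₁ :+ f₂ :* u₂ :+ f₃ :* u₃) :+ t :* (f₀ :* w₀ :+ f₁ :* w₁ :+ f₂ :* w₂ :+ f₃ :* w₃)) ≈-refl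

  recombine : ∀ s t a b c d u w → s ⊗ (a ⊗ u ⊕ b ⊗ w) ⊕ t ⊗ (c ⊗ u ⊕ d ⊗ w) ≈ (s ⊗ a ⊕ t ⊗ c) ⊗ u ⊕ (s ⊗ b ⊕ t ⊗ d) ⊗ w
  recombine = solve 8 (λ s t a b c d u w →
    s :* (a :* u :+ b :* w) :+ t :* (c :* u :+ d :* w) :=
    (s :* a :+ t :* c) :* u :+ (s :* b :+ t :* d) :* w) ≈-refl

  four-linear : ∀ s t a b c d a′ b′ c′ d′ u w x z →
    s ⊗ ((a ⊗ u ⊕ b ⊗ w) ⊕ (c ⊗ x ⊕ d ⊗ z)) ⊕ t ⊗ ((a′ ⊗ u ⊕ b′ ⊗ w) ⊕ (c′ ⊗ x ⊕ d′ ⊗ z))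
    ≈ ((s ⊗ a ⊕ t ⊗ a′) ⊗ u ⊕ (s ⊗ b ⊕ t ⊗ b′) ⊗ w) ⊕ ((s ⊗ c ⊕ t ⊗ c′) ⊗ x ⊕ (s ⊗ d ⊕ t ⊗ d′) ⊗ z)
  four-linear = solve 14 (λ s t a b c d a′ b′ c′ d′ u w x z →
    s :* ((a :* u :+ b :* w) :+ (c :* x :+ d :* z)) :+ t :* ((a′ :* u :+ b′ :* w) :+ (c′ :* x :+ d′ :* z)) :=
    ((s :* a :+ t :* a′) :* u :+ (s :* b :+ t :* b′) :* w) :+ ((s :* c :+ t :* c′) :* x :+ (s :* d :+ t :* d′) :* z)) ≈-refl

  rotate : ∀ a b c → a ⊗ (b ⊗ c) ≈ b ⊗ (a ⊗ c)
  rotate = solve 3 (λ a b c →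
    a :* (b :* c) :=
    b :* (a :* c)) ≈-refl

  dot-swap : ∀ f₀ f₁ f₂ f₃ u₀ u₁ u₂ u₃ → f₀ ⊗ u₀ ⊕ f₁ ⊗ u₁ ⊕ f₂ ⊗ u₂ ⊕ f₃ ⊗ u₃ ≈ u₀ ⊗ f₀ ⊕ u₁ ⊗ f₁ ⊕ u₂ ⊗ f₂ ⊕ u₃ ⊗ f₃
  dot-swap = solve 8 (λ f₀ f₁ f₂ f₃ u₀ u₁ u₂ u₃ →
    f₀ :* u₀ :+ f₁ :* u₁ :+ f₂ :* u₂ :+ f₃ :* u₃ :=
    u₀ :* f₀ :+ u₁ :* f₁ :+ u₂ :* f₂ :+ u₃ :* f₃) ≈-refl

module Linear {c ℓ} (R : CommutativeRing c ℓ) {q : ℕ} (F : IsFiniteFieldOfOrder R q) (1<q : 1 < q) where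
  open CommutativeRing R using (Carrier; _≈_; 0#; 1#)
    renaming (setoid to ≈-setoid; zeroˡ to ⊗-zeroˡ; zeroʳ to ⊗-zeroʳ; *-identityˡ to ⊗-identityˡ; *-identityʳ to ⊗-identityʳ;
              +-identityˡ to ⊕-identityˡ; +-identityʳ to ⊕-identityʳ; *-assoc to ⊗-assoc; *-comm to ⊗-comm; +-comm to ⊕-comm;
              _+_ to _⊕_; _*_ to _⊗_; -_ to ⊖_; refl to ≈-refl; sym to ≈-sym; trans to ≈-trans; reflexive to ≈-reflexive;
              +-cong to ⊕-cong; *-cong to ⊗-cong; -‿inverseʳ to ⊖-inverseʳ; -‿cong to ⊖-cong; +-group to ⊕-group; ring to ring)
  open IsFiniteFieldOfOrder F renaming (_≟_ to _≟ᶠ_)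
  open PG3 R renaming (NonZero to NonZeroᵛ)
  open Identities R
  private
    module GP = GroupProperties ⊕-group
    module RP = RingProperties ring
    module ≈R = SetoidReasoning ≈-setoid

  infix 4 _≋_
  _≋_ : ∀ {n} → (Fin n → Carrier) → (Fin n → Carrier) → Set ℓ
  u ≋ v = ∀ i → u i ≈ v i

  ⊗-cancel : ∀ {x y} → ¬ (x ≈ 0#) → x ⊗ y ≈ 0# → y ≈ 0#
  ⊗-cancel {x} {y} x≉0 xy≈0 = let (x⁻¹ , inv) = inverse x x≉0 in begin
    y      ≈⟨ ⊗-identityˡ y ⟨
    1# ⊗ y      ≈⟨ ⊗-cong (≈-trans (≈-sym inv) (⊗-comm x x⁻¹)) ≈-refl ⟩
    (x⁻¹ ⊗ x) ⊗ y      ≈⟨ ⊗-assoc x⁻¹ x y ⟩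
    x⁻¹ ⊗ (x ⊗ y)      ≈⟨ ⊗-cong ≈-refl xy≈0 ⟩
    x⁻¹ ⊗ 0#      ≈⟨ ⊗-zeroʳ x⁻¹ ⟩
    0#      ∎
    where open ≈R

  0+ : ∀ {x y} → x ≈ 0# → x ⊕ y ≈ y
  0+ {x} {y} h = ≈-trans (⊕-cong h ≈-refl) (⊕-identityˡ y)

  +0 : ∀ {x y} → y ≈ 0# → x ⊕ y ≈ x
  +0 {x} {y} h = ≈-trans (⊕-cong ≈-refl h) (⊕-identityʳ x)

  0* : ∀ {x y} → x ≈ 0# → x ⊗ y ≈ 0#
  0* {x} {y} h = ≈-trans (⊗-cong h ≈-refl) (⊗-zeroˡ y)

  *0 : ∀ {x y} → y ≈ 0# → x ⊗ y ≈ 0#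
  *0 {x} {y} h = ≈-trans (⊗-cong ≈-refl h) (⊗-zeroʳ x)

  -1# : Carrier
  -1# = ⊖ 1#

  -- Differences are written with the coefficients 1 and -1, so that they have the shape of a linear
  -- combination and the bilinear identities apply.
  difference : ∀ {x y} → 1# ⊗ x ⊕ -1# ⊗ y ≈ 0# → x ≈ y
  difference {x} {y} h = begin
    x      ≈⟨ ⊗-identityˡ x ⟨
    1# ⊗ x      ≈⟨ GP.inverseˡ-unique (1# ⊗ x) (-1# ⊗ y) h ⟩
    ⊖ (-1# ⊗ y)      ≈⟨ RP.-‿distribˡ-* -1# y ⟩
    (⊖ -1#) ⊗ y      ≈⟨ ⊗-cong (GP.⁻¹-involutive 1#) ≈-refl ⟩
    1# ⊗ y      ≈⟨ ⊗-identityˡ y ⟩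
    y      ∎
    where open ≈R

  difference′ : ∀ {x y} → x ≈ y → 1# ⊗ x ⊕ -1# ⊗ y ≈ 0#
  difference′ {x} {y} h = begin
    1# ⊗ x ⊕ -1# ⊗ y      ≈⟨ ⊕-cong (⊗-cong ≈-refl h) (≈-sym (RP.-‿distribˡ-* 1# y)) ⟩
    1# ⊗ y ⊕ ⊖ (1# ⊗ y)    ≈⟨ ⊖-inverseʳ (1# ⊗ y) ⟩
    0#      ∎
    where open ≈R

  cancels : ∀ b d → d ⊗ b ⊕ (⊖ b) ⊗ d ≈ 0#
  cancels b d = begin
    d ⊗ b ⊕ (⊖ b) ⊗ d      ≈⟨ ⊕-cong (⊗-comm d b) (≈-sym (RP.-‿distribˡ-* b d)) ⟩
    b ⊗ d ⊕ ⊖ (b ⊗ d)      ≈⟨ ⊖-inverseʳ (b ⊗ d) ⟩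
    0#      ∎
    where open ≈R

  code : Carrier → Fin q
  code x = proj₁ (enum-sur x)

  enum-code : ∀ x → enum (code x) ≈ x
  enum-code x = proj₂ (enum-sur x)

  code-cong : ∀ {x y} → x ≈ y → code x ≡ code y
  code-cong {x} {y} h = enum-inj _ _ (≈-trans (enum-code x) (≈-trans h (≈-sym (enum-code y))))

  any-element? : ∀ {p} {P : Carrier → Set p} → (∀ {x y} → x ≈ y → P x → P y) → (∀ x → Dec (P x)) → Dec (∃ P)
  any-element? resp P? = map′ (λ (i , p) → enum i , p) (λ (x , p) → code x , resp (≈-sym (enum-code x)) p) (Fin.any? (P? ∘ enum))

  -- Numbers below `q ^ n` stand for vectors up to `_≋_`, which makes search and the pigeonhole
  -- principle available.
  encode : ∀ {n} → (Fin n → Carrier) → Fin (q ^ n)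
  encode v = Fin.funToFin (code ∘ v)

  decode : ∀ {n} → Fin (q ^ n) → Fin n → Carrier
  decode i = enum ∘ Fin.finToFun i

  decode-encode : ∀ {n} (v : Fin n → Carrier) → decode (encode v) ≋ v
  decode-encode v i = ≈-trans (≈-reflexive (cong enum (Fin.finToFun-funToFin (code ∘ v) i))) (enum-code (v i))

  encode-decode : ∀ n i → encode (decode {n} i) ≡ i
  encode-decode n i = trans (funToFin-cong (λ j → enum-inj _ _ (enum-code (enum (Fin.finToFun {m = q} {n} i j))))) (Fin.funToFin-finToFin {m = n} {q} i)

  encode-cong : ∀ {n} {u v : Fin n → Carrier} → u ≋ v → encode u ≡ encode v
  encode-cong h = funToFin-cong (code-cong ∘ h)

  encode-injective : ∀ {n} {u v : Fin n → Carrier} → encode u ≡ encode v → u ≋ v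
  encode-injective {u = u} {v} h i = ≈-trans (≈-sym (decode-encode u i)) (≈-trans (≈-reflexive (cong (λ k → decode k i) h)) (decode-encode v i))

  comb : Carrier → Carrier → V → V → V
  comb s t u w i = s ⊗ u i ⊕ t ⊗ w i

  dot-comb : ∀ f s t u w → ⟨ f , comb s t u w ⟩ ≈ s ⊗ ⟨ f , u ⟩ ⊕ t ⊗ ⟨ f , w ⟩
  dot-comb f s t u w = bilinear s t (f zero) (f (suc zero)) (f (suc (suc zero))) (f (suc (suc (suc zero)))) _ _ _ _ _ _ _ _

  dot-comm : ∀ f u → ⟨ f , u ⟩ ≈ ⟨ u , f ⟩
  dot-comm f u = dot-swap (f zero) (f (suc zero)) (f (suc (suc zero))) (f (suc (suc (suc zero)))) _ _ _ _

  dot-cong : ∀ f {u w} → u ≋ w → ⟨ f , u ⟩ ≈ ⟨ f , w ⟩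
  dot-cong f h = ⊕-cong (⊕-cong (⊕-cong (⊗-cong ≈-refl (h _)) (⊗-cong ≈-refl (h _))) (⊗-cong ≈-refl (h _))) (⊗-cong ≈-refl (h _))

  dot-span : ∀ f u w {v} → ⟨ f , u ⟩ ≈ 0# → ⟨ f , w ⟩ ≈ 0# → InSpan u w v → ⟨ f , v ⟩ ≈ 0#
  dot-span f u w fu fw (s , t , h) = ≈-trans (dot-cong f h) (≈-trans (dot-comb f s t u w) (≈-trans (+0 (*0 fw)) (*0 fu)))

  dot-scale : ∀ f u {v s} → ⟨ f , u ⟩ ≈ 0# → (∀ i → v i ≈ s ⊗ u i) → ⟨ f , v ⟩ ≈ 0#
  dot-scale f u {s = s} fu h = dot-span f u u fu fu (s , 0# , λ i → ≈-trans (h i) (≈-sym (+0 (⊗-zeroˡ _))))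

  unit : Fin 4 → V
  unit zero      zero      = 1#
  unit (suc zero)      (suc zero)      = 1#
  unit (suc (suc zero))      (suc (suc zero))      = 1#
  unit (suc (suc (suc zero))) (suc (suc (suc zero))) = 1#
  unit _      _      = 0#

  dot-unit : ∀ f j → ⟨ f , unit j ⟩ ≈ f j
  dot-unit f zero      = ≈-trans (+0 (⊗-zeroʳ _)) (≈-trans (+0 (⊗-zeroʳ _)) (≈-trans (+0 (⊗-zeroʳ _)) (⊗-identityʳ _)))
  dot-unit f (suc zero)      = ≈-trans (+0 (⊗-zeroʳ _)) (≈-trans (+0 (⊗-zeroʳ _)) (≈-trans (0+ (⊗-zeroʳ _)) (⊗-identityʳ _)))
  dot-unit f (suc (suc zero))      = ≈-trans (+0 (⊗-zeroʳ _)) (≈-trans (0+ (≈-trans (+0 (⊗-zeroʳ _)) (⊗-zeroʳ _))) (⊗-identityʳ _))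
  dot-unit f (suc (suc (suc zero))) = ≈-trans (0+ (≈-trans (+0 (⊗-zeroʳ _)) (≈-trans (+0 (⊗-zeroʳ _)) (⊗-zeroʳ _)))) (⊗-identityʳ _)

  opaque
    nonzero-coordinate : ∀ {v : V} → NonZeroᵛ v → ∃ λ i → ¬ (v i ≈ 0#)
    nonzero-coordinate {v} nz with Fin.any? (λ i → ¬? (v i ≟ᶠ 0#))
    ... | yes found = found
    ... | no none = ⊥-elim (nz λ i → decidable-stable (v i ≟ᶠ 0#) (λ h → none (i , h)))

  unit-nonzero : ∀ j → NonZeroᵛ (unit j)
  unit-nonzero zero h = 1≉0 (h zero)
  unit-nonzero (suc zero) h = 1≉0 (h (suc zero))
  unit-nonzero (suc (suc zero)) h = 1≉0 (h (suc (suc zero)))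
  unit-nonzero (suc (suc (suc zero))) h = 1≉0 (h (suc (suc (suc zero))))

  -- Fewer equations than unknowns: by the pigeonhole principle two vectors have the same image.
  opaque
    kernel-vector : ∀ {n} (g : Fin n → V) → n < 4 → ∃ λ v → NonZeroᵛ v × (∀ k → ⟨ g k , v ⟩ ≈ 0#)
    kernel-vector {n} g n<4 with Fin.pigeonhole (^-monoʳ-< q 1<q n<4) (λ i → encode (λ k → ⟨ g k , decode {4} i ⟩))
    ... | i , j , i<j , eq = comb 1# -1# (decode i) (decode j) ,
          (λ h → Fin.<-irrefl (trans (sym (encode-decode 4 i)) (trans (encode-cong (λ k → difference (h k))) (encode-decode 4 j))) i<j) ,
          (λ k → ≈-trans (dot-comb (g k) 1# -1# (decode i) (decode j)) (difference′ (encode-injective eq k)))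

  -- The factor 0 is allowed. Hence symmetry requires `w` nonzero, and for nonzero `u` the negation
  -- is exactly linear independence.
  Proportional : V → V → Set (c ⊔ˡ ℓ)
  Proportional u w = ∃ λ s → ∀ i → w i ≈ s ⊗ u i

  opaque
    proportional? : ∀ u w → Dec (Proportional u w)
    proportional? u w = any-element? (λ x≈y h i → ≈-trans (h i) (⊗-cong x≈y ≈-refl)) (λ s → Fin.all? (λ i → w i ≟ᶠ (s ⊗ u i)))

    in-span? : ∀ u w v → Dec (InSpan u w v)
    in-span? u w v = any-element? (λ x≈y (t , h) → t , λ i → ≈-trans (h i) (⊕-cong (⊗-cong x≈y ≈-refl) ≈-refl))
      (λ s → any-element? (λ x≈y h i → ≈-trans (h i) (⊕-cong ≈-refl (⊗-cong x≈y ≈-refl)))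
      (λ t → Fin.all? (λ i → v i ≟ᶠ (s ⊗ u i ⊕ t ⊗ w i))))

    nonzero? : ∀ (v : V) → Dec (NonZeroᵛ v)
    nonzero? v = ¬? (Fin.all? (λ i → v i ≟ᶠ 0#))

  solve-for : ∀ {t} → ¬ (t ≈ 0#) → ∃ λ r → ∀ {x y} → x ⊕ t ⊗ y ≈ 0# → y ≈ r ⊗ x
  solve-for {t} t≉0 = ⊖ t⁻¹ , λ {x} {y} h → begin
      y      ≈⟨ ⊗-identityˡ y ⟨
      1# ⊗ y      ≈⟨ ⊗-cong (≈-trans (≈-sym inv) (⊗-comm t t⁻¹)) ≈-refl ⟩
      (t⁻¹ ⊗ t) ⊗ y      ≈⟨ ⊗-assoc t⁻¹ t y ⟩
      t⁻¹ ⊗ (t ⊗ y)      ≈⟨ ⊗-cong ≈-refl (GP.inverseʳ-unique x (t ⊗ y) h) ⟩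
      t⁻¹ ⊗ (⊖ x)      ≈⟨ RP.-‿distribʳ-* t⁻¹ x ⟨
      ⊖ (t⁻¹ ⊗ x)      ≈⟨ RP.-‿distribˡ-* t⁻¹ x ⟩
      (⊖ t⁻¹) ⊗ x      ∎
    where
    open ≈R
    t⁻¹ = proj₁ (inverse t t≉0)
    inv = proj₂ (inverse t t≉0)

  independent : ∀ {u w} → NonZeroᵛ u → ¬ Proportional u w → LinIndep2 u w
  independent {u} {w} nz np s t h with t ≟ᶠ 0#
  ... | no t≉0 = let (r , solve) = solve-for t≉0 in
        ⊥-elim (np (r ⊗ s , λ i → ≈-trans (solve (h i)) (≈-sym (⊗-assoc r s (u i)))))
  ... | yes t≈0 with nonzero-coordinate nz
  ... | i , ui = ⊗-cancel ui (≈-trans (⊗-comm (u i) s) (≈-trans (≈-sym (+0 (0* t≈0))) (h i))) , t≈0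

  independent⇒nonzeroˡ : ∀ {u w} → LinIndep2 u w → NonZeroᵛ u
  independent⇒nonzeroˡ ind h = 1≉0 (proj₁ (ind 1# 0# (λ i → ≈-trans (+0 (⊗-zeroˡ _)) (*0 (h i)))))

  independent⇒¬proportional : ∀ {u w} → LinIndep2 u w → ¬ Proportional u w
  independent⇒¬proportional {u} {w} ind (s , h) = 1≉0 (begin
      1#      ≈⟨ GP.⁻¹-involutive 1# ⟨
      ⊖ -1#     ≈⟨ ⊖-cong (proj₂ (ind s -1# (λ i → ≈-trans (⊕-cong (≈-trans (≈-sym (h i)) (≈-sym (⊗-identityˡ _))) ≈-refl) (difference′ ≈-refl)))) ⟩
      ⊖ 0#      ≈⟨ GP.ε⁻¹≈ε ⟩
      0#      ∎)
    where open ≈R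

  independent? : ∀ u w → Dec (LinIndep2 u w)
  independent? u w = map′ (λ (nz , np) → independent nz np) (λ ind → independent⇒nonzeroˡ ind , independent⇒¬proportional ind)
                          (nonzero? u ×-dec ¬? (proportional? u w))

  proportional-refl : ∀ {u} → Proportional u u
  proportional-refl = 1# , λ i → ≈-sym (⊗-identityˡ _)

  proportional-trans : ∀ {u v w} → Proportional u v → Proportional v w → Proportional u w
  proportional-trans (s , h) (t , k) = t ⊗ s , λ i → ≈-trans (k i) (≈-trans (⊗-cong ≈-refl (h i)) (≈-sym (⊗-assoc t s _)))

  proportional-sym : ∀ {u w} → NonZeroᵛ w → Proportional u w → Proportional w u
  proportional-sym {u} {w} nz (s , h) = s⁻¹ , λ i → ≈-sym (begin
      s⁻¹ ⊗ w i      ≈⟨ ⊗-cong ≈-refl (h i) ⟩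
      s⁻¹ ⊗ (s ⊗ u i)     ≈⟨ ⊗-assoc s⁻¹ s (u i) ⟨
      (s⁻¹ ⊗ s) ⊗ u i     ≈⟨ ⊗-cong (≈-trans (⊗-comm s⁻¹ s) inv) ≈-refl ⟩
      1# ⊗ u i      ≈⟨ ⊗-identityˡ (u i) ⟩
      u i      ∎)
    where
    open ≈R
    s≉0 : ¬ (s ≈ 0#)
    s≉0 s≈0 = nz (λ i → ≈-trans (h i) (0* s≈0))
    s⁻¹ = proj₁ (inverse s s≉0)
    inv = proj₂ (inverse s s≉0)

  span-left : ∀ {u w} → InSpan u w u
  span-left = 1# , 0# , λ i → ≈-sym (≈-trans (+0 (⊗-zeroˡ _)) (⊗-identityˡ _))

  span-right : ∀ {u w} → InSpan u w w
  span-right = 0# , 1# , λ i → ≈-sym (≈-trans (0+ (⊗-zeroˡ _)) (⊗-identityˡ _))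

  span-trans : ∀ {u w p r v} → InSpan u w p → InSpan u w r → InSpan p r v → InSpan u w v
  span-trans (a , b , hp) (c , d , hr) (s , t , hv) = s ⊗ a ⊕ t ⊗ c , s ⊗ b ⊕ t ⊗ d ,
    λ i → ≈-trans (hv i) (≈-trans (⊕-cong (⊗-cong ≈-refl (hp i)) (⊗-cong ≈-refl (hr i))) (recombine s t a b c d _ _))

  span-proportional : ∀ {u w p v} → InSpan u w p → Proportional p v → InSpan u w v
  span-proportional hp (s , h) = span-trans hp hp (s , 0# , λ i → ≈-trans (h i) (≈-sym (+0 (⊗-zeroˡ _))))

  scale-span : ∀ {D u p r s t} → ¬ (D ≈ 0#) → (∀ i → D ⊗ u i ≈ s ⊗ p i ⊕ t ⊗ r i) → InSpan p r u
  scale-span {D} {u} {p} {r} {s} {t} D≉0 h = span-proportional {p = λ i → D ⊗ u i} (s , t , h)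
    (D⁻¹ , λ i → ≈-sym (≈-trans (≈-sym (⊗-assoc D⁻¹ D (u i))) (≈-trans (⊗-cong (≈-trans (⊗-comm D⁻¹ D) inv) ≈-refl) (⊗-identityˡ _))))
    where
    D⁻¹ = proj₁ (inverse D D≉0)
    inv = proj₂ (inverse D D≉0)

  -- Cramer's rule.
  exchange : ∀ {u w p r} → LinIndep2 p r → InSpan u w p → InSpan u w r → InSpan p r u × InSpan p r w
  exchange {u} {w} {p} {r} ind (a , b , hp) (c , d , hr) = scale-span D≉0 Du , scale-span D≉0 Dw
    where
    open ≈R
    D = d ⊗ a ⊕ (⊖ b) ⊗ c
    Du : ∀ i → D ⊗ u i ≈ d ⊗ p i ⊕ (⊖ b) ⊗ r i
    Du i = ≈-sym (begin
      d ⊗ p i ⊕ (⊖ b) ⊗ r i      ≈⟨ ⊕-cong (⊗-cong ≈-refl (hp i)) (⊗-cong ≈-refl (hr i)) ⟩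
      d ⊗ (a ⊗ u i ⊕ b ⊗ w i) ⊕ (⊖ b) ⊗ (c ⊗ u i ⊕ d ⊗ w i)      ≈⟨ recombine d (⊖ b) a b c d (u i) (w i) ⟩
      D ⊗ u i ⊕ (d ⊗ b ⊕ (⊖ b) ⊗ d) ⊗ w i      ≈⟨ +0 (0* (cancels b d)) ⟩
      D ⊗ u i      ∎)
    D′ : a ⊗ d ⊕ (⊖ c) ⊗ b ≈ D
    D′ = ⊕-cong (⊗-comm a d) (≈-trans (≈-sym (RP.-‿distribˡ-* c b)) (≈-trans (⊖-cong (⊗-comm c b)) (RP.-‿distribˡ-* b c)))
    Dw : ∀ i → D ⊗ w i ≈ (⊖ c) ⊗ p i ⊕ a ⊗ r i
    Dw i = ≈-sym (begin
      (⊖ c) ⊗ p i ⊕ a ⊗ r i      ≈⟨ ⊕-cong (⊗-cong ≈-refl (hp i)) (⊗-cong ≈-refl (hr i)) ⟩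
      (⊖ c) ⊗ (a ⊗ u i ⊕ b ⊗ w i) ⊕ a ⊗ (c ⊗ u i ⊕ d ⊗ w i)      ≈⟨ recombine (⊖ c) a a b c d (u i) (w i) ⟩
      ((⊖ c) ⊗ a ⊕ a ⊗ c) ⊗ u i ⊕ ((⊖ c) ⊗ b ⊕ a ⊗ d) ⊗ w i      ≈⟨ 0+ (0* (≈-trans (⊕-comm _ _) (cancels c a))) ⟩
      ((⊖ c) ⊗ b ⊕ a ⊗ d) ⊗ w i      ≈⟨ ⊗-cong (≈-trans (⊕-comm _ _) D′) ≈-refl ⟩
      D ⊗ w i      ∎)
    D≉0 : ¬ (D ≈ 0#)
    D≉0 D≈0 = independent⇒nonzeroˡ ind (λ i → ≈-trans (hp i) (≈-trans (+0 (0* b≈0)) (0* a≈0)))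
      where
      a≈0 = proj₂ (ind (⊖ c) a (λ i → ≈-trans (≈-sym (Dw i)) (0* D≈0)))
      b≈0 : b ≈ 0#
      b≈0 = ≈-trans (≈-sym (GP.⁻¹-involutive b)) (≈-trans (⊖-cong (proj₂ (ind d (⊖ b) (λ i → ≈-trans (≈-sym (Du i)) (0* D≈0))))) GP.ε⁻¹≈ε)

  -- A vector that vanishes in a coordinate where `u` does not can be a multiple of `u` only by
  -- being zero. `kernel-pair` obtains its second vector in the same way.
  complement : ∀ {u} → NonZeroᵛ u → ∃ λ w → LinIndep2 u w
  complement {u} nz with nonzero-coordinate nz
  ... | i , ui with kernel-vector {1} (λ _ → unit i) (s≤s (s≤s z≤n))
  ... | w , nzw , h = w , independent nz np
    where
    np : ¬ Proportional u w
    np (s , k) = nzw (λ j → ≈-trans (k j) (0* s≈0))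
      where
      s≈0 : s ≈ 0#
      s≈0 = ⊗-cancel ui (≈-trans (⊗-comm (u i) s) (≈-trans (≈-sym (k i)) (≈-trans (≈-sym (dot-unit w i)) (≈-trans (dot-comm w (unit i)) (h zero)))))

  kernel-pair : ∀ f g → ∃₂ λ u w → LinIndep2 u w × (⟨ f , u ⟩ ≈ 0# × ⟨ g , u ⟩ ≈ 0#) × (⟨ f , w ⟩ ≈ 0# × ⟨ g , w ⟩ ≈ 0#)
  kernel-pair f g with kernel-vector {2} (λ { zero → f ; (suc _) → g }) (s≤s (s≤s (s≤s z≤n)))
  ... | u , nzu , hu with nonzero-coordinate nzu
  ... | i , ui with kernel-vector {3} (λ { zero → f ; (suc zero) → g ; (suc (suc _)) → unit i }) (s≤s (s≤s (s≤s (s≤s z≤n))))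
  ... | w , nzw , hw = u , w , independent nzu np , (hu zero , hu (suc zero)) , (hw zero , hw (suc zero))
    where
    np : ¬ Proportional u w
    np (s , k) = nzw (λ j → ≈-trans (k j) (0* s≈0))
      where
      s≈0 : s ≈ 0#
      s≈0 = ⊗-cancel ui (≈-trans (⊗-comm (u i) s) (≈-trans (≈-sym (k i)) (≈-trans (≈-sym (dot-unit w i)) (≈-trans (dot-comm w (unit i)) (hw (suc (suc zero)))))))

  kernel-triple : ∀ f g h → ∃ λ v → NonZeroᵛ v × ⟨ f , v ⟩ ≈ 0# × ⟨ g , v ⟩ ≈ 0# × ⟨ h , v ⟩ ≈ 0#
  kernel-triple f g h with kernel-vector {3} (λ { zero → f ; (suc zero) → g ; (suc (suc _)) → h }) (s≤s (s≤s (s≤s (s≤s z≤n))))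
  ... | v , nz , k = v , nz , k zero , k (suc zero) , k (suc (suc zero))

  -- Four independent vectors span: an injective self-map of the finite set of vectors is surjective.
  module Spanning (u w x z : V)
    (ind : ∀ a b c d → (∀ i → comb a b u w i ⊕ comb c d x z i ≈ 0#) → (a ≈ 0# × b ≈ 0#) × (c ≈ 0# × d ≈ 0#)) where

    combination : V → V
    combination t i = comb (t zero) (t (suc zero)) u w i ⊕ comb (t (suc (suc zero))) (t (suc (suc (suc zero)))) x z i

    combination-injective : ∀ {s t} → combination s ≋ combination t → s ≋ t
    combination-injective {s} {t} h = λ
      { zero → difference (proj₁ (proj₁ zeros)) ; (suc zero) → difference (proj₂ (proj₁ zeros))
      ; (suc (suc zero)) → difference (proj₁ (proj₂ zeros)) ; (suc (suc (suc zero))) → difference (proj₂ (proj₂ zeros)) }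
      where
      δ : Fin 4 → Carrier
      δ k = 1# ⊗ s k ⊕ -1# ⊗ t k
      zeros : (δ zero ≈ 0# × δ (suc zero) ≈ 0#) × (δ (suc (suc zero)) ≈ 0# × δ (suc (suc (suc zero))) ≈ 0#)
      zeros = ind (δ zero) (δ (suc zero)) (δ (suc (suc zero))) (δ (suc (suc (suc zero))))
        (λ i → ≈-trans (≈-sym (four-linear 1# -1# _ _ _ _ _ _ _ _ (u i) (w i) (x i) (z i))) (difference′ (h i)))

    step : Fin (q ^ 4) → Fin (q ^ 4)
    step k = encode (combination (decode k))

    step-injective : ∀ {k k′} → step k ≡ step k′ → k ≡ k′
    step-injective {k} {k′} h = trans (sym (encode-decode 4 k))
      (trans (encode-cong (combination-injective {decode k} {decode k′} (encode-injective h))) (encode-decode 4 k′))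

    opaque
      spanning : ∀ v → ∃ λ t → v ≋ combination t
      spanning v = let (k , h) = injective⇒surjective step step-injective (encode v) in decode k , λ i → ≈-sym (encode-injective {u = combination (decode k)} {v = v} h i)

  -- For a unit vector `z` on which `f` does not vanish, u, w, x and z are independent and span. A
  -- form that kills the first three is determined by its value at `z`; so coordinate `i` of either
  -- form is the same multiple of its coordinate `j`.
  common-form : ∀ {u w x f g} → LinIndep2 u w → ¬ InSpan u w x → NonZeroᵛ f →
                ⟨ f , u ⟩ ≈ 0# → ⟨ f , w ⟩ ≈ 0# → ⟨ f , x ⟩ ≈ 0# → ⟨ g , u ⟩ ≈ 0# → ⟨ g , w ⟩ ≈ 0# → ⟨ g , x ⟩ ≈ 0# → Proportional f g
  common-form {u} {w} {x} {f} {g} ind x∉ nz fu fw fx gu gw gx with nonzero-coordinate nz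
  ... | j , fj = g j ⊗ fj⁻¹ , ratio
    where
    open ≈R
    z = unit j
    fz≉0 : ¬ (⟨ f , z ⟩ ≈ 0#)
    fz≉0 h = fj (≈-trans (≈-sym (dot-unit f j)) h)
    fj⁻¹ = proj₁ (inverse (f j) fj)
    inv = proj₂ (inverse (f j) fj)
    evaluate : ∀ {h : V} {a b c d} → ⟨ h , u ⟩ ≈ 0# → ⟨ h , w ⟩ ≈ 0# → ⟨ h , x ⟩ ≈ 0# →
               ⟨ h , (λ i → 1# ⊗ comb a b u w i ⊕ 1# ⊗ comb c d x z i) ⟩ ≈ d ⊗ ⟨ h , z ⟩
    evaluate {h} {a} {b} {c} {d} hu hw hx = begin
      ⟨ h , comb 1# 1# (comb a b u w) (comb c d x z) ⟩      ≈⟨ dot-comb h 1# 1# (comb a b u w) (comb c d x z) ⟩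
      1# ⊗ ⟨ h , comb a b u w ⟩ ⊕ 1# ⊗ ⟨ h , comb c d x z ⟩      ≈⟨ 0+ (*0 (dot-span h u w hu hw (a , b , λ i → ≈-refl))) ⟩
      1# ⊗ ⟨ h , comb c d x z ⟩      ≈⟨ ⊗-identityˡ _ ⟩
      ⟨ h , comb c d x z ⟩      ≈⟨ dot-comb h c d x z ⟩
      c ⊗ ⟨ h , x ⟩ ⊕ d ⊗ ⟨ h , z ⟩      ≈⟨ 0+ (*0 hx) ⟩
      d ⊗ ⟨ h , z ⟩      ∎
    ones : ∀ {x y} → x ⊕ y ≈ 1# ⊗ x ⊕ 1# ⊗ y
    ones = ⊕-cong (≈-sym (⊗-identityˡ _)) (≈-sym (⊗-identityˡ _))
    ind₄ : ∀ a b c d → (∀ i → comb a b u w i ⊕ comb c d x z i ≈ 0#) → (a ≈ 0# × b ≈ 0#) × (c ≈ 0# × d ≈ 0#)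
    ind₄ a b c d h = ind a b (λ i → ≈-trans (≈-sym (+0 (≈-trans (+0 (0* d≈0)) (0* c≈0)))) (h i)) , c≈0 , d≈0
      where
      d≈0 : d ≈ 0#
      d≈0 = ⊗-cancel fz≉0 (≈-trans (⊗-comm _ _) (≈-trans (≈-sym (evaluate {f} {a} {b} {c} {d} fu fw fx))
              (≈-trans (dot-cong f (λ i → ≈-trans (≈-sym ones) (≈-trans (h i) (≈-sym (⊗-zeroˡ 0#))))) (dot-scale f (λ _ → 0#) {s = 0#} zero-dot (λ i → ≈-refl)))))
        where
        zero-dot : ⟨ f , (λ _ → 0#) ⟩ ≈ 0#
        zero-dot = ≈-trans (+0 (⊗-zeroʳ _)) (≈-trans (+0 (⊗-zeroʳ _)) (≈-trans (+0 (⊗-zeroʳ _)) (⊗-zeroʳ _)))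
      reduced : ∀ i → comb a b u w i ⊕ c ⊗ x i ≈ 0#
      reduced i = ≈-trans (⊕-cong ≈-refl (≈-sym (+0 (0* d≈0)))) (h i)
      c≈0 : c ≈ 0#
      c≈0 with c ≟ᶠ 0#
      ... | yes e = e
      ... | no c≉0 = let (r , solve) = solve-for c≉0 in
            ⊥-elim (x∉ (span-proportional (a , b , λ i → ≈-refl) (r , λ i → solve (reduced i))))
    ratio : ∀ i → g i ≈ (g j ⊗ fj⁻¹) ⊗ f i
    ratio i = let (t , h) = Spanning.spanning u w x z ind₄ (unit i) in ratio′ i t h
      where
      ratio′ : ∀ i t → unit i ≋ Spanning.combination u w x z ind₄ t → g i ≈ (g j ⊗ fj⁻¹) ⊗ f i
      ratio′ i t h = begin
        g i      ≈⟨ value g gu gw gx ⟩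
        d ⊗ g j      ≈⟨ ⊗-cong ≈-refl (≈-trans (⊗-identityʳ (g j)) ≈-refl) ⟨
        d ⊗ (g j ⊗ 1#)      ≈⟨ rotate d (g j) 1# ⟩
        g j ⊗ (d ⊗ 1#)      ≈⟨ ⊗-cong ≈-refl (⊗-cong ≈-refl (≈-trans (≈-sym inv) (⊗-comm _ _))) ⟩
        g j ⊗ (d ⊗ (fj⁻¹ ⊗ f j))      ≈⟨ ⊗-cong ≈-refl (rotate d fj⁻¹ (f j)) ⟩
        g j ⊗ (fj⁻¹ ⊗ (d ⊗ f j))      ≈⟨ ⊗-assoc (g j) fj⁻¹ (d ⊗ f j) ⟨
        (g j ⊗ fj⁻¹) ⊗ (d ⊗ f j)      ≈⟨ ⊗-cong ≈-refl (value f fu fw fx) ⟨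
        (g j ⊗ fj⁻¹) ⊗ f i      ∎
        where
        a = t zero
        b = t (suc zero)
        c′ = t (suc (suc zero))
        d = t (suc (suc (suc zero)))
        value : ∀ (k : V) → ⟨ k , u ⟩ ≈ 0# → ⟨ k , w ⟩ ≈ 0# → ⟨ k , x ⟩ ≈ 0# → k i ≈ d ⊗ k j
        value k ku kw kx = begin
          k i      ≈⟨ dot-unit k i ⟨
          ⟨ k , unit i ⟩      ≈⟨ dot-cong k (λ n → ≈-trans (h n) ones) ⟩
          ⟨ k , (λ i → 1# ⊗ comb a b u w i ⊕ 1# ⊗ comb c′ d x z i) ⟩    ≈⟨ evaluate {k} {a} {b} {c′} {d} ku kw kx ⟩
          d ⊗ ⟨ k , z ⟩      ≈⟨ ⊗-cong ≈-refl (dot-unit k j) ⟩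
          d ⊗ k j      ∎

-- PG(3,q) as a geometry

record Indexed {a r} (X : Set a) (_~_ : X → X → Set r) : Set (a ⊔ˡ r) where
  field
    size      : ℕ
    rep      : Fin size → X
    index      : X → Fin size
    rep-index     : ∀ x → x ~ rep (index x)
    rep-injective : ∀ {i j} → rep i ~ rep j → i ≡ j

module _ {a r} {X : Set a} {_~_ : X → X → Set r} (~-refl : ∀ {x} → x ~ x) (~-sym : ∀ {x y} → x ~ y → y ~ x)
         (~-trans : ∀ {x y z} → x ~ y → y ~ z → x ~ z) (_~?_ : ∀ x y → Dec (x ~ y)) where

  transversal : ∀ {N} (e : Fin N → Maybe X) → ∃₂ λ n (f : Fin n → X) →
                (∀ {i j} → f i ~ f j → i ≡ j) × (∀ k y → e k ≡ just y → ∃ λ i → y ~ f i)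
  transversal {zero} e = 0 , (λ ()) , (λ {}) , λ ()
  transversal {suc N} e with e zero in eq | transversal (e ∘ suc)
  ... | nothing | n , f , inj , sur = n , f , inj , λ { zero y h → case trans (sym eq) h of λ () ; (suc k) y h → sur k y h }
  ... | just x | n , f , inj , sur with Fin.any? (λ i → x ~? f i)
  ... | yes (i , x~) = n , f , inj , λ { zero y h → i , subst (_~ f i) (just-inj (trans (sym eq) h)) x~ ; (suc k) y h → sur k y h }
    where
    just-inj : ∀ {x y : X} → just x ≡ just y → x ≡ y
    just-inj refl = refl
  ... | no new = suc n , g , g-inj , λ { zero y h → zero , subst (_~ x) (just-inj (trans (sym eq) h)) ~-refl
                                       ; (suc k) y h → let (i , p) = sur k y h in suc i , p }
    where
    just-inj : ∀ {x y : X} → just x ≡ just y → x ≡ y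
    just-inj refl = refl
    g : Fin (suc n) → X
    g zero = x
    g (suc i) = f i
    g-inj : ∀ {i j} → g i ~ g j → i ≡ j
    g-inj {zero}  {zero}  _ = refl
    g-inj {zero}  {suc j} h = ⊥-elim (new (j , h))
    g-inj {suc i} {zero}  h = ⊥-elim (new (i , ~-sym h))
    g-inj {suc i} {suc j} h = cong suc (inj h)

  indexed : ∀ {N} (e : Fin N → Maybe X) → (∀ x → ∃₂ λ k y → e k ≡ just y × x ~ y) → Indexed X _~_
  indexed e sur with transversal e
  ... | n , f , inj , all = record
    { size = n ; rep = f ; rep-injective = inj
    ; index = λ x → let (k , y , eq , _) = sur x in proj₁ (all k y eq)
    ; rep-index = λ x → let (k , y , eq , x~y) = sur x in ~-trans x~y (proj₂ (all k y eq)) }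

module Coordinates {c ℓ} (R : CommutativeRing c ℓ) {q : ℕ} (F : IsFiniteFieldOfOrder R q) (1<q : 1 < q) where
  open CommutativeRing R using (Carrier; _≈_; 0#; 1#)
    renaming (zeroˡ to ⊗-zeroˡ; zeroʳ to ⊗-zeroʳ; *-identityˡ to ⊗-identityˡ; *-identityʳ to ⊗-identityʳ;
              *-assoc to ⊗-assoc; *-comm to ⊗-comm; _+_ to _⊕_; _*_ to _⊗_; -_ to ⊖_; refl to ≈-refl; sym to ≈-sym; trans to ≈-trans;
              +-cong to ⊕-cong; *-cong to ⊗-cong)
  open IsFiniteFieldOfOrder F renaming (_≟_ to _≟ᶠ_)
  open PG3 R renaming (NonZero to NonZeroᵛ)
  open Linear R F 1<q

  NonZeroVector : Set (c ⊔ˡ ℓ)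
  NonZeroVector = ∃ λ (v : V) → NonZeroᵛ v

  _∼_ : NonZeroVector → NonZeroVector → Set (c ⊔ˡ ℓ)
  v ∼ w = Proportional (proj₁ v) (proj₁ w)

  -- One system of representatives serves both for points and for planes, a plane being its linear
  -- form up to scalars.
  opaque
    vectors : Indexed NonZeroVector _∼_
    vectors = indexed (λ {x} → proportional-refl {proj₁ x}) (λ {x} {y} → proportional-sym {proj₁ x} (proj₂ y)) proportional-trans
        (λ v w → proportional? (proj₁ v) (proj₁ w)) candidate complete
      where
      candidate : Fin (q ^ 4) → Maybe NonZeroVector
      candidate k with nonzero? (decode k)
      ... | yes nz = just (decode k , nz)
      ... | no _ = nothing
      complete : ∀ x → ∃₂ λ k y → candidate k ≡ just y × x ∼ y
      complete (v , nz) = encode v , found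
        where
        found : ∃ λ y → candidate (encode v) ≡ just y × (v , nz) ∼ y
        found with nonzero? (decode (encode v))
        ... | yes nz′ = _ , refl , 1# , λ i → ≈-trans (decode-encode v i) (≈-sym (⊗-identityˡ _))
        ... | no z = ⊥-elim (z (λ h → nz (λ i → ≈-trans (≈-sym (decode-encode v i)) (h i))))

  ≈L-refl : ∀ {l} → l ≈L l
  ≈L-refl = (span-left , span-right) , (span-left , span-right)

  ≈L-sym : ∀ {l m} → l ≈L m → m ≈L l
  ≈L-sym (a , b) = b , a

  ≈L-trans : ∀ {l m n} → l ≈L m → m ≈L n → l ≈L n
  ≈L-trans ((a , b) , (c , d)) ((a′ , b′) , (c′ , d′)) =
    (span-trans a b a′ , span-trans a b b′) , (span-trans c′ d′ c , span-trans c′ d′ d)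

  _≈L?_ : ∀ l m → Dec (l ≈L m)
  l ≈L? m = (in-span? _ _ _ ×-dec in-span? _ _ _) ×-dec (in-span? _ _ _ ×-dec in-span? _ _ _)

  same-span : ∀ {u w u′ w′} → u ≋ u′ → w ≋ w′ → InSpan u′ w′ u × InSpan u′ w′ w
  same-span h k = span-proportional span-left (1# , λ i → ≈-trans (h i) (≈-sym (⊗-identityˡ _)))
                , span-proportional span-right (1# , λ i → ≈-trans (k i) (≈-sym (⊗-identityˡ _)))

  opaque
    lines : Indexed Line _≈L_
    lines = indexed (λ {l} → ≈L-refl {l}) (λ {l} {m} → ≈L-sym {l} {m}) (λ {l} {m} {n} → ≈L-trans {l} {m} {n}) _≈L?_ candidate complete
      where
      from : ∀ {u w} → Dec (LinIndep2 u w) → Maybe Line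
      from (yes ind) = just (mkLine _ _ ind)
      from (no _)    = nothing
      candidate : Fin ((q ^ 4) * (q ^ 4)) → Maybe Line
      candidate k = from (independent? (decode (Fin.quotient (q ^ 4) k)) (decode (Fin.remainder {q ^ 4} (q ^ 4) k)))
      complete : ∀ l → ∃₂ λ k y → candidate k ≡ just y × l ≈L y
      complete (mkLine u w ind) = k , found
        where
        k : Fin ((q ^ 4) * (q ^ 4))
        k = Fin.combine (encode u) (encode w)
        pick : ∀ {u′ w′} (d : Dec (LinIndep2 u′ w′)) → u ≋ u′ → w ≋ w′ → ∃ λ y → from d ≡ just y × mkLine u w ind ≈L y
        pick (yes ind′) hu hw = _ , refl , same-span (λ i → ≈-sym (hu i)) (λ i → ≈-sym (hw i)) , same-span hu hw
        pick (no dep) hu hw = ⊥-elim (dep (λ s t h → ind s t (λ i → ≈-trans (⊕-cong (⊗-cong ≈-refl (hu i)) (⊗-cong ≈-refl (hw i))) (h i))))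
        found : ∃ λ y → candidate k ≡ just y × mkLine u w ind ≈L y
        found = pick (independent? _ _)
          (λ i → ≈-sym (subst (λ z → decode z i ≈ u i) (sym (cong proj₁ (Fin.remQuot-combine (encode u) (encode w)))) (decode-encode u i)))
          (λ i → ≈-sym (subst (λ z → decode z i ≈ w i) (sym (cong proj₂ (Fin.remQuot-combine (encode u) (encode w)))) (decode-encode w i)))

  module V′ = Indexed vectors
  module L′ = Indexed lines

  n = V′.size

  vec : Fin n → V
  vec i = proj₁ (V′.rep i)

  vec-nonzero : ∀ i → NonZeroᵛ (vec i)
  vec-nonzero i = proj₂ (V′.rep i)

  index : ∀ v → NonZeroᵛ v → Fin n
  index v nz = V′.index (v , nz)

  to-vec : ∀ v nz → Proportional v (vec (index v nz))
  to-vec v nz = V′.rep-index (v , nz)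

  from-vec : ∀ v nz → Proportional (vec (index v nz)) v
  from-vec v nz = proportional-sym (vec-nonzero (index v nz)) (to-vec v nz)

  vec-injective : ∀ {x y} → Proportional (vec x) (vec y) → x ≡ y
  vec-injective = V′.rep-injective

  u′ w′ : Fin L′.size → V
  u′ l = Line.u (L′.rep l)
  w′ l = Line.w (L′.rep l)

  ind′ : ∀ l → LinIndep2 (u′ l) (w′ l)
  ind′ l = Line.ind (L′.rep l)

  opaque
    pl : Fin n → Fin L′.size → Bool
    pl x l = ⌊ in-span? (u′ l) (w′ l) (vec x) ⌋

    pl⇒ : ∀ {x l} → pl x l ≡ true → InSpan (u′ l) (w′ l) (vec x)
    pl⇒ {x} {l} = does-elim (in-span? (u′ l) (w′ l) (vec x))

    pl⇐ : ∀ {x l} → InSpan (u′ l) (w′ l) (vec x) → pl x l ≡ true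
    pl⇐ {x} {l} = does-true (in-span? (u′ l) (w′ l) (vec x))

    le : Fin n → Fin L′.size → Bool
    le e l = ⌊ (⟨ vec e , u′ l ⟩ ≟ᶠ 0#) ×-dec (⟨ vec e , w′ l ⟩ ≟ᶠ 0#) ⌋

    le⇒ : ∀ {e l} → le e l ≡ true → (⟨ vec e , u′ l ⟩ ≈ 0#) × (⟨ vec e , w′ l ⟩ ≈ 0#)
    le⇒ {e} {l} = does-elim ((⟨ vec e , u′ l ⟩ ≟ᶠ 0#) ×-dec (⟨ vec e , w′ l ⟩ ≟ᶠ 0#))

    le⇐ : ∀ {e l} → (⟨ vec e , u′ l ⟩ ≈ 0#) × (⟨ vec e , w′ l ⟩ ≈ 0#) → le e l ≡ true
    le⇐ {e} {l} = does-true ((⟨ vec e , u′ l ⟩ ≟ᶠ 0#) ×-dec (⟨ vec e , w′ l ⟩ ≟ᶠ 0#))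

    pe : Fin n → Fin n → Bool
    pe x e = ⌊ ⟨ vec e , vec x ⟩ ≟ᶠ 0# ⌋

    pe⇒ : ∀ {x e} → pe x e ≡ true → ⟨ vec e , vec x ⟩ ≈ 0#
    pe⇒ {x} {e} = does-elim (⟨ vec e , vec x ⟩ ≟ᶠ 0#)

    pe⇐ : ∀ {x e} → ⟨ vec e , vec x ⟩ ≈ 0# → pe x e ≡ true
    pe⇐ {x} {e} = does-true (⟨ vec e , vec x ⟩ ≟ᶠ 0#)

  line-index : Line → Fin L′.size
  line-index = L′.index

  span-to : ∀ m {v} → InSpan (Line.u m) (Line.w m) v → InSpan (u′ (line-index m)) (w′ (line-index m)) v
  span-to m h = let ((_ , _) , (a , b)) = L′.rep-index m in span-trans a b h

  span-from : ∀ m {v} → InSpan (u′ (line-index m)) (w′ (line-index m)) v → InSpan (Line.u m) (Line.w m) v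
  span-from m h = let ((a , b) , _) = L′.rep-index m in span-trans a b h

  kills-to : ∀ m f → ⟨ f , Line.u m ⟩ ≈ 0# → ⟨ f , Line.w m ⟩ ≈ 0# →
             (⟨ f , u′ (line-index m) ⟩ ≈ 0#) × (⟨ f , w′ (line-index m) ⟩ ≈ 0#)
  kills-to m f fu fw = let ((a , b) , _) = L′.rep-index m in dot-span f _ _ fu fw a , dot-span f _ _ fu fw b

  kills-from : ∀ m f → (⟨ f , u′ (line-index m) ⟩ ≈ 0#) × (⟨ f , w′ (line-index m) ⟩ ≈ 0#) → (⟨ f , Line.u m ⟩ ≈ 0#) × (⟨ f , Line.w m ⟩ ≈ 0#)
  kills-from m f (fu , fw) = let (_ , (a , b)) = L′.rep-index m in dot-span f _ _ fu fw a , dot-span f _ _ fu fw b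

  distinct⇒independent : ∀ {x y} → x ≢ y → LinIndep2 (vec x) (vec y)
  distinct⇒independent x≢y = independent (vec-nonzero _) (λ p → x≢y (vec-injective p))

  -- If `x` were outside the span, `common-form` would make `f` and `g` proportional. Vectors and
  -- forms have the same type, so the statement also serves with their roles exchanged, as in
  -- `#planes-on`.
  in-both : ∀ {u w x f g} → LinIndep2 u w → NonZeroᵛ f → ¬ Proportional f g →
            (⟨ f , u ⟩ ≈ 0#) × (⟨ f , w ⟩ ≈ 0#) → (⟨ g , u ⟩ ≈ 0#) × (⟨ g , w ⟩ ≈ 0#) → ⟨ f , x ⟩ ≈ 0# → ⟨ g , x ⟩ ≈ 0# → InSpan u w x
  in-both {u} {w} {x} {f} {g} ind nz np (fu , fw) (gu , gw) fx gx =
    decidable-stable (in-span? u w x) (λ x∉ → np (common-form {u} {w} {x} {f} {g} ind x∉ nz fu fw fx gu gw gx))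

  dot-scaleˡ : ∀ f g v → Proportional f g → ⟨ f , v ⟩ ≈ 0# → ⟨ g , v ⟩ ≈ 0#
  dot-scaleˡ f g v (s , h) fv = ≈-trans (dot-comm g v) (dot-scale v f (≈-trans (dot-comm v f) fv) h)

  dot-scaleʳ : ∀ f u v → Proportional u v → ⟨ f , u ⟩ ≈ 0# → ⟨ f , v ⟩ ≈ 0#
  dot-scaleʳ f u v (s , h) fu = dot-scale f u fu h

  flip-zero : ∀ f v → ⟨ f , v ⟩ ≈ 0# → ⟨ v , f ⟩ ≈ 0#
  flip-zero f v h = ≈-trans (dot-comm v f) h

  -- The points of the span are represented by u and by tu + w for t in the field. This counts the
  -- points on a line and, for a basis of its annihilator, the planes on it.
  module PencilCount (u w : V) (ind : LinIndep2 u w) (E : Fin n → Bool)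
    (E⇒ : ∀ {x} → E x ≡ true → InSpan u w (vec x)) (E⇐ : ∀ {x} → InSpan u w (vec x) → E x ≡ true) where

    coefficients : ∀ {a b a′ b′} → comb a b u w ≋ comb a′ b′ u w → a ≈ a′ × b ≈ b′
    coefficients {a} {b} {a′} {b′} h = let (p , r) = ind (1# ⊗ a ⊕ -1# ⊗ a′) (1# ⊗ b ⊕ -1# ⊗ b′)
                                              (λ i → ≈-trans (≈-sym (Identities.recombine R 1# -1# a b a′ b′ (u i) (w i))) (difference′ (h i)))
                                       in difference p , difference r

    first second : Fin (suc q) → Carrier
    first zero    = 1#
    first (suc i) = enum i
    second zero    = 0#
    second (suc i) = 1#

    point : Fin (suc q) → V
    point j = comb (first j) (second j) u w

    point-nonzero : ∀ j → NonZeroᵛ (point j)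
    point-nonzero zero h = 1≉0 (proj₁ (ind _ _ h))
    point-nonzero (suc i) h = 1≉0 (proj₂ (ind _ _ h))

    place : Fin (suc q) → Fin n
    place j = index (point j) (point-nonzero j)

    scaled : ∀ {i j} → Proportional (point i) (point j) → ∃ λ r → first j ≈ r ⊗ first i × second j ≈ r ⊗ second i
    scaled {i} {j} (r , h) = r , coefficients {first j} {second j} {r ⊗ first i} {r ⊗ second i}
      (λ k → ≈-trans (h k) (≈-trans (≈-sym (+0 (⊗-zeroˡ _))) (≈-trans (Identities.recombine R r 0# (first i) (second i) 0# 0# (u k) (w k))
         (⊕-cong (⊗-cong (+0 (⊗-zeroˡ _)) ≈-refl) (⊗-cong (+0 (⊗-zeroˡ _)) ≈-refl)))))

    point-injective : ∀ i j → Proportional (point i) (point j) → i ≡ j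
    point-injective zero zero _ = refl
    point-injective zero (suc j) p = let (r , _ , h) = scaled {zero} {suc j} p in ⊥-elim (1≉0 (≈-trans h (⊗-zeroʳ r)))
    point-injective (suc i) zero p = let (r , g , h) = scaled {suc i} {zero} p in
      ⊥-elim (1≉0 (≈-trans g (0* (≈-trans (≈-sym (⊗-identityʳ r)) (≈-sym h)))))
    point-injective (suc i) (suc j) p = let (r , g , h) = scaled {suc i} {suc j} p in
      cong suc (sym (enum-inj j i (≈-trans g (≈-trans (⊗-cong (≈-trans (≈-sym (⊗-identityʳ r)) (≈-sym h)) ≈-refl) (⊗-identityˡ _)))))

    place-eq : ∀ j {x} → Proportional (point j) (vec x) → x ≡ place j
    place-eq j {x} p = vec-injective (proportional-trans (proportional-sym (vec-nonzero x) p) (to-vec (point j) (point-nonzero j)))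

    place-injective : ∀ {i j} → place i ≡ place j → i ≡ j
    place-injective {i} {j} eq = point-injective i j (proportional-trans (to-vec (point i) (point-nonzero i))
      (subst (λ x → Proportional (vec x) (point j)) (sym eq) (from-vec (point j) (point-nonzero j))))

    located : ∀ {x} → InSpan u w (vec x) → ∃ λ j → x ≡ place j
    located {x} (s , t , h) with t ≟ᶠ 0#
    ... | yes t≈0 = zero , place-eq zero {x} (s , λ i → ≈-trans (h i) (≈-trans (+0 (0* t≈0))
            (⊗-cong ≈-refl (≈-sym (≈-trans (+0 (⊗-zeroˡ _)) (⊗-identityˡ _))))))
    ... | no t≉0 = suc (code r) , place-eq (suc (code r)) {x} (t , λ i → ≈-trans (h i)
            (≈-sym (≈-trans (≈-sym (+0 (⊗-zeroˡ _))) (≈-trans (Identities.recombine R t 0# (enum (code r)) 1# 0# 0# (u i) (w i))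
              (⊕-cong (⊗-cong (≈-trans (+0 (⊗-zeroˡ _)) tr) ≈-refl) (⊗-cong (≈-trans (+0 (⊗-zeroˡ _)) (⊗-identityʳ t)) ≈-refl))))))
      where
      t⁻¹ = proj₁ (inverse t t≉0)
      r = t⁻¹ ⊗ s
      tr : t ⊗ enum (code r) ≈ s
      tr = ≈-trans (⊗-cong ≈-refl (enum-code r)) (≈-trans (≈-sym (⊗-assoc t t⁻¹ s)) (≈-trans (⊗-cong (proj₂ (inverse t t≉0)) ≈-refl) (⊗-identityˡ s)))

    count : # E ≡ suc q
    count = ≤-antisym
      (≤-trans (matching E (λ (_ : Fin (suc q)) → true) (λ x j → x == place j)
         (λ x Ex → let (j , eq) = located (E⇒ Ex) in j , refl , ==-refl eq)
         (λ x y j _ _ _ h k → trans (==-elim x (place j) h) (sym (==-elim y (place j) k)))) (≤-reflexive (#-all (suc q))))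
      (≤-trans (≤-reflexive (sym (#-all (suc q)))) (matching (λ (_ : Fin (suc q)) → true) E (λ j x → x == place j)
         (λ j _ → place j , E⇐ (span-proportional (first j , second j , λ i → ≈-refl) (to-vec (point j) (point-nonzero j))) , ==-refl refl)
         (λ i j x _ _ _ h k → place-injective (trans (sym (==-elim x (place i) h)) (==-elim x (place j) k)))))

  #points-on : ∀ l → # (λ x → pl x l) ≡ suc q
  #points-on l = PencilCount.count (u′ l) (w′ l) (ind′ l) (λ x → pl x l) (λ {x} → pl⇒ {x} {l}) (λ {x} → pl⇐ {x} {l})

  #planes-on : ∀ l → # (λ e → le e l) ≡ suc q
  #planes-on l =
    let (f , g , ind , (uf , wf) , (ug , wg)) = kernel-pair (u′ l) (w′ l)
        nz = independent⇒nonzeroˡ (ind′ l)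
        np = independent⇒¬proportional (ind′ l)
    in PencilCount.count f g ind (λ e → le e l)
      (λ {e} h → let (eu , ew) = le⇒ {e} {l} h in
         in-both {f} {g} {vec e} {u′ l} {w′ l} ind nz np (uf , ug) (wf , wg) (flip-zero (vec e) (u′ l) eu) (flip-zero (vec e) (w′ l) ew))
      (λ {e} h → le⇐ {e} {l} (flip-zero (u′ l) (vec e) (dot-span (u′ l) f g uf ug h) , flip-zero (w′ l) (vec e) (dot-span (w′ l) f g wf wg h)))

  opaque
    join : ∀ x y → ∃ λ l → pl x l ≡ true × pl y l ≡ true
    join x y with x Fin.≟ y
    ... | yes refl = let (w , ind) = complement (vec-nonzero x) ; m = mkLine (vec x) w ind in
          line-index m , pl⇐ (span-to m span-left) , pl⇐ (span-to m span-left)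
    ... | no x≢y = let m = mkLine (vec x) (vec y) (distinct⇒independent x≢y) in
          line-index m , pl⇐ (span-to m span-left) , pl⇐ (span-to m span-right)

    meet : ∀ e f → ∃ λ l → le e l ≡ true × le f l ≡ true
    meet e f = let (u , w , ind , (eu , fu) , (ew , fw)) = kernel-pair (vec e) (vec f) ; m = mkLine u w ind in
      line-index m , le⇐ (kills-to m (vec e) eu ew) , le⇐ (kills-to m (vec f) fu fw)

    zero-on-line : ∀ f {u w} → LinIndep2 u w → ∃ λ v → NonZeroᵛ v × InSpan u w v × ⟨ f , v ⟩ ≈ 0#
    zero-on-line f {u} {w} ind with ⟨ f , u ⟩ ≟ᶠ 0#
    ... | yes fu = u , independent⇒nonzeroˡ ind , span-left , fu
    -- The vector ⟨f, w⟩u - ⟨f, u⟩w is killed by `f`, and it is nonzero because its second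
    -- coefficient is.
    ... | no fu≉0 = comb ⟨ f , w ⟩ (⊖ ⟨ f , u ⟩) u w
          , (λ h → fu≉0 (difference {⟨ f , u ⟩} {0#} (≈-trans (+0 (⊗-zeroʳ _)) (≈-trans (⊗-identityˡ _) (⊖-zero (proj₂ (ind _ _ h)))))))
          , (_ , _ , λ i → ≈-refl) , ≈-trans (dot-comb f _ _ u w) (cancels ⟨ f , u ⟩ ⟨ f , w ⟩)
      where
      ⊖-zero : ∀ {x} → ⊖ x ≈ 0# → x ≈ 0#
      ⊖-zero {x} h = ≈-trans (≈-sym (+0 h)) (CommutativeRing.-‿inverseʳ R x)

    cut : ∀ e l → ∃ λ x → pl x l ≡ true × pe x e ≡ true
    cut e l = let (v , nz , inspan , ev) = zero-on-line (vec e) (ind′ l) in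
      index v nz , pl⇐ (span-proportional inspan (to-vec v nz)) , pe⇐ (dot-scaleʳ (vec e) v (vec (index v nz)) (to-vec v nz) ev)

    span : ∀ x l → ∃ λ e → le e l ≡ true × pe x e ≡ true
    span x l = let (f , nz , xf , uf , wf) = kernel-triple (vec x) (u′ l) (w′ l) in
      index f nz , le⇐ (dot-scaleˡ f (vec (index f nz)) (u′ l) (to-vec f nz) (flip-zero (u′ l) f uf) ,
                        dot-scaleˡ f (vec (index f nz)) (w′ l) (to-vec f nz) (flip-zero (w′ l) f wf))
                 , pe⇐ (dot-scaleˡ f (vec (index f nz)) (vec x) (to-vec f nz) (flip-zero (vec x) f xf))

    lines-equal : ∀ {l m} → InSpan (u′ m) (w′ m) (u′ l) × InSpan (u′ m) (w′ m) (w′ l) →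
                  InSpan (u′ l) (w′ l) (u′ m) × InSpan (u′ l) (w′ l) (w′ m) → l ≡ m
    lines-equal h k = L′.rep-injective (k , h)

    join-unique : ∀ {x y l m} → x ≢ y → pl x l ≡ true → pl y l ≡ true → pl x m ≡ true → pl y m ≡ true → l ≡ m
    join-unique {x} {y} {l} {m} x≢y xl yl xm ym =
      let ind = distinct⇒independent x≢y
          (lu , lw) = exchange ind (pl⇒ xl) (pl⇒ yl)
          (mu , mw) = exchange ind (pl⇒ xm) (pl⇒ ym)
      in lines-equal (span-trans (pl⇒ xm) (pl⇒ ym) lu , span-trans (pl⇒ xm) (pl⇒ ym) lw)
                     (span-trans (pl⇒ xl) (pl⇒ yl) mu , span-trans (pl⇒ xl) (pl⇒ yl) mw)

    on-both : ∀ {e f l v} → e ≢ f → le e l ≡ true → le f l ≡ true → ⟨ vec e , v ⟩ ≈ 0# → ⟨ vec f , v ⟩ ≈ 0# → InSpan (u′ l) (w′ l) v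
    on-both {e} {f} {l} {v} e≢f el fl ev fv =
      in-both {x = v} {vec e} {vec f} (ind′ l) (vec-nonzero e) (λ p → e≢f (vec-injective p)) (le⇒ el) (le⇒ fl) ev fv

    meet-unique : ∀ {e f l m} → e ≢ f → le e l ≡ true → le f l ≡ true → le e m ≡ true → le f m ≡ true → l ≡ m
    meet-unique e≢f el fl em fm =
      lines-equal (on-both e≢f em fm (proj₁ (le⇒ el)) (proj₁ (le⇒ fl)) , on-both e≢f em fm (proj₂ (le⇒ el)) (proj₂ (le⇒ fl)))
                  (on-both e≢f el fl (proj₁ (le⇒ em)) (proj₁ (le⇒ fm)) , on-both e≢f el fl (proj₂ (le⇒ em)) (proj₂ (le⇒ fm)))

    flag : ∀ {x l e} → pl x l ≡ true → le e l ≡ true → pe x e ≡ true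
    flag {x} {l} {e} xl el = pe⇐ (dot-span (vec e) (u′ l) (w′ l) (proj₁ (le⇒ el)) (proj₂ (le⇒ el)) (pl⇒ xl))

    line⊆ : ∀ {x y l e} → x ≢ y → pl x l ≡ true → pl y l ≡ true → pe x e ≡ true → pe y e ≡ true → le e l ≡ true
    line⊆ {x} {y} {l} {e} x≢y xl yl xe ye =
      let (lu , lw) = exchange (distinct⇒independent x≢y) (pl⇒ xl) (pl⇒ yl)
      in le⇐ (dot-span (vec e) (vec x) (vec y) (pe⇒ xe) (pe⇒ ye) lu , dot-span (vec e) (vec x) (vec y) (pe⇒ xe) (pe⇒ ye) lw)

    line∋ : ∀ {e f l x} → e ≢ f → le e l ≡ true → le f l ≡ true → pe x e ≡ true → pe x f ≡ true → pl x l ≡ true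
    line∋ e≢f el fl xe xf = pl⇐ (on-both e≢f el fl (pe⇒ xe) (pe⇒ xf))

    false-unless : ∀ {b} → ¬ (b ≡ true) → b ≡ false
    false-unless {true}  h = ⊥-elim (h refl)
    false-unless {false} h = refl

    off-plane : ∀ e → ∃ λ x → pe x e ≡ false
    off-plane e = let (i , ei) = nonzero-coordinate (vec-nonzero e) ; x = index (unit i) (unit-nonzero i) in
      x , false-unless (λ h → ei (≈-trans (≈-sym (dot-unit (vec e) i))
            (dot-scaleʳ (vec e) (vec x) (unit i) (from-vec (unit i) (unit-nonzero i)) (pe⇒ h))))

    off-point : ∀ x → ∃ λ e → pe x e ≡ false
    off-point x = let (i , xi) = nonzero-coordinate (vec-nonzero x) ; e = index (unit i) (unit-nonzero i) in
      e , false-unless (λ h → xi (≈-trans (≈-sym (dot-unit (vec x) i)) (flip-zero (unit i) (vec x)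
            (dot-scaleˡ (vec e) (unit i) (vec x) (from-vec (unit i) (unit-nonzero i)) (pe⇒ h)))))

  geometry : Geometry q
  geometry = record
    { nP = n ; nL = L′.size ; nE = n ; pl = pl ; le = le ; pe = pe
    ; join = join ; meet = meet ; cut = cut ; span = span
    ; join-unique = join-unique ; meet-unique = meet-unique ; flag = flag ; line⊆ = line⊆ ; line∋ = line∋
    ; #points-on = #points-on ; #planes-on = #planes-on ; off-plane = off-plane ; off-point = off-point
    ; a-point = index (unit zero) (unit-nonzero zero) ; a-plane = index (unit zero) (unit-nonzero zero)
    ; 1≤q = <⇒≤ 1<q }

-- Lists of chambers

module Translation {c ℓ} (R : CommutativeRing c ℓ) {q : ℕ} (F : IsFiniteFieldOfOrder R q) (1<q : 1 < q) where
  open PG3 R renaming (NonZero to NonZeroᵛ)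
  open Linear R F 1<q
  open Coordinates R F 1<q
  open Incidence geometry using (Meet; meets-intro; meets-elim; meets; coplanar⇒Meet)
  module CS = ChamberSets geometry
  open CS using (ChSet; card; _⊆_)

  point-index : Point → Fin n
  point-index P = index (Point.vec P) (Point.nz P)

  plane-index : Plane → Fin n
  plane-index π = index (Plane.form π) (Plane.nz π)

  pl-to : ∀ {P l} → P I-PL l → pl (point-index P) (line-index l) ≡ true
  pl-to {P} {l} h = pl⇐ (span-to l (span-proportional h (to-vec (Point.vec P) (Point.nz P))))

  pl-from : ∀ {P l} → pl (point-index P) (line-index l) ≡ true → P I-PL l
  pl-from {P} {l} h = span-from l (span-proportional (pl⇒ h) (from-vec (Point.vec P) (Point.nz P)))

  le-to : ∀ {l π} → l I-Lπ π → le (plane-index π) (line-index l) ≡ true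
  le-to {l} {π} (fu , fw) = le⇐ (kills-to l (vec (plane-index π))
    (dot-scaleˡ (Plane.form π) (vec (plane-index π)) (Line.u l) (to-vec _ (Plane.nz π)) fu) (dot-scaleˡ (Plane.form π) (vec (plane-index π)) (Line.w l) (to-vec _ (Plane.nz π)) fw))

  le-from : ∀ {l π} → le (plane-index π) (line-index l) ≡ true → l I-Lπ π
  le-from {l} {π} h = let (fu , fw) = kills-from l (vec (plane-index π)) (le⇒ h) in
    dot-scaleˡ (vec (plane-index π)) (Plane.form π) (Line.u l) (from-vec _ (Plane.nz π)) fu , dot-scaleˡ (vec (plane-index π)) (Plane.form π) (Line.w l) (from-vec _ (Plane.nz π)) fw

  pe-to : ∀ {P π} → P I-Pπ π → pe (point-index P) (plane-index π) ≡ true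
  pe-to {P} {π} h = pe⇐ (dot-scaleʳ (vec (plane-index π)) (Point.vec P) (vec (point-index P)) (to-vec _ (Point.nz P)) (dot-scaleˡ (Plane.form π) (vec (plane-index π)) (Point.vec P) (to-vec _ (Plane.nz π)) h))

  ptᵢ : Chamber → Fin n
  ptᵢ C = point-index (Chamber.pt C)

  lnᵢ : Chamber → Fin L′.size
  lnᵢ C = line-index (Chamber.ln C)

  plᵢ : Chamber → Fin n
  plᵢ C = plane-index (Chamber.pl C)

  on : ∀ C → pl (ptᵢ C) (lnᵢ C) ≡ true
  on C = pl-to {Chamber.pt C} {Chamber.ln C} (Chamber.pt∈ln C)

  below : ∀ C → le (plᵢ C) (lnᵢ C) ≡ true
  below C = le-to {Chamber.ln C} {Chamber.pl C} (Chamber.ln⊆pl C)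

  index-cong : ∀ {v w nz nz′} → Proportional v w → index v nz ≡ index w nz′
  index-cong {v} {w} {nz} {nz′} p = vec-injective (proportional-trans (from-vec v nz) (proportional-trans p (to-vec w nz′)))

  index-injective : ∀ {v w nz nz′} → index v nz ≡ index w nz′ → Proportional v w
  index-injective {v} {w} {nz} {nz′} eq = proportional-trans (to-vec v nz) (subst (λ z → Proportional (vec z) w) (sym eq) (from-vec w nz′))

  line-index-cong : ∀ {l m} → l ≈L m → line-index l ≡ line-index m
  line-index-cong {l} {m} h = L′.rep-injective (≈L-trans {L′.rep (line-index l)} {l} {L′.rep (line-index m)}
    (≈L-sym {l} {L′.rep (line-index l)} (L′.rep-index l)) (≈L-trans {l} {m} {L′.rep (line-index m)} h (L′.rep-index m)))

  line-index-injective : ∀ {l m} → line-index l ≡ line-index m → l ≈L m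
  line-index-injective {l} {m} eq = ≈L-trans {l} {L′.rep (line-index l)} {m} (L′.rep-index l)
    (subst (λ z → L′.rep z ≈L m) (sym eq) (≈L-sym {m} {L′.rep (line-index m)} (L′.rep-index m)))

  -- Equality of the three indices is the decidable counterpart of `_≈C_`; reflexivity and
  -- transitivity of the latter are drawn from it.
  Same : Fin n → Fin L′.size → Fin n → Chamber → Set
  Same x l e C = x ≡ ptᵢ C × l ≡ lnᵢ C × e ≡ plᵢ C

  same? : ∀ x l e C → Dec (Same x l e C)
  same? x l e C = (x Fin.≟ ptᵢ C) ×-dec ((l Fin.≟ lnᵢ C) ×-dec (e Fin.≟ plᵢ C))

  ≈C⇒same : ∀ {C D} → C ≈C D → Same (ptᵢ C) (lnᵢ C) (plᵢ C) D
  ≈C⇒same {C} {D} (p , l , e) = index-cong p , line-index-cong {Chamber.ln C} {Chamber.ln D} l , index-cong e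

  same⇒≈C : ∀ {C D} → Same (ptᵢ C) (lnᵢ C) (plᵢ C) D → C ≈C D
  same⇒≈C {C} {D} (p , l , e) = index-injective p , line-index-injective {Chamber.ln C} {Chamber.ln D} l , index-injective e

  ≈C-refl : ∀ {C} → C ≈C C
  ≈C-refl {C} = same⇒≈C {C} {C} (refl , refl , refl)

  ≈C-trans : ∀ {C D E} → C ≈C D → D ≈C E → C ≈C E
  ≈C-trans {C} {D} {E} h k = let (p , l , e) = ≈C⇒same {C} {D} h ; (p′ , l′ , e′) = ≈C⇒same {D} {E} k in
    same⇒≈C {C} {E} (trans p p′ , trans l l′ , trans e e′)

  chamber : ∀ {x l e} → pl x l ≡ true → le e l ≡ true → Chamber
  chamber {x} {l} {e} xl el = mkChamber (mkPoint (vec x) (vec-nonzero x)) (L′.rep l) (mkPlane (vec e) (vec-nonzero e)) (pl⇒ xl) (le⇒ el)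

  vec-index : ∀ x → x ≡ index (vec x) (vec-nonzero x)
  vec-index x = vec-injective (to-vec (vec x) (vec-nonzero x))

  chamber-same : ∀ {x l e} (xl : pl x l ≡ true) (el : le e l ≡ true) → Same x l e (chamber xl el)
  chamber-same {x} {l} {e} _ _ = vec-index x , L′.rep-injective (L′.rep-index (L′.rep l)) , vec-index e

  Meeting : Chamber → Chamber → Set
  Meeting C D = pe (ptᵢ C) (plᵢ D) ≡ true ⊎ (pe (ptᵢ D) (plᵢ C) ≡ true ⊎ Meet (lnᵢ C) (lnᵢ D))

  meeting⇒¬skew : ∀ {C D} → Meet (lnᵢ C) (lnᵢ D) → ¬ Skew (Chamber.ln C) (Chamber.ln D)
  meeting⇒¬skew {C} {D} (x , xl , xm) skew = skew (mkPoint (vec x) (vec-nonzero x)) (span-from (Chamber.ln C) (pl⇒ xl)) (span-from (Chamber.ln D) (pl⇒ xm))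

  ¬opposite⇒meeting : ∀ C D → ¬ Opposite C D → Meeting C D
  ¬opposite⇒meeting C D h with decide (pe (ptᵢ C) (plᵢ D)) | decide (pe (ptᵢ D) (plᵢ C)) | decide (meets (lnᵢ C) (lnᵢ D))
  ... | inj₁ p | _ | _ = inj₁ p
  ... | _ | inj₁ p | _ = inj₂ (inj₁ p)
  ... | _ | _ | inj₁ m = inj₂ (inj₂ (meets-elim m))
  ... | inj₂ a | inj₂ b | inj₂ m = ⊥-elim (h
        ( (λ p → true≢false (pe-to {Chamber.pt C} {Chamber.pl D} p) a)
        , (λ P p r → true≢false (meets-intro (point-index P , pl-to {P} {Chamber.ln C} p , pl-to {P} {Chamber.ln D} r)) m)
        , (λ p → true≢false (pe-to {Chamber.pt D} {Chamber.pl C} p) b)))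

  opaque
    members : List Chamber → ChSet
    members S x l e = ⌊ any? (same? x l e) S ⌋

    members-intro : ∀ S {x l e} → Any (Same x l e) S → members S x l e ≡ true
    members-intro S {x} {l} {e} = does-true (any? (same? x l e) S)

    members-elim : ∀ S {x l e} → members S x l e ≡ true → Any (Same x l e) S
    members-elim S {x} {l} {e} = does-elim (any? (same? x l e) S)

  in-members : ∀ S {C} → C ∈C S → members S (ptᵢ C) (lnᵢ C) (plᵢ C) ≡ true
  in-members S {C} h = members-intro S (Any.map (λ {D} → ≈C⇒same {C} {D}) h)

  same-members : ∀ S {C x l e} → Same x l e C → C ∈C S → members S x l e ≡ true
  same-members S {C} (refl , refl , refl) = in-members S {C}

  from-members : ∀ S {C} → members S (ptᵢ C) (lnᵢ C) (plᵢ C) ≡ true → C ∈C S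
  from-members S {C} h = Any.map (λ {D} → same⇒≈C {C} {D}) (members-elim S h)

  representative : ∀ S {x l e} → members S x l e ≡ true → ∃ λ C → Same x l e C × C ∈C S
  representative S {x} {l} {e} h = go S (members-elim S h)
    where
    go : ∀ S → Any (Same x l e) S → ∃ λ C → Same x l e C × C ∈C S
    go (C ∷ S) (here s) = C , s , here (≈C-refl {C})
    go (C ∷ S) (there a) = let (D , s , d) = go S a in D , s , there d

  members-chambers : ∀ S → CS.Chambers (members S)
  members-chambers S h with representative S h
  ... | C , (refl , refl , refl) , _ = on C , below C

  members-independent : ∀ S → Independent S → CS.Independent (members S)
  members-independent S ind h k with representative S h | representative S k
  ... | C , (refl , refl , refl) , c | D , (refl , refl , refl) , d = ¬opposite⇒meeting C D (ind C D c d)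

  single : Chamber → ChSet
  single C x l e = ⌊ same? x l e C ⌋

  card-single≤ : ∀ C → card (single C) ≤ 1
  card-single≤ C = ≤-trans (CS.by-lines (single C) (λ l → l == lnᵢ C) 1
      (λ {x l e} h → ==-refl (proj₁ (proj₂ (does-elim (same? x l e C) h))))
      (λ l _ → ≤-trans (CS.sum-support (λ x → # (λ e → single C x l e)) (λ x → x == ptᵢ C) 1
        (λ x _ → #-≤1 _ (λ e f h k → trans (proj₂ (proj₂ (does-elim (same? x l e C) h))) (sym (proj₂ (proj₂ (does-elim (same? x l f C) k))))))
        (λ x n → #-none _ (λ e h → true≢false (==-refl (proj₁ (does-elim (same? x l e C) h))) n)))
        (≤-reflexive (trans (*-identityʳ _) (#-single (ptᵢ C))))))
    (≤-reflexive (trans (*-identityʳ _) (#-single (lnᵢ C))))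

  1≤card-single : ∀ C → 1 ≤ card (single C)
  1≤card-single C = ≤-trans (#-≥1 (λ e → single C (ptᵢ C) (lnᵢ C) e) (plᵢ C) (does-true (same? (ptᵢ C) (lnᵢ C) (plᵢ C) C) (refl , refl , refl)))
    (≤-trans (term≤sum (λ x → # (λ e → single C x (lnᵢ C) e)) (ptᵢ C)) (term≤sum (CS.on-line (single C)) (lnᵢ C)))

  card≤length : ∀ S → card (members S) ≤ length S
  card≤length [] = ≤-trans (CS.card-mono {members []} {λ x l e → false} (λ h → case members-elim [] h of λ ()))
    (≤-reflexive (trans (sum-cong-≗ (λ l → trans (sum-cong-≗ (λ x → sum-zero n)) (sum-zero n))) (sum-zero L′.size)))
  card≤length (C ∷ S) = ≤-trans (CS.card-∪ (members (C ∷ S)) (single C) (members S) each)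
    (+-mono-≤ (card-single≤ C) (card≤length S))
    where
    each : ∀ {x l e} → members (C ∷ S) x l e ≡ true → single C x l e ≡ true ⊎ members S x l e ≡ true
    each {x} {l} {e} h with members-elim (C ∷ S) h
    ... | here s = inj₁ (does-true (same? x l e C) s)
    ... | there a = inj₂ (members-intro S a)

  -- By uniqueness the triple of the head does not occur among those of the tail, so the indicator
  -- functions add up pointwise.
  length≤card : ∀ S → UniqueC S → length S ≤ card (members S)
  length≤card [] _ = z≤n
  length≤card (C ∷ S) (new ∷ uniq) = begin
    1 + length S      ≤⟨ +-mono-≤ (1≤card-single C) (length≤card S uniq) ⟩
    card (single C) + card (members S)      ≡⟨ ∑-distrib-+ (CS.on-line (single C)) (CS.on-line (members S)) ⟨
    sum (λ l → CS.on-line (single C) l + CS.on-line (members S) l)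
      ≤⟨ sum-mono (λ l → ≤-trans (≤-reflexive (sym (∑-distrib-+ (λ x → # (single C x l)) (λ x → # (members S x l)))))
           (sum-mono (λ x → ≤-trans (≤-reflexive (sym (∑-distrib-+ (λ e → ι (single C x l e)) (λ e → ι (members S x l e)))))
             (sum-mono (λ e → each x l e))))) ⟩
    card (members (C ∷ S))      ∎
    where
    open ≤-Reasoning
    each : ∀ x l e → ι (single C x l e) + ι (members S x l e) ≤ ι (members (C ∷ S) x l e)
    each x l e with same? x l e C | decide (members S x l e)
    ... | no _ | inj₂ m rewrite m = z≤n
    ... | no _ | inj₁ m rewrite m | members-intro (C ∷ S) (there (members-elim S m)) = ≤-refl
    ... | yes s | inj₂ m rewrite m | members-intro (C ∷ S) {x} {l} {e} (here s) = ≤-refl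
    ... | yes (refl , refl , refl) | inj₁ m = ⊥-elim (All.All¬⇒¬Any new (from-members S {C} m))

  _∈C?_ : ∀ C S → Dec (C ∈C S)
  C ∈C? S = map′ (Any.map (λ {D} → same⇒≈C {C} {D})) (Any.map (λ {D} → ≈C⇒same {C} {D})) (any? (same? (ptᵢ C) (lnᵢ C) (plᵢ C)) S)

  nub : ∀ S → ∃ λ T → UniqueC T × (∀ {D} → D ∈C T → D ∈C S) × (∀ {D} → D ∈C S → D ∈C T)
  nub [] = [] , [] , (λ h → h) , (λ h → h)
  nub (C ∷ S) with nub S
  ... | T , u , f , g with C ∈C? T
  ... | yes c = T , u , (λ {D} h → there (f {D} h)) , λ { {D} (here h) → Any.map (λ {E} → ≈C-trans {D} {C} {E} h) c ; {D} (there h) → g {D} h }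
  ... | no c = C ∷ T , All.¬Any⇒All¬ T c ∷ u , (λ { (here h) → here h ; {D} (there h) → there (f {D} h) }) , (λ { (here h) → here h ; {D} (there h) → there (g {D} h) })

  opaque
    gather : ∀ {N} → (Fin N → List Chamber) → List Chamber
    gather f = concat (tabulate f)

    gather⁺ : ∀ {p N} {P : Chamber → Set p} (f : Fin N → List Chamber) i → Any P (f i) → Any P (gather f)
    gather⁺ f i h = Any.concat⁺ (Any.tabulate⁺ i h)

    gather⁻ : ∀ {p N} {P : Chamber → Set p} (f : Fin N → List Chamber) → Any P (gather f) → ∃ λ i → Any P (f i)
    gather⁻ f h = Any.tabulate⁻ (Any.concat⁻ (tabulate f) h)

  module Listing {X : ChSet} (ch : CS.Chambers X) where
    -- The Boolean is abstracted together with its equation: matching on it computes the list while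
    -- keeping the proof from which the chamber is built.
    cell : ∀ {x l e b} → X x l e ≡ b → List Chamber
    cell {b = true}  h = chamber (proj₁ (ch h)) (proj₂ (ch h)) ∷ []
    cell {b = false} _ = []

    on-line-list : ∀ x l → List Chamber
    on-line-list x l = gather (λ e → cell {x} {l} {e} refl)

    at-point-list : ∀ x → List Chamber
    at-point-list x = gather (on-line-list x)

    everything : List Chamber
    everything = gather at-point-list

    cell-complete : ∀ {x l e b} (h : X x l e ≡ b) → b ≡ true → Any (Same x l e) (cell h)
    cell-complete {b = true} h refl = here (chamber-same (proj₁ (ch h)) (proj₂ (ch h)))

    cell-sound : ∀ {C x l e b} (h : X x l e ≡ b) → C ∈C cell h → X (ptᵢ C) (lnᵢ C) (plᵢ C) ≡ true
    cell-sound {C} {x} {l} {e} {true} h (here s) =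
      let (p , r , t) = ≈C⇒same {C} {chamber (proj₁ (ch h)) (proj₂ (ch h))} s
          (p′ , r′ , t′) = chamber-same (proj₁ (ch h)) (proj₂ (ch h))
      in subst (λ z → X z (lnᵢ C) (plᵢ C) ≡ true) (trans p′ (sym p))
          (subst (λ z → X x z (plᵢ C) ≡ true) (trans r′ (sym r)) (subst (λ z → X x l z ≡ true) (trans t′ (sym t)) h))

    complete : ∀ {x l e} → X x l e ≡ true → Any (Same x l e) everything
    complete {x} {l} {e} h = gather⁺ at-point-list x (gather⁺ (on-line-list x) l (gather⁺ (λ e → cell {x} {l} {e} refl) e (cell-complete refl h)))

    sound : ∀ {C} → C ∈C everything → X (ptᵢ C) (lnᵢ C) (plᵢ C) ≡ true
    sound {C} h =
      let (x , h₁) = gather⁻ at-point-list h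
          (l , h₂) = gather⁻ (on-line-list x) h₁
          (e , h₃) = gather⁻ (λ e → cell {x} {l} {e} refl) h₂
      in cell-sound {C} {x} {l} {e} refl h₃

    listing : ∃ λ S → UniqueC S × (∀ {C} → X (ptᵢ C) (lnᵢ C) (plᵢ C) ≡ true → C ∈C S) × (∀ {C} → C ∈C S → X (ptᵢ C) (lnᵢ C) (plᵢ C) ≡ true)
    listing = let (T , u , f , g) = nub everything in
      T , u , (λ {C} h → g {C} (Any.map (λ {D} → same⇒≈C {C} {D}) (complete h))) , (λ {C} c → sound {C} (f {C} c))

-- Stars of lines and the three claims

module MainTheorem {c ℓ} (R : CommutativeRing c ℓ) {q : ℕ} (F : IsFiniteFieldOfOrder R q) (1<q : 1 < q) (43≤q : 43 ≤ q) where
  open PG3 R renaming (NonZero to NonZeroᵛ)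
  open Coordinates R F 1<q
  open Translation R F 1<q
  open Incidence geometry using (Meet; #lines-on; coplanar⇒Meet)
  open CS using (ChSet; card; _⊆_)
  open Parts geometry using (K)
  open Trichotomy geometry using (trichotomy)
  open ClassColouring geometry using (chambers-on; card-chambers-on; too-few-classes)

  Centred : (Fin L′.size → Bool) → List Chamber → Set (c ⊔ˡ ℓ)
  Centred D S = ∀ {C} → C ∈C S → D (lnᵢ C) ≡ true

  -- What the lines through a point and the lines in a plane have in common, so that both kinds of
  -- F(x) are treated at once. A `Bundle` over a star is a list of the whole of F(x).
  record Star (D : Fin L′.size → Bool) : Set where
    field
      pairwise : ∀ {l m} → D l ≡ true → D m ≡ true → Meet l m
      count    : # D ≡ q * q + q + 1

  through-star : ∀ r → Star (λ l → pl r l)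
  through-star r = record { pairwise = λ a b → r , a , b ; count = #lines-on r }

  inside-star : ∀ f → Star (λ l → le f l)
  inside-star f = record { pairwise = coplanar⇒Meet ; count = Incidence.#lines-on (dual geometry) f }

  centred⇒independent : ∀ {D} → Star D → ∀ S → Centred D S → Independent S
  centred⇒independent st S cen C C′ c c′ (_ , skew , _) = meeting⇒¬skew {C} {C′} (Star.pairwise st (cen {C} c) (cen {C′} c′)) skew

  centred-cons : ∀ D S C → D (lnᵢ C) ≡ true → Centred D S → Centred D (C ∷ S)
  centred-cons D S C h cen {E} (here s) = subst (λ z → D z ≡ true) (sym (proj₁ (proj₂ (≈C⇒same {E} {C} s)))) h
  centred-cons D S C h cen {E} (there t) = cen {E} t

  Bundle : (Fin L′.size → Bool) → List Chamber → Set (c ⊔ˡ ℓ)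
  Bundle D S = Centred D S × (∀ {C} → D (lnᵢ C) ≡ true → C ∈C S)

  through-IsF : ∀ {r S} → Bundle (λ l → pl r l) S → IsF S
  through-IsF {r} {S} (cen , all) = inj₁ (mkPoint (vec r) (vec-nonzero r) , λ C → mk⇔
    (λ h → span-from (Chamber.ln C) (pl⇒ (cen {C} h)))
    (λ h → all {C} (pl⇐ (span-to (Chamber.ln C) h))))

  inside-IsF : ∀ {f S} → Bundle (λ l → le f l) S → IsF S
  inside-IsF {f} {S} (cen , all) = inj₂ (mkPlane (vec f) (vec-nonzero f) , λ C → mk⇔
    (λ h → lift (kills-from (Chamber.ln C) (vec f) (le⇒ (cen {C} h))))
    (λ h → all {C} (le⇐ (kills-to (Chamber.ln C) (vec f) (proj₁ (lower h)) (proj₂ (lower h))))))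

  IsF-star : ∀ {S} → IsF S → ∃ λ D → Star D × Bundle D S
  IsF-star (inj₁ (P , rep)) = _ , through-star (point-index P) ,
    (λ {C} h → pl-to {P} {Chamber.ln C} (Equivalence.to (rep C) h)) , (λ {C} h → Equivalence.from (rep C) (pl-from {P} {Chamber.ln C} h))
  IsF-star (inj₂ (π , rep)) = _ , inside-star (plane-index π) ,
    (λ {C} h → le-to {Chamber.ln C} {π} (lower (Equivalence.to (rep C) h))) , (λ {C} h → Equivalence.from (rep C) (lift (le-from {Chamber.ln C} {π} h)))

  star-size : ℕ
  star-size = (q * q + q + 1) * (suc q * suc q)

  card-star : ∀ {D} → Star D → card (chambers-on D) ≡ star-size
  card-star {D} st = trans (card-chambers-on D) (cong (_* (suc q * suc q)) (Star.count st))

  chambers-on-chambers : ∀ D → CS.Chambers (chambers-on D)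
  chambers-on-chambers D {x} {l} {e} h = ∧-elim {pl x l} (proj₁ (∧-elim {pl x l ∧ le e l} h))

  centred-length : ∀ {D} → Star D → ∀ S → UniqueC S → Centred D S → length S ≤ star-size
  centred-length {D} st S u cen = ≤-trans (length≤card S u) (≤-trans (CS.card-mono {members S} {chambers-on D} sub) (≤-reflexive (card-star st)))
    where
    sub : members S ⊆ chambers-on D
    sub h with representative S h
    ... | C , (refl , refl , refl) , c = ∧-intro (∧-intro (on C) (below C)) (cen {C} c)

  bundle-length : ∀ {D} → Star D → ∀ S → Bundle D S → star-size ≤ length S
  bundle-length {D} st S (_ , all) = ≤-trans (≤-reflexive (sym (card-star st)))
    (≤-trans (CS.card-mono {chambers-on D} {members S} sub) (card≤length S))
    where
    placed : ∀ {x l e} (xl : pl x l ≡ true) (el : le e l ≡ true) → D l ≡ true → members S x l e ≡ true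
    placed xl el d = same-members S {chamber xl el} (chamber-same xl el)
      (all {chamber xl el} (subst (λ z → D z ≡ true) (proj₁ (proj₂ (chamber-same xl el))) d))
    sub : chambers-on D ⊆ members S
    sub {x} {l} {e} h = placed (proj₁ (chambers-on-chambers D {x} {l} {e} h)) (proj₂ (chambers-on-chambers D {x} {l} {e} h))
                               (proj₂ (∧-elim {pl x l ∧ le e l} h))

  -- Without the common factor (q + 1)² this is 25(q + 1) < q² + q + 1.
  25K<star : 25 * K < star-size
  25K<star = begin-strict
    25 * K      ≡⟨ cong (25 *_) (cube-def q) ⟨
    25 * (suc q * (suc q * suc q))      ≡⟨ *-assoc 25 (suc q) (suc q * suc q) ⟨
    25 * suc q * (suc q * suc q)      <⟨ *-monoˡ-< (suc q * suc q) small ⟩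
    star-size      ∎
    where
    open ≤-Reasoning
    small : 25 * suc q < q * q + q + 1
    small = begin-strict
      25 * suc q      ≡⟨ *-suc 25 q ⟩
      25 + 25 * q      <⟨ +-monoˡ-< (25 * q) (≤-trans (m≤m+n 26 17) 43≤q) ⟩
      26 * q      ≤⟨ *-monoˡ-≤ q (≤-trans (m≤m+n 26 17) 43≤q) ⟩
      q * q      ≤⟨ m≤m+n (q * q) (q + 1) ⟩
      q * q + (q + 1)      ≡⟨ +-assoc (q * q) q 1 ⟨
      q * q + q + 1      ∎

  25K≤bound : 25 * K ≤ 9 * (q + 1) * (5 * (q * q) + 1)
  25K≤bound = begin
    25 * K      ≡⟨ cong (25 *_) (cube-def q) ⟨
    25 * (suc q * (suc q * suc q))      ≡⟨ arith₁ q ⟩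
    suc q * (25 * (q * q) + (50 * q + 25))      ≤⟨ *-monoʳ-≤ (suc q) (+-monoʳ-≤ (25 * (q * q)) (+-mono-≤ 50q≤ 25≤)) ⟩
    suc q * (25 * (q * q) + (2 * (q * q) + q * q))    ≤⟨ *-monoʳ-≤ (suc q) (m≤m+n _ (17 * (q * q) + 9)) ⟩
    suc q * (25 * (q * q) + (2 * (q * q) + q * q) + (17 * (q * q) + 9)) ≡⟨ arith₂ q ⟩
    9 * (q + 1) * (5 * (q * q) + 1)      ∎
    where
    open ≤-Reasoning
    arith₁ : ∀ q → 25 * (suc q * (suc q * suc q)) ≡ suc q * (25 * (q * q) + (50 * q + 25))
    arith₁ = solve-∀
    arith₂ : ∀ q → suc q * (25 * (q * q) + (2 * (q * q) + q * q) + (17 * (q * q) + 9)) ≡ 9 * (q + 1) * (5 * (q * q) + 1)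
    arith₂ = solve-∀
    50q≤ : 50 * q ≤ 2 * (q * q)
    50q≤ = ≤-trans (≤-reflexive (*-assoc 2 25 q)) (*-monoʳ-≤ 2 (*-monoˡ-≤ q (≤-trans (m≤m+n 25 18) 43≤q)))
    25≤ : 25 ≤ q * q
    25≤ = ≤-trans (≤-trans (m≤m+n 25 18) 43≤q) (m≤m*n q q {{>-nonZero (≤-trans (s≤s z≤n) 43≤q)}})

  list-trichotomy : ∀ S → UniqueC S → Independent S →
    (∃ λ D → Star D × Centred D S × (Bundle D S → IsF S)) ⊎ length S ≤ 25 * K
  list-trichotomy S u ind with trichotomy (members-independent S ind) (members-chambers S)
  ... | inj₁ (r , t) = inj₁ (_ , through-star r , (λ {C} h → t (in-members S {C} h)) , through-IsF)
  ... | inj₂ (inj₁ (f , i)) = inj₁ (_ , inside-star f , (λ {C} h → i (in-members S {C} h)) , inside-IsF)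
  ... | inj₂ (inj₂ b) = inj₂ (≤-trans (length≤card S u) b)

  -- A list inside a star that misses one of its chambers could be extended independently; a small
  -- list is shorter than the list `T` of all chambers whose line passes through `a-point`.
  largest⇒IsF : ∀ S → Largest S → IsF S
  largest⇒IsF S ((u , ind) , max) with list-trichotomy S u ind
  ... | inj₁ (D , st , cen , isF) = isF ((λ {C} → cen {C}) , λ {C} h → decidable-stable (C ∈C? S) (λ new →
        <⇒≱ (n<1+n (length S)) (max (C ∷ S) (All.¬Any⇒All¬ S new ∷ u , centred⇒independent st (C ∷ S) (λ {E} → centred-cons D S C h (λ {E} → cen {E}) {E})))))
  ... | inj₂ small = ⊥-elim (<⇒≱ 25K<star (≤-trans (≤-trans (bundle-length st T bundle) (max T (uT , centred⇒independent st T (λ {C} → proj₁ bundle {C})))) small))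
    where
    D = λ l → pl (Geometry.a-point geometry) l
    st = through-star (Geometry.a-point geometry)
    list = Listing.listing {chambers-on D} (λ {x l e} → chambers-on-chambers D {x} {l} {e})
    T = proj₁ list
    uT = proj₁ (proj₂ list)
    bundle : Bundle D T
    bundle = (λ {C} h → proj₂ (∧-elim {pl (ptᵢ C) (lnᵢ C) ∧ le (plᵢ C) (lnᵢ C)} (proj₂ (proj₂ (proj₂ list)) {C} h)))
           , (λ {C} h → proj₁ (proj₂ (proj₂ list)) {C} (∧-intro (∧-intro (on C) (below C)) h))

  IsF⇒largest : ∀ S → UniqueC S → IsF S → Largest S
  IsF⇒largest S u isF with IsF-star isF
  ... | D , st , bundle = (u , centred⇒independent st S (λ {C} → proj₁ bundle {C})) , longest
    where
    longest : ∀ T → IndepSet T → length T ≤ length S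
    longest T (uT , indT) with list-trichotomy T uT indT
    ... | inj₁ (D′ , st′ , cen′ , _) = ≤-trans (centred-length st′ T uT (λ {C} → cen′ {C})) (bundle-length st S bundle)
    ... | inj₂ small = ≤-trans small (≤-trans (<⇒≤ 25K<star) (bundle-length st S bundle))

  maximal-bound : ∀ S → MaximalIndep S → ¬ IsF S → length S ≤ 9 * (q + 1) * (5 * (q * q) + 1)
  maximal-bound S ((u , ind) , max) notF with list-trichotomy S u ind
  ... | inj₂ small = ≤-trans small 25K≤bound
  ... | inj₁ (D , st , cen , isF) = ⊥-elim (notF (isF ((λ {C} → cen {C}) , λ {C} h → max C (centred⇒independent st (C ∷ S)
          (λ {E} → centred-cons D S C h (λ {E} → cen {E}) {E})))))

  proper-colouring : ProperColouring (q * q + q)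
  proper-colouring = let (col , sound) = LineColouring.line-colouring geometry in
    (λ C → col (lnᵢ C)) , (λ C D h → cong col (proj₁ (proj₂ (≈C⇒same {C} {D} h)))) ,
    (λ C D (_ , skew , _) eq → meeting⇒¬skew {C} {D} (sound (lnᵢ C) (lnᵢ D) eq) skew)

  not-fewer-colours : 47 ≤ q → ∀ k → k < q * q + q → ¬ ProperColouring k
  not-fewer-colours 47≤q k k< (col , _ , proper) = too-few-classes X 47≤q k< independent chambers cover
    where
    incident? : ∀ x l e → Dec (pl x l ≡ true × le e l ≡ true)
    incident? x l e = true? (pl x l) ×-dec true? (le e l)
    -- The decision is a parameter so that membership can be analysed by matching on it; triples
    -- that are not chambers belong to no class.
    coloured : ∀ {x l e} → Fin k → Dec (pl x l ≡ true × le e l ≡ true) → Bool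
    coloured i (yes (xl , el)) = col (chamber xl el) == i
    coloured i (no _) = false
    X : Fin k → ChSet
    X i x l e = coloured i (incident? x l e)
    coloured-elim : ∀ {x l e} i (d : Dec (pl x l ≡ true × le e l ≡ true)) → coloured i d ≡ true → ∃ λ C → Same x l e C × col C ≡ i
    coloured-elim i (yes (xl , el)) h = chamber xl el , chamber-same xl el , ==-elim _ i h
    chambers : ∀ i → CS.Chambers (X i)
    chambers i {x} {l} {e} h with coloured-elim i (incident? x l e) h
    ... | C , (refl , refl , refl) , _ = on C , below C
    independent : ∀ i → CS.Independent (X i)
    independent i {x} {l} {e} {x′} {l′} {e′} h h′ with coloured-elim i (incident? x l e) h | coloured-elim i (incident? x′ l′ e′) h′
    ... | C , (refl , refl , refl) , p | D , (refl , refl , refl) , r = ¬opposite⇒meeting C D (λ opp → proper C D opp (trans p (sym r)))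
    cover : ∀ x l e → pl x l ≡ true → le e l ≡ true → ∃ λ i → X i x l e ≡ true
    cover x l e xl el = go (incident? x l e)
      where
      go : (d : Dec (pl x l ≡ true × le e l ≡ true)) → ∃ λ i → coloured i d ≡ true
      go (yes (a , b)) = col (chamber a b) , ==-refl refl
      go (no n) = ⊥-elim (n (xl , el))

theorem1p1 : ∀ {c ℓ} (R : CommutativeRing c ℓ) (q : ℕ) → IsFiniteFieldOfOrder R q → 43 ≤ q →
    let open PG3 R in
    (∀ (S : List Chamber) → UniqueC S → (Largest S ⇔ IsF S))
    × (∀ (S : List Chamber) → MaximalIndep S → ¬ IsF S → length S ≤ 9 * (q + 1) * (5 * (q * q) + 1))
    × (47 ≤ q → ChromaticNumber (q * q + q))
theorem1p1 R q F 43≤q = (λ S u → mk⇔ (largest⇒IsF S) (IsF⇒largest S u)) , maximal-bound , λ 47≤q → proper-colouring , not-fewer-colours 47≤q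
  where
  open MainTheorem R F (≤-trans (s≤s (s≤s z≤n)) 43≤q) 43≤q
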